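{- If $G$ is a natural unit interval graph, then \[ X_G(\bm x)=M_{(G,\emptyset,\emptyset)}, \] which is $e$-positive, i.e. has nonnegative coefficients in the elementary symmetric function basis.
   Context: $X_G(\bm x)=\sum_\kappa\prod_{v\in V(G)}x_{\kappa(v)}$ is the chromatic symmetric function in infinitely many variables $\bm x=(x_1,x_2,\dots)$, summed over proper colorings $\kappa:V(G)\to\{1,2,\dots\}$. $e_i$ is the elementary symmetric function in $\bm x$, $e_0=1$. A graph $G$ on $[n]=\{1,\dots,n\}$ is a natural unit interval graph if whenever $\{p,q\}$ is an edge with $p<q$, then $\{p,r\},\{r,q\}$ are edges for all $p<r<q$. Let $I_k$ be the set of $k$-tuples of distinct positive integers and $V_k$ the $\mathbb{Q}(e_1,e_2,\dots)$-vector space with basis $\{b_\sigma:\sigma\in I_k\}$; $V_0$ is one-dimensional with basis $b_\emptyset$, and a linear map $V_0\to V_0$ is identified with a scalar. For $\sigma\in I_k$ set \[ A(1\mid\sigma)=\prod_r\frac{\sigma_r-1}{\sigma_r},\qquad A(\sigma_r+1\mid\sigma)=\frac{\sigma_r+1}{\sigma_r}\prod_{r'\ne r}\frac{\sigma_r-\sigma_{r'}+1}{\sigma_r-\sigma_{r'}}, \] and $A(y\mid\sigma)=0$ for all other positive integers $y$. Define $M_k\colon V_k\to V_{k+1}$ and $D_k\colon V_k\to V_{k-1}$ by \[ M_kb_\sigma=\sum_{y\notin\sigma}A(y\mid\sigma)\,b_{\sigma,y},\qquad D_kb_\sigma=\frac{e_{\sigma_1}}{e_{\sigma_1-1}}\,b_{\sigma_2,\dots,\sigma_k},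 \] where $b_{\sigma,y}$ is indexed by $\sigma$ with $y$ appended. Definition of $M_{(G,\emptyset,\emptyset)}\colon V_0\to V_0$. Build $G$ one vertex at a time, starting with no marked vertices. For $v=1,\dots,n$ in order, let $r$ be the number of neighbors of $v$ smaller than $v$; these are the $r$ most recently marked vertices. If currently $s$ vertices are marked, apply $D_s,D_{s-1},\dots,D_{r+1}$ in this order (forgetting the oldest marked vertices), then apply $M_r$ (so that $v$ and its smaller neighbors are marked). After vertex $n$, apply operators $D$ until no vertex is marked. $M_{(G,\emptyset,\emptyset)}$ is the composition of all these operators, later steps on the left. -}

module Defs where

open import Data.Bool.Base using (if_then_else_; true; false)
open import Data.Empty using (⊥)
open import Data.Fin.Base as Fin using (Fin; toℕ)
import Data.Fin.Properties as Fin
open import Data.Integer.Base as ℤ using (ℤ; +_; +[1+_]; -[1+_])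
open import Data.List.Base as List
  using (List; []; _∷_; [_]; _++_; length; map; filter; concatMap; replicate;
         foldr; allFin; tabulate; cartesianProductWith)
open import Data.List.Properties using (≡-dec; length-replicate; length-++; ++-assoc)
open import Data.List.Relation.Unary.All as All using (All; []; _∷_)
open import Data.List.Relation.Unary.Linked using (Linked)
open import Data.Nat.Base as ℕ
  using (ℕ; zero; suc; _∸_; _≤_; _<_; _≥_; NonZero; z≤n; s≤s)
open import Data.Nat.Induction using (<-rec)
open import Data.Nat.ListAction using (sum)
import Data.Nat.Properties as ℕ
open import Data.Product.Base using (Σ; ∃; _×_; _,_; proj₁; proj₂)
open import Data.Rational.Base as ℚ using (ℚ; 0ℚ; 1ℚ)
import Data.Rational.Properties as ℚ
open import Data.Vec.Base as Vec using (Vec; []; _∷_; lookup; toList; _∷ʳ_)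
open import Data.Vec.Membership.DecPropositional ℕ._≟_ using (_∈?_)
open import Data.Vec.Membership.Propositional using (_∉_)
import Data.Vec.Relation.Unary.All as VecAll
import Data.Vec.Relation.Unary.Any as VecAny
import Data.Vec.Relation.Unary.AllPairs as AllPairs
open import Data.Vec.Relation.Unary.Unique.Propositional using (Unique)
open import Level using (0ℓ)
open import Relation.Binary.Core using (Rel)
open import Relation.Binary.Definitions using (Decidable; Irreflexive; Symmetric; tri<; tri≈; tri>)
open import Relation.Binary.PropositionalEquality
  using (_≡_; _≢_; refl; sym; trans; cong; cong₂; subst; module ≡-Reasoning)
open import Relation.Nullary using (¬_; Dec; yes; no; does; contradiction)
open import Relation.Nullary.Decidable
  using (_×-dec_; _→-dec_; ¬?; decidable-stable; does-⇔)
open import Function.Base using (_∘_)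
open import Function.Bundles using (mk⇔)

open import Algebra.Properties.CommutativeMonoid.Sum ℚ.+-0-commutativeMonoid
  using (sum-syntax; sum⁺-syntax; sum-cong-≗)
open import Algebra.Properties.CommutativeMonoid.Sum ℚ.*-1-commutativeMonoid
  using () renaming (sum to product)

product-syntax : ∀ n → (Fin n → ℚ) → ℚ
product-syntax _ = product

syntax product-syntax n (λ i → x) = ∏[ i < n ] x

private variable
  n k l : ℕ

-- Formal power series in x₁, x₂, …: F (α₁ ∷ … ∷ αₘ ∷ []) is the
-- coefficient of x₁^α₁ ⋯ xₘ^αₘ.  Lists which differ by trailing zeros
-- denote the same monomial.
Series : Set
Series = List ℕ → ℚ

infix 4 _≈_
_≈_ : Rel Series 0ℓ
F ≈ H = ∀ α → F α ≡ H α

const : ℚ → Series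
const q α = if does (All.all? (ℕ._≟ 0) α) then q else 0ℚ

infixl 6 _⊕_
_⊕_ : Series → Series → Series
(F ⊕ H) α = F α ℚ.+ H α

-- F restricted to the monomials in which the first variable has exponent
-- i, as a series in the remaining variables.
slice : Series → ℕ → Series
slice F i α = F (i ∷ α)

infixl 7 _⊗_
_⊗_ : Series → Series → Series
(F ⊗ H) []      = F [] ℚ.* H []
(F ⊗ H) (m ∷ α) = ∑[ i ≤ m ] (slice F (toℕ i) ⊗ slice H (m ∸ toℕ i)) α

-- eᵢ is the sum of all squarefree monomials of degree i.
e : ℕ → Series
e i α = if does (All.all? (ℕ._≤? 1) α ×-dec sum α ℕ.≟ i) then 1ℚ else 0ℚ

record Partition : Set where
  field
    parts    : List ℕ
    positive : All NonZero parts
    ordered  : Linked _≥_ parts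

e-basis : Partition → Series
e-basis λ′ = foldr _⊗_ (const 1ℚ) (map e (Partition.parts λ′))

e-combination : List (ℚ × Partition) → Series
e-combination = foldr (λ (c , λ′) F → (const c ⊗ e-basis λ′) ⊕ F) (const 0ℚ)

-- Repeated partitions are harmless: their coefficients add up.
EPositive : Series → Set
EPositive F = ∃ λ terms → All (λ (c , _) → 0ℚ ℚ.≤ c) terms × F ≈ e-combination terms

record Graph (n : ℕ) : Set₁ where
  infix 4 _~_ _~?_
  field
    _~_    : Rel (Fin n) 0ℓ
    _~?_   : Decidable _~_
    symm   : Symmetric _~_
    irrefl : Irreflexive _≡_ _~_

NaturalUnitInterval : Graph n → Set
NaturalUnitInterval G =
  ∀ {p q} → p ~ q → p Fin.< q → ∀ r → p Fin.< r → r Fin.< q → p ~ r × r ~ q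
  where open Graph G

Proper : Graph n → Vec (Fin l) n → Set
Proper G κ = ∀ u v → u ~ v → lookup κ u ≢ lookup κ v
  where open Graph G

proper? : (G : Graph n) (κ : Vec (Fin l) n) → Dec (Proper G κ)
proper? G κ = Fin.all? λ u → Fin.all? λ v →
  (u ~? v) →-dec ¬? (lookup κ u Fin.≟ lookup κ v)
  where open Graph G

colourings : ∀ n l → List (Vec (Fin l) n)
colourings zero    l = [ [] ]
colourings (suc n) l = cartesianProductWith _∷_ (allFin l) (colourings n l)

-- The exponents of the monomial ∏ᵥ x_κ(v).
content : Vec (Fin l) n → List ℕ
content κ = tabulate λ c → Vec.count (Fin._≟ c) κ

-- A colouring contributing to x^α only uses the first length α colours.
X : Graph n → Series
X {n} G α = + length (filter (λ κ → proper? G κ ×-dec ≡-dec ℕ._≟_ (content κ) α)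
                             (colourings n (length α))) ℚ./ 1

------------------------------------------------------------------------
-- ℚ[e₁, e₂, …] as the subring of the power series generated by
-- ℚ and the eᵢ.  Elements are to be compared through ⟦_⟧.

infixl 6 _⊞_
infixl 7 _⊠_
data ℚ[e] : Set where
  con     : ℚ → ℚ[e]
  gen     : ℕ → ℚ[e]
  _⊞_ _⊠_ : ℚ[e] → ℚ[e] → ℚ[e]

⟦_⟧ : ℚ[e] → Series
⟦ con q ⟧ = const q
⟦ gen i ⟧ = e i
⟦ P ⊞ Q ⟧ = ⟦ P ⟧ ⊕ ⟦ Q ⟧
⟦ P ⊠ Q ⟧ = ⟦ P ⟧ ⊗ ⟦ Q ⟧

-- The lemmas up to ⊠-nonZero show that ℚ[e₁, e₂, …] has no zero divisors,
-- which is what makes sums and products of fractions well defined.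
NonZeroPoly : ℚ[e] → Set
NonZeroPoly P = ¬ (⟦ P ⟧ ≈ const 0ℚ)

const-0 : ∀ α → const 0ℚ α ≡ 0ℚ
const-0 α with does (All.all? (ℕ._≟ 0) α)
... | true  = refl
... | false = refl

∑-0 : ∀ m {t : Fin m → ℚ} → (∀ i → t i ≡ 0ℚ) → ∑[ i < m ] t i ≡ 0ℚ
∑-0 zero    t≡0 = refl
∑-0 (suc m) t≡0 = cong₂ ℚ._+_ (t≡0 Fin.zero) (∑-0 m (t≡0 ∘ Fin.suc))

∑-single : ∀ {m} {t : Fin m → ℚ} j → (∀ i → i ≢ j → t i ≡ 0ℚ) → ∑[ i < m ] t i ≡ t j
∑-single {suc m} {t} Fin.zero    t≡0 =
  trans (cong (t Fin.zero ℚ.+_) (∑-0 m λ i → t≡0 (Fin.suc i) λ ())) (ℚ.+-identityʳ (t Fin.zero))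
∑-single {suc m} {t} (Fin.suc j) t≡0 =
  trans (cong₂ ℚ._+_ (t≡0 Fin.zero λ ())
                     (∑-single j λ i i≢j → t≡0 (Fin.suc i) (i≢j ∘ Fin.suc-injective)))
        (ℚ.+-identityˡ (t (Fin.suc j)))

*-nonZero : ∀ p q → p ≢ 0ℚ → q ≢ 0ℚ → p ℚ.* q ≢ 0ℚ
*-nonZero p q p≢0 q≢0 pq≡0 = q≢0 (begin
  q                         ≡⟨ ℚ.*-identityˡ q ⟨
  1ℚ ℚ.* q                  ≡⟨ cong (ℚ._* q) (ℚ.*-inverseˡ p) ⟨
  (ℚ.1/ p) ℚ.* p ℚ.* q      ≡⟨ ℚ.*-assoc (ℚ.1/ p) p q ⟩
  (ℚ.1/ p) ℚ.* (p ℚ.* q)    ≡⟨ cong ((ℚ.1/ p) ℚ.*_) pq≡0 ⟩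
  (ℚ.1/ p) ℚ.* 0ℚ           ≡⟨ ℚ.*-zeroʳ (ℚ.1/ p) ⟩
  0ℚ                        ∎)
  where
  open ≡-Reasoning
  instance _ = ℚ.≢-nonZero p≢0

-- F vanishes when all but the first m variables are set to zero.
VanishesIn : ℕ → Series → Set
VanishesIn m F = ∀ α → length α ≡ m → F α ≡ 0ℚ

VanishesIn-stable : ∀ m F → ¬ ¬ VanishesIn m F → VanishesIn m F
VanishesIn-stable m F ¬¬v α |α|≡m =
  decidable-stable (F α ℚ.≟ 0ℚ) λ Fα≢0 → ¬¬v λ v → Fα≢0 (v α |α|≡m)

⊗-zeroˡ : ∀ m {F} H → VanishesIn m F → VanishesIn m (F ⊗ H)
⊗-zeroˡ zero    H v []      refl = trans (cong (ℚ._* H []) (v [] refl)) (ℚ.*-zeroˡ (H []))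
⊗-zeroˡ (suc m) H v (a ∷ α) eq   = ∑-0 (suc a) λ i →
  ⊗-zeroˡ m (slice H (a ∸ toℕ i)) (λ β |β|≡m → v (toℕ i ∷ β) (cong suc |β|≡m))
    α (ℕ.suc-injective eq)

⊗-zeroʳ : ∀ m F {H} → VanishesIn m H → VanishesIn m (F ⊗ H)
⊗-zeroʳ zero    F v []      refl = trans (cong (F [] ℚ.*_) (v [] refl)) (ℚ.*-zeroʳ (F []))
⊗-zeroʳ (suc m) F v (a ∷ α) eq   = ∑-0 (suc a) λ i →
  ⊗-zeroʳ m (slice F (toℕ i)) (λ β |β|≡m → v (a ∸ toℕ i ∷ β) (cong suc |β|≡m))
    α (ℕ.suc-injective eq)

LeastNonZeroSlice : ℕ → Series → ℕ → Set
LeastNonZeroSlice m F i =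
  ¬ VanishesIn m (slice F i) × (∀ {j} → j < i → VanishesIn m (slice F j))

least-slice : ∀ m F → ¬ VanishesIn (suc m) F → ¬ ¬ ∃ (LeastNonZeroSlice m F)
least-slice m F ¬v none = ¬v λ { (i ∷ α) eq → slices i α (ℕ.suc-injective eq) }
  where
  slices : ∀ i → VanishesIn m (slice F i)
  slices = <-rec _ λ i below → VanishesIn-stable m (slice F i) λ ¬vᵢ → none (i , ¬vᵢ , below)

⊗-nonZeroIn : ∀ m F H → ¬ VanishesIn m F → ¬ VanishesIn m H → ¬ VanishesIn m (F ⊗ H)
⊗-nonZeroIn zero    F H ¬vF ¬vH v =
  *-nonZero (F []) (H []) (λ z → ¬vF λ { [] _ → z }) (λ z → ¬vH λ { [] _ → z }) (v [] refl)
⊗-nonZeroIn (suc m) F H ¬vF ¬vH v =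
  least-slice m F ¬vF λ (i , Fᵢ≢0 , F<i) → least-slice m H ¬vH λ (j , Hⱼ≢0 , H<j) →
  ⊗-nonZeroIn m (slice F i) (slice H j) Fᵢ≢0 Hⱼ≢0 (leading i j F<i H<j)
  where
  module _ i j (F<i : ∀ {a} → a < i → VanishesIn m (slice F a))
               (H<j : ∀ {b} → b < j → VanishesIn m (slice H b)) where
    i≤ : i < suc (i ℕ.+ j)
    i≤ = s≤s (ℕ.m≤m+n i j)

    leading : VanishesIn m (slice F i ⊗ slice H j)
    leading α |α|≡m = begin
      (slice F i ⊗ slice H j) α                      ≡⟨ cong₂ t (Fin.toℕ-fromℕ< i≤) (ℕ.m+n∸m≡n i j) ⟨
      t (toℕ i′) ((i ℕ.+ j) ∸ i)                      ≡⟨ cong (λ z → t (toℕ i′) ((i ℕ.+ j) ∸ z)) (Fin.toℕ-fromℕ< i≤) ⟨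
      t (toℕ i′) ((i ℕ.+ j) ∸ toℕ i′)                 ≡⟨ ∑-single i′ others ⟨
      (F ⊗ H) ((i ℕ.+ j) ∷ α)                         ≡⟨ v ((i ℕ.+ j) ∷ α) (cong suc |α|≡m) ⟩
      0ℚ                                             ∎
      where
      open ≡-Reasoning
      i′ = Fin.fromℕ< i≤
      t : ℕ → ℕ → ℚ
      t a b = (slice F a ⊗ slice H b) α
      others : ∀ a → a ≢ i′ → t (toℕ a) ((i ℕ.+ j) ∸ toℕ a) ≡ 0ℚ
      others a a≢i′ with ℕ.<-cmp (toℕ a) i
      ... | tri< a<i _ _ = ⊗-zeroˡ m (slice H ((i ℕ.+ j) ∸ toℕ a)) (F<i a<i) α |α|≡m
      ... | tri≈ _ a≡i _ =
        contradiction (Fin.toℕ-injective (trans a≡i (sym (Fin.toℕ-fromℕ< i≤)))) a≢i′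
      ... | tri> _ _ i<a = ⊗-zeroʳ m (slice F (toℕ a)) (H<j below) α |α|≡m
        where
        below : (i ℕ.+ j) ∸ toℕ a < j
        below = subst ((i ℕ.+ j) ∸ toℕ a <_) (ℕ.m+n∸m≡n i j)
                  (ℕ.∸-monoʳ-< i<a (ℕ.s≤s⁻¹ (Fin.toℕ<n a)))

TrailingZeros : Series → Set
TrailingZeros F = ∀ α → F (α ++ [ 0 ]) ≡ F α

if-⇔ : ∀ {A B : Set} (a? : Dec A) (b? : Dec B) {x y : ℚ} → (A → B) → (B → A) →
       (if does a? then x else y) ≡ (if does b? then x else y)
if-⇔ a? b? f g = cong (λ b → if b then _ else _) (does-⇔ (mk⇔ f g) a? b?)

All-++0 : ∀ {P : ℕ → Set} → P 0 → ∀ {α} → All P α → All P (α ++ [ 0 ])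
All-++0 p []         = p ∷ []
All-++0 p (q ∷ rest) = q ∷ All-++0 p rest

All-++0⁻ : ∀ {P : ℕ → Set} α → All P (α ++ [ 0 ]) → All P α
All-++0⁻ []      _          = []
All-++0⁻ (_ ∷ α) (q ∷ rest) = q ∷ All-++0⁻ α rest

sum-++0 : ∀ α → sum (α ++ [ 0 ]) ≡ sum α
sum-++0 []      = refl
sum-++0 (a ∷ α) = cong (a ℕ.+_) (sum-++0 α)

⊗-trailing : ∀ F H → TrailingZeros F → TrailingZeros H → TrailingZeros (F ⊗ H)
⊗-trailing F H tF tH []      = trans (ℚ.+-identityʳ _) (cong₂ ℚ._*_ (tF []) (tH []))
⊗-trailing F H tF tH (a ∷ α) = sum-cong-≗ {suc a} λ i →
  ⊗-trailing (slice F (toℕ i)) (slice H (a ∸ toℕ i))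
    (λ β → tF (toℕ i ∷ β)) (λ β → tH (a ∸ toℕ i ∷ β)) α

⟦⟧-trailing : ∀ P → TrailingZeros ⟦ P ⟧
⟦⟧-trailing (con q) α = if-⇔ (All.all? (ℕ._≟ 0) (α ++ [ 0 ])) (All.all? (ℕ._≟ 0) α)
  (All-++0⁻ α) (All-++0 refl)
⟦⟧-trailing (gen i) α =
  if-⇔ (All.all? (ℕ._≤? 1) (α ++ [ 0 ]) ×-dec sum (α ++ [ 0 ]) ℕ.≟ i)
       (All.all? (ℕ._≤? 1) α ×-dec sum α ℕ.≟ i)
       (λ (a , s) → All-++0⁻ α a , trans (sym (sum-++0 α)) s)
       (λ (a , s) → All-++0 z≤n a , trans (sum-++0 α) s)
⟦⟧-trailing (P ⊞ Q) α = cong₂ ℚ._+_ (⟦⟧-trailing P α) (⟦⟧-trailing Q α)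
⟦⟧-trailing (P ⊠ Q) = ⊗-trailing ⟦ P ⟧ ⟦ Q ⟧ (⟦⟧-trailing P) (⟦⟧-trailing Q)

trailing-replicate : ∀ {F} → TrailingZeros F → ∀ d α → F (α ++ replicate d 0) ≡ F α
trailing-replicate {F} tF zero    []      = refl
trailing-replicate {F} tF zero    (a ∷ α) = trailing-replicate (λ β → tF (a ∷ β)) zero α
trailing-replicate {F} tF (suc d) α       = begin
  F (α ++ 0 ∷ replicate d 0)          ≡⟨ cong F (++-assoc α [ 0 ] (replicate d 0)) ⟨
  F ((α ++ [ 0 ]) ++ replicate d 0)   ≡⟨ trailing-replicate tF d (α ++ [ 0 ]) ⟩
  F (α ++ [ 0 ])                      ≡⟨ tF α ⟩
  F α                                 ∎
  where open ≡-Reasoning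

nonZeroIn-mono : ∀ {F m α} → TrailingZeros F → F α ≢ 0ℚ → length α ≤ m → ¬ VanishesIn m F
nonZeroIn-mono {F} {m} {α} tF Fα≢0 |α|≤m v = Fα≢0 (begin
  F α                   ≡⟨ trailing-replicate tF d α ⟨
  F (α ++ replicate d 0) ≡⟨ v (α ++ replicate d 0) |α++0|≡m ⟩
  0ℚ                    ∎)
  where
  open ≡-Reasoning
  d = m ∸ length α
  |α++0|≡m : length (α ++ replicate d 0) ≡ m
  |α++0|≡m = trans (length-++ α)
    (trans (cong (length α ℕ.+_) (length-replicate d)) (ℕ.m+[n∸m]≡n |α|≤m))

⊠-nonZero : ∀ P Q → NonZeroPoly P → NonZeroPoly Q → NonZeroPoly (P ⊠ Q)
⊠-nonZero P Q P≉0 Q≉0 PQ≈0 =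
  witness P P≉0 λ (α , Pα≢0) → witness Q Q≉0 λ (β , Qβ≢0) →
  let m = length α ℕ.+ length β in
  ⊗-nonZeroIn m ⟦ P ⟧ ⟦ Q ⟧
    (nonZeroIn-mono (⟦⟧-trailing P) Pα≢0 (ℕ.m≤m+n _ _))
    (nonZeroIn-mono (⟦⟧-trailing Q) Qβ≢0 (ℕ.m≤n+m _ _))
    (λ γ _ → trans (PQ≈0 γ) (const-0 γ))
  where
  witness : ∀ R → NonZeroPoly R → ¬ ¬ ∃ λ α → ⟦ R ⟧ α ≢ 0ℚ
  witness R R≉0 none = R≉0 λ α → trans
    (decidable-stable (⟦ R ⟧ α ℚ.≟ 0ℚ) λ Rα≢0 → none (α , Rα≢0))
    (sym (const-0 α))

const-nonZero : ∀ {q} → q ≢ 0ℚ → NonZeroPoly (con q)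
const-nonZero q≢0 q≈0 = q≢0 (q≈0 [])

-- The coefficient of x₁ ⋯ xᵢ in eᵢ is 1.
gen-nonZero : ∀ i → NonZeroPoly (gen i)
gen-nonZero i eᵢ≈0 =
  ℚ.1≢0 (trans (sym coeff-1) (trans (eᵢ≈0 (replicate i 1)) (const-0 (replicate i 1))))
  where
  all≤1 : ∀ j → All (_≤ 1) (replicate j 1)
  all≤1 zero    = []
  all≤1 (suc j) = s≤s z≤n ∷ all≤1 j
  sum-1 : ∀ j → sum (replicate j 1) ≡ j
  sum-1 zero    = refl
  sum-1 (suc j) = cong suc (sum-1 j)
  coeff-1 : e i (replicate i 1) ≡ 1ℚ
  coeff-1 = if-⇔ (All.all? (ℕ._≤? 1) (replicate i 1) ×-dec sum (replicate i 1) ℕ.≟ i) (yes refl)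
    (λ _ → refl {x = i}) (λ _ → all≤1 i , sum-1 i)

infix 5 _//_⟨_⟩
record ℚ⟨e⟩ : Set where
  constructor _//_⟨_⟩
  field
    num    : ℚ[e]
    den    : ℚ[e]
    den-≉0 : NonZeroPoly den

fromℚ : ℚ → ℚ⟨e⟩
fromℚ q = con q // con 1ℚ ⟨ const-nonZero ℚ.1≢0 ⟩

infixl 6 _+ᶠ_
_+ᶠ_ : ℚ⟨e⟩ → ℚ⟨e⟩ → ℚ⟨e⟩
(P // Q ⟨ Q≉0 ⟩) +ᶠ (R // S ⟨ S≉0 ⟩) =
  (P ⊠ S ⊞ R ⊠ Q) // (Q ⊠ S) ⟨ ⊠-nonZero Q S Q≉0 S≉0 ⟩

infixl 7 _*ᶠ_
_*ᶠ_ : ℚ⟨e⟩ → ℚ⟨e⟩ → ℚ⟨e⟩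
(P // Q ⟨ Q≉0 ⟩) *ᶠ (R // S ⟨ S≉0 ⟩) =
  (P ⊠ R) // (Q ⊠ S) ⟨ ⊠-nonZero Q S Q≉0 S≉0 ⟩

e-ratio : ℕ → ℕ → ℚ⟨e⟩
e-ratio i j = gen i // gen j ⟨ gen-nonZero j ⟩

-- Equality of a power series with an element of ℚ(e₁, e₂, …), i.e. of
-- F/1 with num/den, fractions being compared by cross-multiplication.
infix 4 _≈ᶠ_
_≈ᶠ_ : Series → ℚ⟨e⟩ → Set
F ≈ᶠ φ = F ⊗ ⟦ den ⟧ ≈ ⟦ num ⟧
  where open ℚ⟨e⟩ φ

record I (k : ℕ) : Set where
  field
    entries   : Vec ℕ k
    .positive : VecAll.All NonZero entries
    .distinct : Unique entries

open I using (entries)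

∅ : I 0
∅ = record { entries = [] ; positive = VecAll.[] ; distinct = AllPairs.[] }

uncons : I (suc k) → ℕ × I k
uncons record { entries = s ∷ σ ; positive = p ; distinct = d } =
  s , record { entries = σ ; positive = VecAll.tail p ; distinct = AllPairs.tail d }

All-∷ʳ : ∀ {P : ℕ → Set} {σ : Vec ℕ k} {y} → VecAll.All P σ → P y → VecAll.All P (σ ∷ʳ y)
All-∷ʳ VecAll.[]       q = q VecAll.∷ VecAll.[]
All-∷ʳ (p VecAll.∷ ps) q = p VecAll.∷ All-∷ʳ ps q

Unique-∷ʳ : {σ : Vec ℕ k} {y : ℕ} → Unique σ → y ∉ σ → Unique (σ ∷ʳ y)
Unique-∷ʳ AllPairs.[]       y∉σ = VecAll.[] AllPairs.∷ AllPairs.[]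
Unique-∷ʳ (d AllPairs.∷ ds) y∉σ =
  All-∷ʳ d (λ s≡y → y∉σ (VecAny.here (sym s≡y))) AllPairs.∷ Unique-∷ʳ ds (y∉σ ∘ VecAny.there)

append : (σ : I k) (y : ℕ) .{{_ : NonZero y}} → .(y ∉ entries σ) → I (suc k)
append record { entries = σ ; positive = p ; distinct = d } y {{y≢0}} y∉σ = record
  { entries = σ ∷ʳ y ; positive = All-∷ʳ p y≢0 ; distinct = Unique-∷ʳ d y∉σ }

-- Formal linear combinations of the basis vectors b_σ.
V : ℕ → Set
V k = List (ℚ⟨e⟩ × I k)

b : I k → V k
b σ = [ (fromℚ 1ℚ , σ) ]

infixr 7 _·_
_·_ : ℚ⟨e⟩ → V k → V k
c · x = map (λ (d , σ) → (c *ᶠ d , σ)) x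

linear : (I k → V l) → V k → V l
linear f = concatMap λ (c , σ) → c · f σ

-- The coefficient of b_∅; every element of I 0 equals ∅.
scalar : V 0 → ℚ⟨e⟩
scalar = foldr (λ (c , _) s → c +ᶠ s) (fromℚ 0ℚ)

-- Division by 0, which does not occur below as the entries of σ are
-- positive and distinct, gives 0.
infixl 7 _÷_
_÷_ : ℤ → ℤ → ℚ
a ÷ (+ zero)   = 0ℚ
a ÷ +[1+ m ]   = a ℚ./ suc m
a ÷ -[1+ m ]   = (ℤ.- a) ℚ./ suc m

A-one : I k → ℚ
A-one {k} σ = ∏[ r < k ] ((+ s r ℤ.- + 1) ÷ (+ s r))
  where s = lookup (entries σ)

A-next : I k → Fin k → ℚ
A-next {k} σ r =
  ((+ s r ℤ.+ + 1) ÷ (+ s r)) ℚ.*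
  ∏[ r′ < k ] (if does (r′ Fin.≟ r) then 1ℚ
               else (+ s r ℤ.- + s r′ ℤ.+ + 1) ÷ (+ s r ℤ.- + s r′))
  where s = lookup (entries σ)

A : ℕ → I k → ℚ
A y σ with y ℕ.≟ 1 | Fin.any? (λ r → y ℕ.≟ lookup (entries σ) r ℕ.+ 1)
... | yes _ | _           = A-one σ
... | no _  | yes (r , _) = A-next σ r
... | no _  | no _        = 0ℚ

summand : I k → ℕ → V (suc k)
summand σ y-1 with suc y-1 ∈? entries σ
... | yes _  = []
... | no y∉σ = fromℚ (A (suc y-1) σ) · b (append σ (suc y-1) y∉σ)

-- A(y ∣ σ) = 0 unless y - 1 is 0 or an entry of σ, so the sum over all
-- y ∉ σ reduces to these values, which are pairwise distinct.
M : V k → V (suc k)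
M = linear λ σ → concatMap (summand σ) (0 ∷ toList (entries σ))

D : V (suc k) → V k
D = linear λ σ → let (s , σ′) = uncons σ in e-ratio s (s ∸ 1) · b σ′

forget : ∀ d → V k → V (k ∸ d)
forget zero            x = x
forget {zero}  (suc d) x = x
forget {suc k} (suc d) x = forget d (D x)

forgetAll : V k → V 0
forgetAll {zero}  x = x
forgetAll {suc k} x = forgetAll (D x)

module _ (G : Graph n) where
  open Graph G

  smallerNeighbours : Fin n → List (Fin n)
  smallerNeighbours v = filter (λ u → (u Fin.<? v) ×-dec (u ~? v)) (allFin n)

  -- Adds the listed vertices in turn, then forgets all marked ones.  For a
  -- natural unit interval graph always r ≤ s, hence s ∸ (s ∸ r) = r.
  build : ∀ {s} → List (Fin n) → V s → V 0
  build         []       x = forgetAll x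
  build {s = s} (v ∷ vs) x = build vs (M (forget (s ∸ r) x))
    where r = length (smallerNeighbours v)

  M-operator : V 0 → V 0
  M-operator = build (allFin n)

  M[_,∅,∅] : ℚ⟨e⟩
  M[_,∅,∅] = scalar (M-operator (b ∅))

{-# OPTIONS --safe #-}

-- Weight the tuples of distinct colours of the marked vertices by x^a, where
-- a = (a₁, …, aₖ) lists the marked vertices oldest first, and sum over all colours.
-- Marking a vertex then appends 1 to a, and forgetting the oldest vertex gives
--   p_{a₁}·(a₂, …, aₖ) − ∑ⱼ (a₂, …, aⱼ + a₁, …, aₖ).
-- The idea is that V_k contains vectors Φ(a) obeying the same two rules, so that
-- both sides of the theorem are the same polynomial in the power sums.  For
-- R = MD − DM put Φ(a, 1) = M Φ(a) and Φ(a₂, …, aₖ, a₁ + 1) = R Φ(a₁, …, aₖ).  The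
-- rule for D holds because the symmetric group acts on V_k in Young's seminormal
-- form, s b_{ij} = 1/d b_{ij} + (1 − 1/d) b_{ji} with d = j − i, so as to permute
-- the Φ(a); this rests on
--   s M M = M M,   D D s = D D,   (1 + s) M D M = M M D + D M M   and
--   D M D (1 + s) = M D D + D D M.
-- On one marked vertex, D Rᵐ M b_∅ = p_{m+1} is Newton's identity.
-- For positivity, all A(y ∣ σ) are nonnegative, and a maximal chain i, i + 1, …, j
-- of entries, each extending the previous one, contributes
-- (e_i/e_{i−1}) ⋯ (e_j/e_{j−1}) = e_j/e_{i−1}.
module Submission where

open import Defs
open import Data.Nat.Base using (ℕ)
open import Data.Product.Base using (_×_)

open import Algebra.Bundles using (CommutativeRing)
import Algebra.Solver.Ring
open import Algebra.Solver.Ring.AlmostCommutativeRing using (fromCommutativeRing; _-Raw-AlmostCommutative⟶_)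
open import Data.Bool.Base using (if_then_else_; true; false)
open import Data.Empty using (⊥-elim)
open import Data.Fin.Base as Fin using (Fin; zero; suc; toℕ)
import Data.Fin.Properties as Fin
open import Data.Integer.Base as ℤ using (ℤ; +_; +[1+_]; -[1+_]; _⊖_)
import Data.Integer.Properties as ℤ
import Data.Integer.Tactic.RingSolver as ℤ-Solver
open import Data.List.Base as List
  using (List; []; _∷_; _++_; length; filter; take; foldr; concatMap; cartesianProductWith)
import Data.List.Membership.DecPropositional as DecMembership
import Data.List.Membership.Propositional as ListMembership
import Data.List.Properties as List
open import Data.List.Relation.Unary.All as All using ([]; _∷_)
import Data.List.Relation.Unary.All.Properties as All
open import Data.List.Relation.Unary.Any using (here; there)
open import Data.List.Relation.Unary.Linked using (Linked; []; [-]; _∷_)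
open import Data.Maybe.Base using (Maybe; just; nothing; maybe)
open import Data.Maybe.Properties using (just-injective)
open import Data.Nat.Base as ℕ using (zero; suc; _∸_; _≤_; _<_; _≥_; z≤n; s≤s; NonZero)
import Data.Nat.ListAction as ℕ
import Data.Nat.Properties as ℕ
open import Data.Product.Base using (Σ; _,_; proj₁; proj₂)
open import Data.Rational.Base as ℚ using (ℚ; 0ℚ; 1ℚ; toℚᵘ)
import Data.Rational.Properties as ℚ
open import Data.Rational.Solver using () renaming (module +-*-Solver to ℚ-Solver)
open import Data.Rational.Unnormalised.Base as ℚᵘ using (mkℚᵘ; *≡*)
import Data.Rational.Unnormalised.Properties as ℚᵘ
open import Data.Sum.Base using (inj₁; inj₂)
open import Data.Unit.Base using (⊤; tt)
open import Data.Vec.Base as Vec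
  using (Vec; []; _∷_; _∷ʳ_; init; last; initLast; lookup; reverse; toList; allFin; tabulate)
open import Data.Vec.Membership.DecPropositional ℕ._≟_ using (_∈?_)
open import Data.Vec.Membership.Propositional using (_∈_; _∉_)
open import Data.Vec.Membership.Propositional.Properties using (∈-lookup)
open import Data.Vec.Properties using (init-∷ʳ; last-∷ʳ; tabulate-∘; toList-∷ʳ; length-toList; reverse-∷)
open import Data.Vec.Relation.Unary.All as VecAll using ([]; _∷_)
open import Data.Vec.Relation.Unary.AllPairs using ([]; _∷_; allPairs?)
open import Data.Vec.Relation.Unary.Any as VecAny using (here; there)
open import Data.Vec.Relation.Unary.Any.Properties using (lookup-index)
open import Data.Vec.Relation.Unary.Unique.Propositional using (Unique)
open import Function.Base using (_∘_; id; flip)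
open import Level using (0ℓ)
open import Relation.Binary.Definitions using (tri<; tri≈; tri>)
open import Relation.Binary.PropositionalEquality as ≡ using (_≡_; _≢_; module ≡-Reasoning)
open import Relation.Nullary using (Dec; ¬_; does; yes; no; contradiction; recompute)
open import Relation.Nullary.Decidable using (_×-dec_; ¬?; decidable-stable)
open import Relation.Unary using (Decidable)

-- The operator R is read off from colours: M D lets the new vertex repeat the colour of the vertex
-- just forgotten, D M does not, so in M D - D M the new vertex takes over the oldest colour and its
-- exponent grows by 1. The two sides of the theorem live in different rings: the ratios e_s/e_{s-1}
-- exist only among fractions, the variables only among power series. Each step is therefore carried
-- by a witness in ℚ[e₁, e₂, ...] whose image among the fractions is the operator side and whose
-- coefficients at exponent lists of length l are those of the colour sum with l colours, for every
-- l. The operators act on functionals instead of formal combinations, which makes equality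
-- pointwise and reverses compositions: `D* (M* f)` is f precomposed with M D. Pointwise equality is
-- only asked for tuples of distinct positive entries, since 1/d and the weights of A have poles
-- elsewhere.

private variable
  k l m n : ℕ
  B C : Set


-- Reciprocals of integers and the factors (d + 1)/d of A

module Reciprocals where
  open ≡
  open import Data.Rational.Base using (_*_; _+_; _-_; -_)

  open ℚ-Solver using (solve; _:=_; _:+_; _:*_; _:-_; :-_; con)

  fromℤ : ℤ → ℚ
  fromℤ a = a ℚ./ 1

  -- κ d = 1/d, except that κ 0 = 0, hence β 0 = 1.
  κ : ℤ → ℚ
  κ d = + 1 ÷ d

  β : ℤ → ℚ
  β d = 1ℚ + κ d

  toℚᵘ-/ : ∀ a m → toℚᵘ (a ℚ./ suc m) ℚᵘ.≃ mkℚᵘ a m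
  toℚᵘ-/ a m = ℚ.toℚᵘ-fromℚᵘ (mkℚᵘ a m)

  fromℤ-+ : ∀ a b → fromℤ (a ℤ.+ b) ≡ fromℤ a + fromℤ b
  fromℤ-+ a b = ℚ.toℚᵘ-injective (ℚᵘ.≃-trans (toℚᵘ-/ (a ℤ.+ b) 0) (ℚᵘ.≃-sym
    (ℚᵘ.≃-trans (ℚ.toℚᵘ-homo-+ (fromℤ a) (fromℤ b))
      (ℚᵘ.≃-trans (ℚᵘ.+-cong (toℚᵘ-/ a 0) (toℚᵘ-/ b 0)) (*≡* (eq a b))))))
    where
    eq : ∀ a b → (a ℤ.* + 1 ℤ.+ b ℤ.* + 1) ℤ.* + 1 ≡ (a ℤ.+ b) ℤ.* + 1
    eq = ℤ-Solver.solve-∀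

  fromℤ-neg : ∀ a → fromℤ (ℤ.- a) ≡ - fromℤ a
  fromℤ-neg a = ℚ.toℚᵘ-injective (ℚᵘ.≃-trans (toℚᵘ-/ (ℤ.- a) 0) (ℚᵘ.≃-sym
    (ℚᵘ.≃-trans (ℚ.toℚᵘ-homo‿- (fromℤ a)) (ℚᵘ.-‿cong (toℚᵘ-/ a 0)))))

  fromℤ-*-/ : ∀ a m → fromℤ a * (+ 1 ℚ./ suc m) ≡ a ℚ./ suc m
  fromℤ-*-/ a m = ℚ.toℚᵘ-injective (ℚᵘ.≃-trans (ℚ.toℚᵘ-homo-* (fromℤ a) (+ 1 ℚ./ suc m))
    (ℚᵘ.≃-trans (ℚᵘ.*-cong (toℚᵘ-/ a 0) (toℚᵘ-/ (+ 1) m)) (ℚᵘ.≃-trans (*≡* (eq a (+ suc m)))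
    (ℚᵘ.≃-sym (toℚᵘ-/ a m)))))
    where
    eq : ∀ a m → (a ℤ.* + 1) ℤ.* m ≡ a ℤ.* (+ 1 ℤ.* m)
    eq = ℤ-Solver.solve-∀

  n/n≡1 : ∀ m → + suc m ℚ./ suc m ≡ 1ℚ
  n/n≡1 m = ℚ.toℚᵘ-injective (ℚᵘ.≃-trans (toℚᵘ-/ (+ suc m) m) (*≡* (ℤ.*-comm (+ suc m) (+ 1))))

  κ-neg : ∀ d → κ (ℤ.- d) ≡ - κ d
  κ-neg (+ zero) = refl
  κ-neg +[1+ m ] = refl
  κ-neg -[1+ m ] = sym (solve 1 (λ x → :- (:- x) := x) refl (κ +[1+ m ]))

  fromℤ*κ : ∀ d → d ≢ + 0 → fromℤ d * κ d ≡ 1ℚ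
  fromℤ*κ (+ zero) d≢0 = ⊥-elim (d≢0 refl)
  fromℤ*κ +[1+ m ] d≢0 = trans (fromℤ-*-/ +[1+ m ] m) (n/n≡1 m)
  fromℤ*κ -[1+ m ] d≢0 = trans (solve 2 (λ x y → (:- x) :* (:- y) := x :* y) refl (fromℤ +[1+ m ]) (κ +[1+ m ]))
    (fromℤ*κ +[1+ m ] λ ())

  ÷-κ : ∀ a d → a ÷ d ≡ fromℤ a * κ d
  ÷-κ a (+ zero) = sym (ℚ.*-zeroʳ (fromℤ a))
  ÷-κ a +[1+ m ] = sym (fromℤ-*-/ a m)
  ÷-κ a -[1+ m ] = trans (sym (fromℤ-*-/ (ℤ.- a) m)) (trans (cong (_* κ +[1+ m ]) (fromℤ-neg a))
    (solve 2 (λ x y → (:- x) :* y := x :* (:- y)) refl (fromℤ a) (κ +[1+ m ])))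

  ÷-β : ∀ d → d ≢ + 0 → (d ℤ.+ + 1) ÷ d ≡ β d
  ÷-β d d≢0 = trans (÷-κ (d ℤ.+ + 1) d) (trans (cong (_* κ d) (fromℤ-+ d (+ 1)))
    (trans (solve 2 (λ x y → (x :+ con 1ℚ) :* y := x :* y :+ y) refl (fromℤ d) (κ d))
           (cong (_+ κ d) (fromℤ*κ d d≢0))))

  -- Partial fractions: 1/(xy) = (1/x - 1/y)/(y - x). This is the source of `β-inverse` and
  -- `β-exchange`.
  κ-κ : ∀ x y → x ≢ + 0 → y ≢ + 0 → y ℤ.- x ≢ + 0 →
        κ x * κ y ≡ κ (y ℤ.- x) * (κ x - κ y)
  κ-κ x y x≢0 y≢0 d≢0 = begin
    a * b′                                   ≡⟨ ℚ.*-identityʳ _ ⟨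
    a * b′ * 1ℚ                            ≡⟨ cong (a * b′ *_) (fromℤ*κ (y ℤ.- x) d≢0) ⟨
    a * b′ * (fromℤ (y ℤ.- x) * c)           ≡⟨ cong (λ t → a * b′ * (t * c))
      (trans (fromℤ-+ y (ℤ.- x)) (cong (λ t → fromℤ y + t) (fromℤ-neg x))) ⟩
    a * b′ * ((fromℤ y - fromℤ x) * c)         ≡⟨ solve 5
      (λ a b′ c X Y → a :* b′ :* ((Y :- X) :* c) := c :* (a :* (Y :* b′) :- b′ :* (X :* a))) refl a b′ c
      (fromℤ x) (fromℤ y) ⟩
    c * (a * (fromℤ y * b′) - b′ * (fromℤ x * a)) ≡⟨ cong₂ (λ s t → c * (a * s - b′ * t)) (fromℤ*κ y y≢0)
      (fromℤ*κ x x≢0) ⟩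
    c * (a * 1ℚ - b′ * 1ℚ)             ≡⟨ cong₂ (λ s t → c * (s - t)) (ℚ.*-identityʳ a) (ℚ.*-identityʳ b′) ⟩
    c * (a - b′)                           ∎
    where
    open ≡-Reasoning
    a = κ x
    b′ = κ y
    c = κ (y ℤ.- x)

  -- The factors are (x + 1)/x and x/(x + 1); the excluded values are their poles.
  β-inverse : ∀ x → x ≢ + 0 → x ≢ -[1+ 0 ] → β x * β (ℤ.- x ℤ.- + 1) ≡ 1ℚ
  β-inverse x x≢0 x≢-1 = begin
    β x * β (ℤ.- x ℤ.- + 1)          ≡⟨ cong (λ t → β x * β t) (neg-suc x) ⟩
    β x * β (ℤ.- (x ℤ.+ + 1))        ≡⟨ cong (λ t → β x * (1ℚ + t)) (κ-neg (x ℤ.+ + 1)) ⟩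
    (1ℚ + a) * (1ℚ - b′)          ≡⟨ solve 2
      (λ a b′ → (con 1ℚ :+ a) :* (con 1ℚ :- b′) := con 1ℚ :+ (a :- b′) :- a :* b′) refl a b′ ⟩
    1ℚ + (a - b′) - a * b′        ≡⟨ cong (λ t → 1ℚ + (a - b′) - t)
      (κ-κ x (x ℤ.+ + 1) x≢0 x+1≢0 λ p → 1≢0 (trans (sym (suc-minus x)) p)) ⟩
    1ℚ + (a - b′) - κ (x ℤ.+ + 1 ℤ.- x) * (a - b′) ≡⟨ cong (λ t → 1ℚ + (a - b′) - κ t * (a - b′)) (suc-minus x) ⟩
    1ℚ + (a - b′) - 1ℚ * (a - b′) ≡⟨ solve 1 (λ a → con 1ℚ :+ a :- con 1ℚ :* a := con 1ℚ) refl (a - b′) ⟩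
    1ℚ                                 ∎
    where
    open ≡-Reasoning
    a = κ x
    b′ = κ (x ℤ.+ + 1)
    neg-suc : ∀ x → ℤ.- x ℤ.- + 1 ≡ ℤ.- (x ℤ.+ + 1)
    neg-suc = ℤ-Solver.solve-∀
    suc-minus : ∀ x → x ℤ.+ + 1 ℤ.- x ≡ + 1
    suc-minus = ℤ-Solver.solve-∀
    minus-suc : ∀ x → x ℤ.+ + 1 ℤ.- + 1 ≡ x
    minus-suc = ℤ-Solver.solve-∀
    1≢0 : + 1 ≢ + 0
    1≢0 ()
    x+1≢0 : x ℤ.+ + 1 ≢ + 0
    x+1≢0 p = x≢-1 (trans (sym (minus-suc x)) (cong (ℤ._- + 1) p))

  -- After expansion with d = q - p, the sides differ only in κ d (κ p - κ q) against κ p κ q, which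
  -- `κ-κ` identifies. The relations for M D M and D M D rest on this identity.
  β-exchange : ∀ p q → p ≢ + 0 → q ≢ + 0 → q ℤ.- p ≢ + 0 →
               β p * β (q ℤ.- p) + β q * β (ℤ.- (q ℤ.- p)) ≡ 1ℚ + β p * β q
  β-exchange p q p≢0 q≢0 d≢0 = begin
    β p * β d + β q * β (ℤ.- d)  ≡⟨ cong (λ t → β p * β d + β q * (1ℚ + t)) (κ-neg d) ⟩
    (1ℚ + a) * (1ℚ + c) + (1ℚ + b′) * (1ℚ - c)
      ≡⟨ solve 3 (λ a b′ c → (con 1ℚ :+ a) :* (con 1ℚ :+ c) :+ (con 1ℚ :+ b′) :* (con 1ℚ :- c)
           := con 1ℚ :+ con 1ℚ :+ a :+ b′ :+ c :* (a :- b′)) refl a b′ c ⟩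
    1ℚ + 1ℚ + a + b′ + c * (a - b′) ≡⟨ cong (λ t → 1ℚ + 1ℚ + a + b′ + t) (κ-κ p q p≢0 q≢0 d≢0) ⟨
    1ℚ + 1ℚ + a + b′ + a * b′  ≡⟨ solve 2 (λ a b′ → con 1ℚ :+ con 1ℚ :+ a :+ b′ :+ a :* b′ := con 1ℚ :+
      (con 1ℚ :+ a) :* (con 1ℚ :+ b′)) refl a b′ ⟩
    1ℚ + β p * β q                 ∎
    where
    open ≡-Reasoning
    d = q ℤ.- p
    a = κ p
    b′ = κ q
    c = κ d

  κ⊖ β⊖ : ℕ → ℕ → ℚ
  κ⊖ z s = κ (z ⊖ s)
  β⊖ z s = β (z ⊖ s)

  ⊖-minus : ∀ z s → z ⊖ s ≡ + z ℤ.- + s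
  ⊖-minus z s = sym (ℤ.m-n≡m⊖n z s)

  ⊖≢0 : ∀ {z s} → z ≢ s → z ⊖ s ≢ + 0
  ⊖≢0 {z} {s} z≢s p = z≢s (ℤ.+-injective (ℤ.i-j≡0⇒i≡j (+ z) (+ s) (trans (sym (⊖-minus z s)) p)))

  β⊖-refl : ∀ z → β⊖ z z ≡ 1ℚ
  β⊖-refl z = cong β (ℤ.n⊖n≡0 z)

  κ⊖-suc : ∀ z s → κ⊖ (suc z) (suc s) ≡ κ⊖ z s
  κ⊖-suc z s = cong κ (ℤ.[1+m]⊖[1+n]≡m⊖n z s)

  ⊖-pred : ∀ z → z ⊖ suc z ≡ -[1+ 0 ]
  ⊖-pred zero    = refl
  ⊖-pred (suc z) = trans (ℤ.[1+m]⊖[1+n]≡m⊖n z (suc z)) (⊖-pred z)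

  β⊖-pred : ∀ z → β⊖ z (suc z) ≡ 0ℚ
  β⊖-pred z = cong β (⊖-pred z)

  suc-⊖ : ∀ z → suc z ⊖ z ≡ + 1
  suc-⊖ zero    = refl
  suc-⊖ (suc z) = trans (ℤ.[1+m]⊖[1+n]≡m⊖n (suc z) z) (suc-⊖ z)

  κ⊖-1 : ∀ z → κ⊖ (suc z) z ≡ 1ℚ
  κ⊖-1 z = cong κ (suc-⊖ z)

  β⊖-1 : ∀ z → β⊖ (suc z) z ≡ 1ℚ + 1ℚ
  β⊖-1 z = cong β (suc-⊖ z)

  κ⊖-swap : ∀ z s → κ⊖ z s ≡ - κ⊖ s z
  κ⊖-swap z s = trans (cong κ (ℤ.⊖-swap z s)) (κ-neg (s ⊖ z))

  κ⊖+β⊖ : ∀ z s → κ⊖ z s + β⊖ s z ≡ 1ℚ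
  κ⊖+β⊖ z s = trans (cong (λ t → κ⊖ z s + (1ℚ + t)) (κ⊖-swap s z))
    (solve 1 (λ κ → κ :+ (con 1ℚ :+ :- κ) := con 1ℚ) refl (κ⊖ z s))

  β⊖-inverse : ∀ {z z′} → z ≢ z′ → suc z ≢ z′ → β⊖ z z′ * β⊖ z′ (suc z) ≡ 1ℚ
  β⊖-inverse {z} {z′} z≢z′ sz≢z′ = trans (cong (λ t → β⊖ z z′ * β t) eq)
    (β-inverse (z ⊖ z′) (⊖≢0 z≢z′) λ p → ⊖≢0 sz≢z′ (trans (⊖-minus (suc z) z′)
       (trans (lem₂ (+ z) (+ z′)) (trans (cong (ℤ._+ + 1) (trans (sym (⊖-minus z z′)) p)) refl))))
    where
    lem₁ : ∀ x y → y ℤ.- (+ 1 ℤ.+ x) ≡ ℤ.- (x ℤ.- y) ℤ.- + 1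
    lem₁ = ℤ-Solver.solve-∀
    lem₂ : ∀ x y → + 1 ℤ.+ x ℤ.- y ≡ x ℤ.- y ℤ.+ + 1
    lem₂ = ℤ-Solver.solve-∀
    eq : z′ ⊖ suc z ≡ ℤ.- (z ⊖ z′) ℤ.- + 1
    eq = trans (⊖-minus z′ (suc z)) (trans (lem₁ (+ z) (+ z′)) (cong (λ t → ℤ.- t ℤ.- + 1) (sym (⊖-minus z z′))))

  -- This form has two appended values z, z′ against one old entry i; the primed form has one
  -- appended value z against two old entries j, i.
  β⊖-exchange : ∀ {z z′ i} → z ≢ i → z′ ≢ i → z′ ≢ z →
                β⊖ z i * β⊖ z′ z + β⊖ z′ i * β⊖ z z′ ≡ 1ℚ + β⊖ z i * β⊖ z′ i
  β⊖-exchange {z} {z′} {i} z≢i z′≢i z′≢z = trans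
    (cong₂ (λ s t → β⊖ z i * β s + β⊖ z′ i * β t) (sym eq) (trans (ℤ.⊖-swap z z′) (cong ℤ.-_ (sym eq))))
    (β-exchange (z ⊖ i) (z′ ⊖ i) (⊖≢0 z≢i) (⊖≢0 z′≢i) λ p → ⊖≢0 z′≢z (trans (sym eq) p))
    where
    lem : ∀ x y t → (y ℤ.- t) ℤ.- (x ℤ.- t) ≡ y ℤ.- x
    lem = ℤ-Solver.solve-∀
    eq : (z′ ⊖ i) ℤ.- (z ⊖ i) ≡ z′ ⊖ z
    eq = trans (cong₂ ℤ._-_ (⊖-minus z′ i) (⊖-minus z i)) (trans (lem (+ z) (+ z′) (+ i)) (sym (⊖-minus z′ z)))

  β⊖-exchange′ : ∀ {z j i} → z ≢ j → z ≢ i → j ≢ i →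
                 β⊖ z j * β⊖ j i + β⊖ z i * β⊖ i j ≡ 1ℚ + β⊖ z j * β⊖ z i
  β⊖-exchange′ {z} {j} {i} z≢j z≢i j≢i = trans
    (cong₂ (λ s t → β⊖ z j * β s + β⊖ z i * β t) (sym eq) (trans (ℤ.⊖-swap i j) (cong ℤ.-_ (sym eq))))
    (β-exchange (z ⊖ j) (z ⊖ i) (⊖≢0 z≢j) (⊖≢0 z≢i) λ p → ⊖≢0 j≢i (trans (sym eq) p))
    where
    lem : ∀ x y t → (x ℤ.- t) ℤ.- (x ℤ.- y) ≡ y ℤ.- t
    lem = ℤ-Solver.solve-∀
    eq : (z ⊖ i) ℤ.- (z ⊖ j) ≡ j ⊖ i
    eq = trans (cong₂ ℤ._-_ (⊖-minus z i) (⊖-minus z j)) (trans (lem (+ z) (+ j) (+ i)) (sym (⊖-minus j i)))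

  fromℕ : ℕ → ℚ
  fromℕ n = fromℤ (+ n)

  fromℕ-κ : ∀ i → fromℕ (suc i) * κ⊖ (suc i) 0 ≡ 1ℚ
  fromℕ-κ i = fromℤ*κ (+ suc i) λ ()

  fromℕ-suc : ∀ i → fromℕ (suc i) ≡ 1ℚ + fromℕ i
  fromℕ-suc i = fromℤ-+ (+ 1) (+ i)

open Reciprocals

-- The coefficients of A and their products over two steps

module Weights where
  open ≡
  open import Data.Rational.Base using (_*_; _+_; -_)
  open VecAll using (All)

  open ℚ-Solver using (solve; _:=_; _:+_; _:*_; _:-_; :-_; con)
  open ≡-Reasoning

  -- weight z σ = A(z + 1 ∣ σ) for z ∈ 0 ∷ σ: with a phantom entry 0, the two cases of A
  -- agree, and β⊖ z z = 1 omits the factor r′ = r.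
  weight : ℕ → Vec ℕ k → ℚ
  weight z []      = β⊖ z 0
  weight z (s ∷ σ) = β⊖ z s * weight z σ

  -- Positivity is distinctness from the phantom entry 0 of `weight`, so that 0 is treated like any
  -- other entry.
  Valid : Vec ℕ k → Set
  Valid σ = Unique (0 ∷ σ)

  Valid⇒0∉ : {σ : Vec ℕ k} → Valid σ → All (0 ≢_) σ
  Valid⇒0∉ (0∉ ∷ _) = 0∉

  weight-∷ʳ : ∀ z (σ : Vec ℕ k) i → weight z (σ ∷ʳ i) ≡ β⊖ z i * weight z σ
  weight-∷ʳ z []      i = refl
  weight-∷ʳ z (s ∷ σ) i = trans (cong (β⊖ z s *_) (weight-∷ʳ z σ i))
    (solve 3 (λ x y t → x :* (y :* t) := y :* (x :* t)) refl (β⊖ z s) (β⊖ z i) (weight z σ))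

  -- The entry z + 1 contributes the factor β(-1) = 0. Hence a sum over all z in `0 ∷ σ` skips by
  -- itself the values z + 1 that already occur.
  weight-vanishes : ∀ {z} {σ : Vec ℕ k} → suc z ∈ 0 ∷ σ → weight z σ ≡ 0ℚ
  weight-vanishes (here ())
  weight-vanishes {z = z} {σ = s ∷ σ} (there (here refl)) =
    trans (cong (_* weight z σ) (β⊖-pred z)) (ℚ.*-zeroˡ (weight z σ))
  weight-vanishes {z = z} {σ = s ∷ σ} (there (there z∈σ)) =
    trans (cong (β⊖ z s *_) (weight-vanishes (there z∈σ))) (ℚ.*-zeroʳ (β⊖ z s))

  -- The coefficient of b_{σ,z+1,z′+1} in M M b_σ for z, z′ in `0 ∷ σ`; the last factor is the
  -- effect of the new entry z + 1 on the weight of z′.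
  pair-weight : ℕ → ℕ → Vec ℕ k → ℚ
  pair-weight z z′ σ = weight z σ * weight z′ σ * β⊖ z′ (suc z)

  All⇒∉ : ∀ {i} {σ : Vec B k} → All (i ≢_) σ → i ∉ σ
  All⇒∉ (i≢s ∷ _) (here i≡s)  = i≢s i≡s
  All⇒∉ (_ ∷ i∉σ) (there i∈σ) = All⇒∉ i∉σ i∈σ

  ∉⇒All : ∀ {i} {σ : Vec B k} → i ∉ σ → All (i ≢_) σ
  ∉⇒All {σ = []}    i∉σ = []
  ∉⇒All {σ = s ∷ σ} i∉σ = (λ i≡s → i∉σ (here i≡s)) ∷ ∉⇒All λ i∈σ → i∉σ (there i∈σ)

  ∈-∷ʳ-last : ∀ (σ : Vec B k) {j} → j ∈ σ ∷ʳ j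
  ∈-∷ʳ-last []      = here refl
  ∈-∷ʳ-last (s ∷ σ) = there (∈-∷ʳ-last σ)

  ∈-∷ʳ-init : ∀ {σ : Vec B k} {z j} → z ∈ σ → z ∈ σ ∷ʳ j
  ∈-∷ʳ-init (here p)  = here p
  ∈-∷ʳ-init (there p) = there (∈-∷ʳ-init p)

  All-∷ʳ⁻ : ∀ {P : B → Set} (σ : Vec B k) {i} → All P (σ ∷ʳ i) → All P σ × P i
  All-∷ʳ⁻ []      (p ∷ [])   = [] , p
  All-∷ʳ⁻ (s ∷ σ) (p ∷ rest) with All-∷ʳ⁻ σ rest
  ... | ps , q = p ∷ ps , q

  Unique-∷ʳ⁻ : ∀ (σ : Vec B k) {i} → Unique (σ ∷ʳ i) → Unique σ × i ∉ σ
  Unique-∷ʳ⁻ []      _          = [] , λ ()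
  Unique-∷ʳ⁻ (s ∷ σ) (s∉ ∷ u) with Unique-∷ʳ⁻ σ u | All-∷ʳ⁻ σ s∉
  ... | uσ , i∉σ | s∉σ , s≢i = (s∉σ ∷ uσ) , λ { (here i≡s) → s≢i (sym i≡s) ; (there i∈σ) → i∉σ i∈σ }

  -- The pairs at which one of the inverses from `β⊖-inverse` has a pole. By `pair-vanishes` their
  -- pair weight is 0, so identities between pair weights hold there trivially.
  data Degenerate (z z′ : ℕ) : Set where
    ⟨z≡z′⟩ : z ≡ z′ → Degenerate z z′
    ⟨z+1≡z′⟩ : suc z ≡ z′ → Degenerate z z′
    ⟨z′+1≡z⟩ : suc z′ ≡ z → Degenerate z z′

  degenerate? : ∀ z z′ → Dec (Degenerate z z′)
  degenerate? z z′ with z ℕ.≟ z′ | suc z ℕ.≟ z′ | suc z′ ℕ.≟ z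
  ... | yes p | _     | _     = yes (⟨z≡z′⟩ p)
  ... | no _  | yes p | _     = yes (⟨z+1≡z′⟩ p)
  ... | no _  | no _  | yes p = yes (⟨z′+1≡z⟩ p)
  ... | no ¬p | no ¬q | no ¬r = no λ { (⟨z≡z′⟩ p) → ¬p p ; (⟨z+1≡z′⟩ q) → ¬q q ; (⟨z′+1≡z⟩ r) → ¬r r }

  opposite : ∀ {z z′} → Degenerate z z′ → Degenerate z′ z
  opposite (⟨z≡z′⟩ p) = ⟨z≡z′⟩ (sym p)
  opposite (⟨z+1≡z′⟩ p) = ⟨z′+1≡z⟩ p
  opposite (⟨z′+1≡z⟩ p) = ⟨z+1≡z′⟩ p

  pair-weight-refl : ∀ z (σ : Vec ℕ k) → pair-weight z z σ ≡ 0ℚ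
  pair-weight-refl z σ = trans (cong (weight z σ * weight z σ *_) (β⊖-pred z)) (ℚ.*-zeroʳ (weight z σ * weight z σ))

  pair-vanishes : ∀ {z z′} {σ : Vec ℕ k} → z ∈ 0 ∷ σ → z′ ∈ 0 ∷ σ → Degenerate z z′ → pair-weight z z′ σ ≡ 0ℚ
  pair-vanishes {z = z} {σ = σ} z∈ z′∈ (⟨z≡z′⟩ refl) = pair-weight-refl z σ
  pair-vanishes {z = z} {z′} {σ} z∈ z′∈ (⟨z+1≡z′⟩ refl) = trans
    (cong (λ t → t * weight z′ σ * β⊖ z′ (suc z)) (weight-vanishes z′∈))
    (solve 2 (λ x y → con 0ℚ :* x :* y := con 0ℚ) refl (weight z′ σ) (β⊖ z′ (suc z)))
  pair-vanishes {z = z} {z′} {σ} z∈ z′∈ (⟨z′+1≡z⟩ refl) = trans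
    (cong (λ t → weight z σ * t * β⊖ z′ (suc z)) (weight-vanishes z∈))
    (solve 2 (λ x y → x :* con 0ℚ :* y := con 0ℚ) refl (weight z σ) (β⊖ z′ (suc z)))

  pair-reverse : ∀ {z z′} (σ : Vec ℕ k) → ¬ Degenerate z z′ → pair-weight z′ z σ * β⊖ z′ z ≡ weight z σ * weight z′ σ
  pair-reverse {z = z} {z′} σ ¬deg = trans
    (solve 4 (λ x y s t → y :* x :* s :* t := x :* y :* (t :* s)) refl (weight z σ) (weight z′ σ)
      (β⊖ z (suc z′)) (β⊖ z′ z))
    (trans (cong (weight z σ * weight z′ σ *_)
      (β⊖-inverse (λ p → ¬deg (⟨z≡z′⟩ (sym p))) (λ p → ¬deg (⟨z′+1≡z⟩ p)))) (ℚ.*-identityʳ _))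

  pair-reverse-≡ : ∀ {z z′} (σ : Vec ℕ k) → ¬ Degenerate z z′ →
                   pair-weight z′ z σ * β⊖ z′ z ≡ pair-weight z z′ σ * β⊖ z z′
  pair-reverse-≡ {z = z} {z′} σ ¬deg = trans (pair-reverse σ ¬deg)
    (trans (ℚ.*-comm (weight z σ) (weight z′ σ)) (sym (pair-reverse σ (λ deg → ¬deg (opposite deg)))))

  -- Compares the coefficients of b_{σ,z+1,z′+1} in s M M b_σ and M M b_σ. Away from degenerate
  -- pairs, each order of choice times its β is weight z · weight z′, so the two orders can be
  -- exchanged, and κ + β = 1 concludes.
  pair-symmetrise : ∀ {z z′} {σ : Vec ℕ k} → z ∈ 0 ∷ σ → z′ ∈ 0 ∷ σ →
    pair-weight z z′ σ * κ⊖ z′ z + pair-weight z′ z σ * β⊖ z′ z ≡ pair-weight z z′ σ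
  pair-symmetrise {z = z} {z′} {σ} z∈ z′∈ with degenerate? z z′
  ... | yes deg = begin
    pair-weight z z′ σ * κ⊖ z′ z + pair-weight z′ z σ * β⊖ z′ z
      ≡⟨ cong₂ (λ s t → s * κ⊖ z′ z + t * β⊖ z′ z) p≡0 (pair-vanishes z′∈ z∈ (opposite deg)) ⟩
    0ℚ * κ⊖ z′ z + 0ℚ * β⊖ z′ z
      ≡⟨ solve 2 (λ x y → con 0ℚ :* x :+ con 0ℚ :* y := con 0ℚ) refl (κ⊖ z′ z) (β⊖ z′ z) ⟩
    0ℚ
      ≡⟨ p≡0 ⟨
    pair-weight z z′ σ ∎
    where p≡0 = pair-vanishes z∈ z′∈ deg
  ... | no ¬deg = begin
    p * κ⊖ z′ z + pair-weight z′ z σ * β⊖ z′ z ≡⟨ cong (λ t → p * κ⊖ z′ z + t) (pair-reverse-≡ σ ¬deg) ⟩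
    p * κ⊖ z′ z + p * β⊖ z z′                  ≡⟨ cong (λ t → p * κ⊖ z′ z + p * (1ℚ + t)) (κ⊖-swap z z′) ⟩
    p * κ⊖ z′ z + p * (1ℚ + - κ⊖ z′ z)         ≡⟨ solve 2 (λ p κ → p :* κ :+ p :* (con 1ℚ :+ :- κ) := p) refl p
      (κ⊖ z′ z) ⟩
    p                                          ∎
    where
    p = pair-weight z z′ σ

  -- The same comparison for (1 + s) M D M = M M D + D M M, where i is the entry forgotten.
  pair-exchange : ∀ {z z′ i} {σ : Vec ℕ k} → z ∈ 0 ∷ σ → z′ ∈ 0 ∷ σ → i ∉ 0 ∷ σ →
    β⊖ z i * pair-weight z z′ σ * β⊖ z′ z + β⊖ z′ i * pair-weight z′ z σ * β⊖ z′ z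
      ≡ pair-weight z z′ σ + β⊖ z i * β⊖ z′ i * pair-weight z z′ σ
  pair-exchange {z = z} {z′} {i} {σ} z∈ z′∈ i∉ with degenerate? z z′
  ... | yes deg = trans
    (cong₂ (λ s t → β⊖ z i * s * β⊖ z′ z + β⊖ z′ i * t * β⊖ z′ z) p≡0 (pair-vanishes z′∈ z∈ (opposite deg)))
    (trans (solve 3 (λ x y u → x :* con 0ℚ :* u :+ y :* con 0ℚ :* u := con 0ℚ :+ x :* y :* con 0ℚ) refl (β⊖ z i)
      (β⊖ z′ i) (β⊖ z′ z))
      (cong (λ s → s + β⊖ z i * β⊖ z′ i * s) (sym p≡0)))
    where p≡0 = pair-vanishes z∈ z′∈ deg
  ... | no ¬deg = begin
    x * p * u + y * pair-weight z′ z σ * u  ≡⟨ cong (λ t → x * p * u + t)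
      (trans (ℚ.*-assoc y _ u) (cong (y *_) (pair-reverse-≡ σ ¬deg))) ⟩
    x * p * u + y * (p * v)                 ≡⟨ solve 5
      (λ x y p u v → x :* p :* u :+ y :* (p :* v) := p :* (x :* u :+ y :* v)) refl x y p u v ⟩
    p * (x * u + y * v)                     ≡⟨ cong (p *_)
      (β⊖-exchange {z} {z′} {i} (λ { refl → i∉ z∈ }) (λ { refl → i∉ z′∈ }) λ q → ¬deg (⟨z≡z′⟩ (sym q))) ⟩
    p * (1ℚ + x * y)                        ≡⟨ solve 3
      (λ x y p → p :* (con 1ℚ :+ x :* y) := p :+ x :* y :* p) refl x y p ⟩
    p + x * y * p                           ∎
    where
    p = pair-weight z z′ σ
    x = β⊖ z i
    y = β⊖ z′ i
    u = β⊖ z′ z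
    v = β⊖ z z′

  -- The case z′ = z + 1 of `β⊖-exchange`, where β⊖ z′ z = 2 and β⊖ z z′ = 0.
  two-steps-exchange : ∀ {z i} → z ≢ i → suc z ≢ i →
    β⊖ z i * (1ℚ + 1ℚ) ≡ 1ℚ + β⊖ z i * β⊖ (suc z) i
  two-steps-exchange {z} {i} z≢i sz≢i = trans
    (trans (solve 2 (λ x y → x :* (con 1ℚ :+ con 1ℚ) := x :* (con 1ℚ :+ con 1ℚ) :+ y :* con 0ℚ) refl (β⊖ z i)
      (β⊖ (suc z) i))
           (cong₂ (λ s t → β⊖ z i * s + β⊖ (suc z) i * t) (sym (β⊖-1 z)) (sym (β⊖-pred z))))
    (β⊖-exchange z≢i sz≢i λ ())

  -- Both sides are weight i · weight z times two factors with product 1: β⊖ i z · β⊖ z (i + 1) on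
  -- the left, β⊖ z i · β⊖ i (z + 1) on the right. If i + 1 = z, then weight i vanishes because z is
  -- an entry of σ.
  pair-with-last : ∀ {z i} {σ : Vec ℕ k} → z ∈ 0 ∷ σ → i ∉ 0 ∷ σ → suc z ≢ i →
    weight i σ * weight z σ * β⊖ z (suc i) * β⊖ i z ≡ β⊖ z i * pair-weight z i σ
  pair-with-last {z = z} {i} {σ} z∈ i∉ sz≢i with suc i ℕ.≟ z
  ... | yes refl = trans (cong (λ t → t * weight z σ * β⊖ z (suc i) * β⊖ i z) Ai≡0)
    (trans (solve 5 (λ a s t u v → con 0ℚ :* a :* s :* t := u :* (a :* con 0ℚ :* v)) refl
             (weight z σ) (β⊖ z (suc i)) (β⊖ i z) (β⊖ z i) (β⊖ i (suc z)))
           (cong (λ t → β⊖ z i * (weight z σ * t * β⊖ i (suc z))) (sym Ai≡0)))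
    where Ai≡0 = weight-vanishes z∈
  ... | no si≢z = begin
    a′ * a * β⊖ z (suc i) * β⊖ i z   ≡⟨ solve 4
      (λ a a′ s t → a′ :* a :* s :* t := a :* a′ :* (t :* s)) refl a a′ (β⊖ z (suc i)) (β⊖ i z) ⟩
    a * a′ * (β⊖ i z * β⊖ z (suc i)) ≡⟨ cong (a * a′ *_)
      (trans (β⊖-inverse i≢z si≢z) (sym (β⊖-inverse (≢-sym i≢z) sz≢i))) ⟩
    a * a′ * (β⊖ z i * β⊖ i (suc z)) ≡⟨ solve 4
      (λ a a′ s t → a :* a′ :* (t :* s) := t :* (a :* a′ :* s)) refl a a′ (β⊖ i (suc z)) (β⊖ z i) ⟩
    β⊖ z i * (a * a′ * β⊖ i (suc z)) ∎
    where
    a  = weight z σ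
    a′ = weight i σ
    i≢z : i ≢ z
    i≢z refl = i∉ z∈

  -- Consecutive entries z + 1, z + 2 are fixed by s, hence the factor 2 for 1 + s.
  pair-diagonal : ∀ {z i} {σ : Vec ℕ k} → z ∈ 0 ∷ σ → i ∉ 0 ∷ σ → suc z ≢ i →
    β⊖ z i * weight z σ * weight (suc z) σ * (1ℚ + 1ℚ) ≡
    weight z σ * weight (suc z) σ + β⊖ z i * weight z σ * (β⊖ (suc z) i * weight (suc z) σ)
  pair-diagonal {z = z} {i} {σ} z∈ i∉ sz≢i = begin
    β⊖ z i * a * a₁ * (1ℚ + 1ℚ)   ≡⟨ solve 4 (λ s a a₁ t → s :* a :* a₁ :* t := a :* a₁ :* (s :* t)) refl
      (β⊖ z i) a a₁ (1ℚ + 1ℚ) ⟩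
    a * a₁ * (β⊖ z i * (1ℚ + 1ℚ)) ≡⟨ cong (a * a₁ *_) (two-steps-exchange {z} {i} (λ { refl → i∉ z∈ }) sz≢i) ⟩
    a * a₁ * (1ℚ + β⊖ z i * β⊖ (suc z) i)
      ≡⟨ solve 4 (λ s a a₁ t → a :* a₁ :* (con 1ℚ :+ s :* t) := a :* a₁ :+ s :* a :* (t :* a₁)) refl
           (β⊖ z i) a a₁ (β⊖ (suc z) i) ⟩
    a * a₁ + β⊖ z i * a * (β⊖ (suc z) i * a₁) ∎
    where
    a  = weight z σ
    a₁ = weight (suc z) σ


  *-rotate : ∀ x y t → x * (y * t) ≡ x * t * y
  *-rotate = solve 3 (λ x y t → x :* (y :* t) := x :* t :* y) refl

  *-rotate′ : ∀ x y s t → x * y * (s * t) ≡ x * (y * t * s)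
  *-rotate′ = solve 4 (λ x y s t → x :* y :* (s :* t) := x :* (y :* t :* s)) refl

  weight-exchange : ∀ {z i j} p → z ≢ j → z ≢ i → j ≢ i →
    β⊖ j i * (β⊖ z j * p) + β⊖ i j * (β⊖ z i * p) ≡ p + β⊖ z i * (β⊖ z j * p)
  weight-exchange {z} {i} {j} p z≢j z≢i j≢i = begin
    β⊖ j i * (β⊖ z j * p) + β⊖ i j * (β⊖ z i * p)
      ≡⟨ solve 5 (λ x y s t p → x :* (y :* p) :+ s :* (t :* p) := (y :* x :+ t :* s) :* p) refl (β⊖ j i)
           (β⊖ z j) (β⊖ i j) (β⊖ z i) p ⟩
    (β⊖ z j * β⊖ j i + β⊖ z i * β⊖ i j) * p
      ≡⟨ cong (_* p) (β⊖-exchange′ {z} {j} {i} z≢j z≢i j≢i) ⟩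
    (1ℚ + β⊖ z j * β⊖ z i) * p
      ≡⟨ solve 3 (λ y t p → (con 1ℚ :+ y :* t) :* p := p :+ t :* (y :* p)) refl (β⊖ z j) (β⊖ z i) p ⟩
    p + β⊖ z i * (β⊖ z j * p) ∎

  pair-weight-∷ʳ : ∀ z z′ (σ : Vec ℕ k) i → pair-weight z z′ (σ ∷ʳ i) ≡ β⊖ z i * β⊖ z′ i * pair-weight z z′ σ
  pair-weight-∷ʳ z z′ σ i = trans
    (cong₂ (λ s t → s * t * β⊖ z′ (suc z)) (weight-∷ʳ z σ i) (weight-∷ʳ z′ σ i))
    (solve 5 (λ x y s t u → (x :* s) :* (y :* t) :* u := x :* y :* (s :* t :* u)) refl
      (β⊖ z i) (β⊖ z′ i) (weight z σ) (weight z′ σ) (β⊖ z′ (suc z)))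

  -- Takes the place of `pair-with-last` in its excluded case i = z + 1.
  pair-weight-suc : ∀ z (σ : Vec ℕ k) → pair-weight (suc z) z σ * β⊖ (suc z) z ≡ weight z σ * weight (suc z) σ
  pair-weight-suc z σ = trans
    (solve 4 (λ x y s t → x :* y :* s :* t := y :* x :* (t :* s)) refl (weight (suc z) σ) (weight z σ)
      (β⊖ z (suc (suc z))) (β⊖ (suc z) z))
    (trans (cong (weight z σ * weight (suc z) σ *_)
      (β⊖-inverse {suc z} {z} ℕ.1+n≢n (λ p → ℕ.m≢1+m+n z {1} (sym (trans (cong suc (ℕ.+-comm z 1)) p)))))
      (ℚ.*-identityʳ _))

  -- Next to a single entry i + 1, only 1 and i + 2 are appended, with weights i/(i + 1) and (i +
  -- 2)/(i + 1). Scaled by i + 1, they yield the integer coefficients of Newton's identity.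
  fromℕ-weight-0 : ∀ i → fromℕ (suc i) * (1ℚ + - weight 0 (suc i ∷ [])) ≡ 1ℚ
  fromℕ-weight-0 i = trans (cong (λ t → fromℕ (suc i) * (1ℚ + - ((1ℚ + t) * 1ℚ))) (κ⊖-swap 0 (suc i)))
    (trans (solve 2 (λ n κ → n :* (con 1ℚ :+ :- ((con 1ℚ :+ :- κ) :* con 1ℚ)) := n :* κ) refl (fromℕ (suc i))
      (κ⊖ (suc i) 0))
      (fromℕ-κ i))

  fromℕ-weight-suc : ∀ i → fromℕ (suc i) * weight (suc i) (suc i ∷ []) ≡ fromℕ (suc (suc i))
  fromℕ-weight-suc i = trans (cong (λ t → fromℕ (suc i) * (t * β⊖ (suc i) 0)) (β⊖-refl (suc i)))
    (trans (solve 2 (λ n κ → n :* (con 1ℚ :* (con 1ℚ :+ κ)) := n :* κ :+ n) refl (fromℕ (suc i)) (κ⊖ (suc i) 0))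
      (trans (cong (_+ fromℕ (suc i)) (fromℕ-κ i)) (sym (fromℕ-suc (suc i)))))

open Weights

-- Commutative ℚ-algebras and finite sums

record ℚ-Algebra : Set₁ where
  field
    commutativeRing : CommutativeRing 0ℓ 0ℓ
  open CommutativeRing commutativeRing public hiding (zero) renaming (_≈_ to _≋_)
  field
    ι   : ℚ → Carrier
    ι-+ : ∀ p q → ι (p ℚ.+ q) ≋ ι p + ι q
    ι-* : ∀ p q → ι (p ℚ.* q) ≋ ι p * ι q
    ι-neg : ∀ p → ι (ℚ.- p) ≋ - ι p
    ι-0 : ι 0ℚ ≋ 0#
    ι-1 : ι 1ℚ ≋ 1#

module Sums (K : ℚ-Algebra) where
  open ℚ-Algebra K
  open import Algebra.Properties.Ring ring using (-0#≈0#)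
  open import Algebra.Properties.CommutativeSemigroup *-commutativeSemigroup public using (x∙yz≈y∙xz)

  homomorphism : ℚ.+-*-rawRing -Raw-AlmostCommutative⟶ fromCommutativeRing commutativeRing
  homomorphism = record
    { ⟦_⟧ = ι ; +-homo = ι-+ ; *-homo = ι-* ; -‿homo = ι-neg ; 0-homo = ι-0 ; 1-homo = ι-1 }

  ι≟ : ∀ p q → Maybe (ι p ≋ ι q)
  ι≟ p q with p ℚ.≟ q
  ... | yes ≡.refl = just refl
  ... | no _       = nothing

  module Solver = Algebra.Solver.Ring ℚ.+-*-rawRing (fromCommutativeRing commutativeRing) homomorphism ι≟
  open Solver using (solve; _:=_; _:+_; _:*_; _:-_; :-_)

  
  infixr 7 _•_
  _•_ : ℚ → Carrier → Carrier
  q • x = ι q * x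

  ι-cong : ∀ {p q} → p ≡ q → ι p ≋ ι q
  ι-cong ≡.refl = refl

  •-congʳ : ∀ {p q x} → p ≡ q → p • x ≋ q • x
  •-congʳ ≡.refl = refl

  •-zero : ∀ {q} x → q ≡ 0ℚ → q • x ≋ 0#
  •-zero x ≡.refl = trans (*-congʳ ι-0) (zeroˡ x)

  •-one : ∀ x → 1ℚ • x ≋ x
  •-one x = trans (*-congʳ ι-1) (*-identityˡ x)

  •-• : ∀ p q x → p • (q • x) ≋ (p ℚ.* q) • x
  •-• p q x = trans (sym (*-assoc _ _ _)) (*-congʳ (sym (ι-* p q)))

  •-+ : ∀ p q x → (p ℚ.+ q) • x ≋ p • x + q • x
  •-+ p q x = trans (*-congʳ (ι-+ p q)) (distribʳ _ _ _)

  ∑ : Vec B k → (B → Carrier) → Carrier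
  ∑ []      f = 0#
  ∑ (x ∷ σ) f = f x + ∑ σ f

  syntax ∑ σ (λ z → x) = ∑[ z ∈ σ ] x

  ∑-cong∈ : ∀ (σ : Vec B k) {f g : B → Carrier} → (∀ z → z ∈ σ → f z ≋ g z) → ∑ σ f ≋ ∑ σ g
  ∑-cong∈ []      f≈g = refl
  ∑-cong∈ (x ∷ σ) f≈g = +-cong (f≈g x (here ≡.refl)) (∑-cong∈ σ λ z z∈σ → f≈g z (there z∈σ))

  ∑-cong : ∀ (σ : Vec B k) {f g : B → Carrier} → (∀ z → f z ≋ g z) → ∑ σ f ≋ ∑ σ g
  ∑-cong σ f≈g = ∑-cong∈ σ λ z _ → f≈g z

  ∑-zero : ∀ (σ : Vec B k) → ∑ σ (λ _ → 0#) ≋ 0#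
  ∑-zero []      = refl
  ∑-zero (x ∷ σ) = trans (+-identityˡ _) (∑-zero σ)

  ∑-+ : ∀ (σ : Vec B k) (f g : B → Carrier) → ∑[ z ∈ σ ] (f z + g z) ≋ ∑ σ f + ∑ σ g
  ∑-+ []      f g = sym (+-identityˡ 0#)
  ∑-+ (x ∷ σ) f g = trans (+-congˡ (∑-+ σ f g))
    (solve 4 (λ p q r s → (p :+ q) :+ (r :+ s) := (p :+ r) :+ (q :+ s)) refl _ _ _ _)

  ∑-*ˡ : ∀ (σ : Vec B k) q (f : B → Carrier) → ∑[ z ∈ σ ] (q * f z) ≋ q * ∑ σ f
  ∑-*ˡ []      q f = sym (zeroʳ q)
  ∑-*ˡ (x ∷ σ) q f = trans (+-congˡ (∑-*ˡ σ q f)) (sym (distribˡ q _ _))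

  ∑-neg : ∀ (σ : Vec B k) (f : B → Carrier) → ∑[ z ∈ σ ] (- f z) ≋ - ∑ σ f
  ∑-neg []      f = sym -0#≈0#
  ∑-neg (x ∷ σ) f = trans (+-congˡ (∑-neg σ f)) (solve 2 (λ p q → (:- p) :+ (:- q) := :- (p :+ q)) refl _ _)

  ∑-∷ʳ : ∀ (σ : Vec B k) i (f : B → Carrier) → ∑ (σ ∷ʳ i) f ≋ ∑ σ f + f i
  ∑-∷ʳ []      i f = +-comm _ _
  ∑-∷ʳ (x ∷ σ) i f = trans (+-congˡ (∑-∷ʳ σ i f)) (sym (+-assoc _ _ _))

  ∑-swap : ∀ (σ : Vec B k) (τ : Vec C l) (f : B → C → Carrier) →
           ∑[ x ∈ σ ] ∑[ y ∈ τ ] f x y ≋ ∑[ y ∈ τ ] ∑[ x ∈ σ ] f x y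
  ∑-swap []      τ f = sym (∑-zero τ)
  ∑-swap (x ∷ σ) τ f = trans (+-congˡ (∑-swap σ τ f)) (sym (∑-+ τ (f x) _))

-- Tuples split at their last entry, and adjacent transpositions

∷ʳ-elim : (P : Vec B (suc k) → Set) → (∀ σ i → P (σ ∷ʳ i)) → ∀ ρ → P ρ
∷ʳ-elim P p ρ with initLast ρ
... | σ , i , ≡.refl = p σ i

swap : ℕ → Vec B k → Vec B k
swap zero    (x ∷ y ∷ σ) = y ∷ x ∷ σ
swap (suc t) (x ∷ σ)     = x ∷ swap t σ
swap _       σ           = σ

swap-∷ʳ : ∀ t (σ : Vec B k) i → suc t < k → swap t (σ ∷ʳ i) ≡ swap t σ ∷ʳ i
swap-∷ʳ zero    (x ∷ [])    i (s≤s ())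
swap-∷ʳ zero    (x ∷ y ∷ σ) i t<k       = ≡.refl
swap-∷ʳ (suc t) (x ∷ σ)     i (s≤s t<k) = ≡.cong (x ∷_) (swap-∷ʳ t σ i t<k)

swap-last : ∀ (σ : Vec B k) x y → swap k (σ ∷ʳ x ∷ʳ y) ≡ σ ∷ʳ y ∷ʳ x
swap-last []      x y = ≡.refl
swap-last (s ∷ σ) x y = ≡.cong (s ∷_) (swap-last σ x y)

-- The 1/d of Young's seminormal form at positions t and t + 1, newest entry first. Out of range it
-- is 0 and `swap` does nothing, which makes `S*` the identity.
swap-κ : ℕ → Vec ℕ k → ℚ
swap-κ zero    (v ∷ u ∷ σ) = κ⊖ v u
swap-κ (suc t) (x ∷ σ)     = swap-κ t σ
swap-κ _       σ           = 0ℚ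

swap-κ-∷ʳ : ∀ t (σ : Vec ℕ k) i → suc t < k → swap-κ t (σ ∷ʳ i) ≡ swap-κ t σ
swap-κ-∷ʳ zero    (x ∷ [])    i (s≤s ())
swap-κ-∷ʳ zero    (x ∷ y ∷ σ) i t<k       = ≡.refl
swap-κ-∷ʳ (suc t) (x ∷ σ)     i (s≤s t<k) = swap-κ-∷ʳ t σ i t<k

swap-κ-last : ∀ (σ : Vec ℕ k) x y → swap-κ k (σ ∷ʳ x ∷ʳ y) ≡ κ⊖ x y
swap-κ-last []      x y = ≡.refl
swap-κ-last (s ∷ σ) x y = swap-κ-last σ x y

All-swap : ∀ {P : B → Set} t {σ : Vec B k} → VecAll.All P σ → VecAll.All P (swap t σ)
All-swap zero    []              = []
All-swap zero    (p ∷ [])        = p ∷ []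
All-swap zero    (p ∷ q ∷ rest)  = q ∷ p ∷ rest
All-swap (suc t) []              = []
All-swap (suc t) (p ∷ rest)      = p ∷ All-swap t rest

Valid-swap : ∀ t {σ : Vec ℕ k} → Valid σ → Valid (swap t σ)
Valid-swap {k} t (0∉ ∷ u) = All-swap t 0∉ ∷ go t u
  where
  go : ∀ {k} t {σ : Vec ℕ k} → Unique σ → Unique (swap t σ)
  go zero    []                             = []
  go zero    (p ∷ [])                       = p ∷ []
  go zero    ((p ∷ ps) ∷ (q ∷ rest))        = ((λ y≡x → p (≡.sym y≡x)) ∷ q) ∷ (ps ∷ rest)
  go (suc t) []                             = []
  go (suc t) (p ∷ rest)                     = All-swap t p ∷ go t rest

weight-swap : ∀ z t (σ : Vec ℕ k) → weight z (swap t σ) ≡ weight z σ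
weight-swap z zero    []          = ≡.refl
weight-swap z zero    (x ∷ [])    = ≡.refl
weight-swap z zero    (x ∷ y ∷ σ) = solve 3 (λ x y t → y :* (x :* t) := x :* (y :* t)) ≡.refl (β⊖ z x) (β⊖ z y)
  (weight z σ)
  where open ℚ-Solver
weight-swap z (suc t) []          = ≡.refl
weight-swap z (suc t) (x ∷ σ)     = ≡.cong (β⊖ z x ℚ.*_) (weight-swap z t σ)

Valid-∷ʳ⁻ : ∀ (σ : Vec ℕ k) {i} → Valid (σ ∷ʳ i) → Valid σ × i ∉ 0 ∷ σ
Valid-∷ʳ⁻ σ v = Unique-∷ʳ⁻ (0 ∷ σ) v

Valid-∷ : ∀ {σ : Vec ℕ k} {z} → Valid σ → suc z ∉ 0 ∷ σ → Valid (suc z ∷ σ)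
Valid-∷ (0∉ ∷ u) z∉ = ((λ ()) ∷ 0∉) ∷ (∉⇒All (λ z∈ → z∉ (there z∈)) ∷ u)

-- Transposes of M, D, R and s, and the relations between M, D and s

module Operators (K : ℚ-Algebra) (w : ℕ → ℚ-Algebra.Carrier K) where
  open ℚ-Algebra K
  open Sums K
  open Solver using (solve; _:=_; _:+_; _:*_; _:-_; :-_)
  open import Relation.Binary.Reasoning.Setoid setoid

  -- M*, D*, R* and S* are the transposes of the operators M, D, R and s, acting on
  -- functionals on V_k.  Tuples list the newest entry first.
  Functional : ℕ → Set
  Functional k = Vec ℕ k → Carrier

  M* : Functional (suc k) → Functional k
  M* f σ = ∑[ z ∈ 0 ∷ σ ] (weight z σ • f (suc z ∷ σ))

  D* : Functional k → Functional (suc k)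
  D* f σ = w (last σ) * f (init σ)

  infixl 6 _⊝_ _⊞ᶠ_
  _⊝_ _⊞ᶠ_ : Functional k → Functional k → Functional k
  (f ⊝ g) σ = f σ - g σ
  (f ⊞ᶠ g) σ = f σ + g σ

  R* : Functional (suc k) → Functional (suc k)
  R* f = D* (M* f) ⊝ M* (D* f)

  S* : ℕ → Functional k → Functional k
  S* t f σ = swap-κ t σ • f σ + (1ℚ ℚ.- swap-κ t σ) • f (swap t σ)

  infix 4 _≗ᵛ_
  _≗ᵛ_ : Functional k → Functional k → Set
  f ≗ᵛ g = ∀ σ → Valid σ → f σ ≋ g σ

  -- Appending z + 1 leaves the valid tuples only if z + 1 already occurs, and then the weight is 0.
  M*-cong : {f g : Functional (suc k)} → f ≗ᵛ g → M* f ≗ᵛ M* g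
  M*-cong {f = f} {g} f≗g σ v = ∑-cong (0 ∷ σ) step
    where
    step : ∀ z → weight z σ • f (suc z ∷ σ) ≋ weight z σ • g (suc z ∷ σ)
    step z with suc z ∈? (0 ∷ σ)
    ... | yes z∈ = trans (•-zero _ (weight-vanishes z∈)) (sym (•-zero _ (weight-vanishes z∈)))
    ... | no z∉  = *-congˡ (f≗g (suc z ∷ σ) (Valid-∷ v z∉))

  D*-∷ʳ : (f : Functional k) (σ : Vec ℕ k) (i : ℕ) → D* f (σ ∷ʳ i) ≋ w i * f σ
  D*-∷ʳ f σ i = reflexive (≡.cong₂ (λ j τ → w j * f τ) (last-∷ʳ i σ) (init-∷ʳ i σ))

  D*-cong : {f g : Functional k} → f ≗ᵛ g → D* f ≗ᵛ D* g
  D*-cong {f = f} {g} f≗g = ∷ʳ-elim _ λ σ i v →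
    trans (D*-∷ʳ f σ i) (trans (*-congˡ (f≗g σ (proj₁ (Valid-∷ʳ⁻ σ v)))) (sym (D*-∷ʳ g σ i)))

  ⊝-cong : {f f′ g g′ : Functional k} → f ≗ᵛ f′ → g ≗ᵛ g′ → f ⊝ g ≗ᵛ f′ ⊝ g′
  ⊝-cong f≗f′ g≗g′ σ v = +-cong (f≗f′ σ v) (-‿cong (g≗g′ σ v))

  R*-cong : {f g : Functional (suc k)} → f ≗ᵛ g → R* f ≗ᵛ R* g
  R*-cong f≗g = ⊝-cong (D*-cong (M*-cong f≗g)) (M*-cong (D*-cong f≗g))

  S*-cong : ∀ t {f g : Functional k} → f ≗ᵛ g → S* t f ≗ᵛ S* t g
  S*-cong t f≗g σ v = +-cong (*-congˡ (f≗g σ v)) (*-congˡ (f≗g (swap t σ) (Valid-swap t v)))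

  M*-⊞ : (f g : Functional (suc k)) (σ : Vec ℕ k) → M* (f ⊞ᶠ g) σ ≋ M* f σ + M* g σ
  M*-⊞ f g σ = trans (∑-cong (0 ∷ σ) λ z → distribˡ _ _ _) (∑-+ (0 ∷ σ) _ _)

  M*-⊝ : (f g : Functional (suc k)) (σ : Vec ℕ k) → M* (f ⊝ g) σ ≋ M* f σ - M* g σ
  M*-⊝ f g σ = trans (∑-cong (0 ∷ σ) λ z → solve 3 (λ p x y → p :* (x :- y) := p :* x :+ :- (p :* y)) refl _ _ _)
    (trans (∑-+ (0 ∷ σ) _ _) (+-congˡ (∑-neg (0 ∷ σ) _)))

  D*-⊞ : (f g : Functional k) (σ : Vec ℕ (suc k)) → D* (f ⊞ᶠ g) σ ≋ D* f σ + D* g σ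
  D*-⊞ f g σ = distribˡ _ _ _

  D*-⊝ : (f g : Functional k) (σ : Vec ℕ (suc k)) → D* (f ⊝ g) σ ≋ D* f σ - D* g σ
  D*-⊝ f g σ = solve 3 (λ p x y → p :* (x :- y) := p :* x :- p :* y) refl _ _ _

  S*-⊝ : ∀ t (f g : Functional k) (σ : Vec ℕ k) → S* t (f ⊝ g) σ ≋ S* t f σ - S* t g σ
  S*-⊝ t f g σ = solve 6 (λ p q x y x′ y′ → p :* (x :- y) :+ q :* (x′ :- y′) := (p :* x :+ q :* x′) :-
    (p :* y :+ q :* y′))
    refl _ _ _ _ _ _

  S*-⊞ : ∀ t (f g : Functional k) (σ : Vec ℕ k) → S* t (f ⊞ᶠ g) σ ≋ S* t f σ + S* t g σ
  S*-⊞ t f g σ = solve 6 (λ p q x y x′ y′ → p :* (x :+ y) :+ q :* (x′ :+ y′) := (p :* x :+ q :* x′) :+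
    (p :* y :+ q :* y′))
    refl _ _ _ _ _ _

  M*-∷ : (f : Functional (suc (suc k))) (u : ℕ) (σ : Vec ℕ k) →
        M* f (u ∷ σ) ≋ weight u σ • f (suc u ∷ u ∷ σ)
                      + ∑[ z ∈ 0 ∷ σ ] ((β⊖ z u ℚ.* weight z σ) • f (suc z ∷ u ∷ σ))
  M*-∷ f u σ = trans (solve 3 (λ x y z → x :+ (y :+ z) := y :+ (x :+ z)) refl _ _ _)
    (+-congʳ (•-congʳ (≡.trans (≡.cong (ℚ._* weight u σ) (β⊖-refl u)) (ℚ.*-identityˡ _))))

  M*-∷ʳ : (f : Functional (suc (suc k))) (σ : Vec ℕ k) (i : ℕ) →
         M* f (σ ∷ʳ i) ≋ ∑[ z ∈ 0 ∷ σ ] ((β⊖ z i ℚ.* weight z σ) • f (suc z ∷ (σ ∷ʳ i)))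
                        + weight i σ • f (suc i ∷ (σ ∷ʳ i))
  M*-∷ʳ f σ i = trans (∑-∷ʳ (0 ∷ σ) i _) (+-cong
    (∑-cong (0 ∷ σ) λ z → •-congʳ (weight-∷ʳ z σ i))
    (•-congʳ (≡.trans (weight-∷ʳ i σ i) (≡.trans (≡.cong (ℚ._* weight i σ) (β⊖-refl i)) (ℚ.*-identityˡ _)))))

  -- The second step extends either the entry z + 1 just added (first sum) or an element of `0 ∷ σ`
  -- (second sum).
  M*M* : (f : Functional (suc (suc k))) (σ : Vec ℕ k) →
       M* (M* f) σ ≋ ∑[ z ∈ 0 ∷ σ ] ((weight z σ ℚ.* weight (suc z) σ) • f (suc (suc z) ∷ suc z ∷ σ))
                   + ∑[ z ∈ 0 ∷ σ ] ∑[ z′ ∈ 0 ∷ σ ] (pair-weight z z′ σ • f (suc z′ ∷ suc z ∷ σ))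
  M*M* f σ = trans (∑-cong (0 ∷ σ) λ z → trans (*-congˡ (M*-∷ f (suc z) σ))
      (trans (distribˡ _ _ _) (+-cong (•-• (weight z σ) _ _)
        (trans (sym (∑-*ˡ (0 ∷ σ) _ _)) (∑-cong (0 ∷ σ) λ z′ → trans (•-• (weight z σ) _ _)
          (•-congʳ (*-rotate (weight z σ) (β⊖ z′ (suc z)) (weight z′ σ))))))))
    (∑-+ (0 ∷ σ) _ _)

  -- On V, s M M = M M. Consecutive entries z + 1, z + 2 have κ = 1 and are fixed by s; in the other
  -- terms the two orders of choice are paired up.
  M*M*S* : (f : Functional (suc (suc k))) → M* (M* (S* 0 f)) ≗ᵛ M* (M* f)
  M*M*S* f σ v = begin
    M* (M* (S* 0 f)) σ ≈⟨ M*M* (S* 0 f) σ ⟩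
    ∑[ z ∈ N ] (diag z • S* 0 f (suc (suc z) ∷ suc z ∷ σ)) + ∑[ z ∈ N ] ∑[ z′ ∈ N ]
      (pair-weight z z′ σ • S* 0 f (suc z′ ∷ suc z ∷ σ))
      ≈⟨ +-cong (∑-cong N λ z → *-congˡ {ι (diag z)} (step₁ z)) step₂ ⟩
    ∑[ z ∈ N ] (diag z • f (suc (suc z) ∷ suc z ∷ σ)) + ∑[ z ∈ N ] ∑[ z′ ∈ N ] (pair-weight z z′ σ • F z′ z)
      ≈⟨ M*M* f σ ⟨
    M* (M* f) σ ∎
    where
    N = 0 ∷ σ
    F : ℕ → ℕ → Carrier
    F z′ z = f (suc z′ ∷ suc z ∷ σ)
    diag : ℕ → ℚ
    diag z = weight z σ ℚ.* weight (suc z) σ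
    step₁ : ∀ z → S* 0 f (suc (suc z) ∷ suc z ∷ σ) ≋ f (suc (suc z) ∷ suc z ∷ σ)
    step₁ z = trans (+-cong (trans (•-congʳ (κ⊖-1 (suc z))) (•-one _))
      (•-zero _ (≡.cong (λ t → 1ℚ ℚ.- t) (κ⊖-1 (suc z))))) (+-identityʳ _)
    step₂ = begin
      ∑[ z ∈ N ] ∑[ z′ ∈ N ] (pair-weight z z′ σ • S* 0 f (suc z′ ∷ suc z ∷ σ))
        ≈⟨ ∑-cong N (λ z → trans (∑-cong N λ z′ → trans (*-congˡ (S*₀ f z′ z))
             (trans (distribˡ _ _ _) (+-cong (•-• _ _ _) (•-• _ _ _)))) (∑-+ N _ _)) ⟩
      ∑[ z ∈ N ] (∑[ z′ ∈ N ] ((pair-weight z z′ σ ℚ.* κ⊖ z′ z) • F z′ z) + ∑[ z′ ∈ N ]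
        ((pair-weight z z′ σ ℚ.* β⊖ z z′) • F z z′))
        ≈⟨ ∑-+ N _ _ ⟩
      ∑[ z ∈ N ] ∑[ z′ ∈ N ] ((pair-weight z z′ σ ℚ.* κ⊖ z′ z) • F z′ z) + ∑[ z ∈ N ] ∑[ z′ ∈ N ]
        ((pair-weight z z′ σ ℚ.* β⊖ z z′) • F z z′)
        -- Renaming z and z′ in the transposed half collects all terms at F z′ z.
        ≈⟨ +-congˡ (∑-swap N N _) ⟩
      ∑[ z ∈ N ] ∑[ z′ ∈ N ] ((pair-weight z z′ σ ℚ.* κ⊖ z′ z) • F z′ z) + ∑[ z ∈ N ] ∑[ z′ ∈ N ]
        ((pair-weight z′ z σ ℚ.* β⊖ z′ z) • F z′ z)
        ≈⟨ ∑-+ N _ _ ⟨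
      ∑[ z ∈ N ] (∑[ z′ ∈ N ] ((pair-weight z z′ σ ℚ.* κ⊖ z′ z) • F z′ z) + ∑[ z′ ∈ N ]
        ((pair-weight z′ z σ ℚ.* β⊖ z′ z) • F z′ z))
        ≈⟨ ∑-cong∈ N (λ z z∈ → trans (sym (∑-+ N _ _))
             (∑-cong∈ N λ z′ z′∈ → trans (sym (•-+ _ _ _)) (•-congʳ (pair-symmetrise z∈ z′∈)))) ⟩
      ∑[ z ∈ N ] ∑[ z′ ∈ N ] (pair-weight z z′ σ • F z′ z) ∎
      where
      S*₀ : ∀ f z′ z → S* 0 f (suc z′ ∷ suc z ∷ σ) ≋ κ⊖ z′ z • f (suc z′ ∷ suc z ∷ σ)
          + β⊖ z z′ • f (suc z ∷ suc z′ ∷ σ)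
      S*₀ f z′ z = +-cong (•-congʳ (κ⊖-suc z′ z))
        (•-congʳ (≡.cong (1ℚ ℚ.+_) (≡.trans (≡.cong ℚ.-_ (κ⊖-suc z′ z)) (≡.sym (κ⊖-swap z z′)))))

  ∑-swap-vec : ∀ t (σ : Vec B k) (f : B → Carrier) → ∑ (swap t σ) f ≋ ∑ σ f
  ∑-swap-vec zero    []          f = refl
  ∑-swap-vec zero    (x ∷ [])    f = refl
  ∑-swap-vec zero    (x ∷ y ∷ σ) f = solve 3 (λ x y z → y :+ (x :+ z) := x :+ (y :+ z)) refl _ _ _
  ∑-swap-vec (suc t) []          f = refl
  ∑-swap-vec (suc t) (x ∷ σ)     f = +-congˡ (∑-swap-vec t σ f)

  -- The weight of an appended entry is symmetric in the old ones. The new entry comes first, so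
  -- position t becomes t + 1.
  S*M* : ∀ t (f : Functional (suc k)) → S* t (M* f) ≗ᵛ M* (S* (suc t) f)
  S*M* t f σ _ = sym (begin
    M* (S* (suc t) f) σ
      ≈⟨ ∑-cong (0 ∷ σ) (λ z → solve 5 (λ q p p′ x y → q :* (p :* x :+ p′ :* y) := p :* (q :* x) :+ p′ :*
           (q :* y)) refl
           (ι (weight z σ)) (ι p) (ι p′) (f (suc z ∷ σ)) (f (suc z ∷ swap t σ))) ⟩
    ∑[ z ∈ 0 ∷ σ ] (p • weight z σ • f (suc z ∷ σ) + p′ • weight z σ • f (suc z ∷ swap t σ))
      ≈⟨ trans (∑-+ (0 ∷ σ) _ _) (+-cong (∑-*ˡ (0 ∷ σ) _ _) (∑-*ˡ (0 ∷ σ) _ _)) ⟩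
    p • M* f σ + p′ • (∑[ z ∈ 0 ∷ σ ] (weight z σ • f (suc z ∷ swap t σ)))
      ≈⟨ +-congˡ (*-congˡ (∑-cong (0 ∷ σ) λ z → •-congʳ (≡.sym (weight-swap z t σ)))) ⟩
    p • M* f σ + p′ • (∑[ z ∈ 0 ∷ σ ] (weight z (swap t σ) • f (suc z ∷ swap t σ)))
      ≈⟨ +-congˡ (*-congˡ (∑-swap-vec (suc t) (0 ∷ σ) _)) ⟨
    p • M* f σ + p′ • M* f (swap t σ) ∎)
    where
    p  = swap-κ t σ
    p′ = 1ℚ ℚ.- p

  -- The bound keeps the exchanged positions away from the oldest entry.
  S*D* : ∀ t (f : Functional k) → suc t < k → S* t (D* f) ≗ᵛ D* (S* t f)
  S*D* t f t<k = ∷ʳ-elim _ λ τ i _ → let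
      κ′ = swap-κ t (τ ∷ʳ i)
      eq = swap-κ-∷ʳ t τ i t<k
    in begin
    κ′ • D* f (τ ∷ʳ i) + (1ℚ ℚ.- κ′) • D* f (swap t (τ ∷ʳ i))
      ≈⟨ +-cong (trans (•-congʳ eq) (*-congˡ (D*-∷ʳ f τ i)))
           (trans (•-congʳ (≡.cong (λ q → 1ℚ ℚ.- q) eq))
             (*-congˡ (trans (reflexive (≡.cong (D* f) (swap-∷ʳ t τ i t<k))) (D*-∷ʳ f _ i)))) ⟩
    swap-κ t τ • (w i * f τ) + (1ℚ ℚ.- swap-κ t τ) • (w i * f (swap t τ))
      ≈⟨ solve 5 (λ w p p′ x y → p :* (w :* x) :+ p′ :* (w :* y) := w :* (p :* x :+ p′ :* y)) refl _ _ _ _ _ ⟩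
    w i * S* t f τ
      ≈⟨ D*-∷ʳ (S* t f) τ i ⟨
    D* (S* t f) (τ ∷ʳ i) ∎

  D*D*-∷ʳ : (f : Functional k) (σ : Vec ℕ k) (j i : ℕ) → D* (D* f) (σ ∷ʳ j ∷ʳ i) ≋ w i * (w j * f σ)
  D*D*-∷ʳ f σ j i = trans (D*-∷ʳ (D* f) (σ ∷ʳ j) i) (*-congˡ (D*-∷ʳ f σ j))

  S*-last : (f : Functional (suc (suc k))) (σ : Vec ℕ k) (j i : ℕ) →
           S* k f (σ ∷ʳ j ∷ʳ i) ≋ κ⊖ j i • f (σ ∷ʳ j ∷ʳ i) + β⊖ i j • f (σ ∷ʳ i ∷ʳ j)
  S*-last f σ j i = +-cong (•-congʳ (swap-κ-last σ j i))
    (trans (•-congʳ (≡.trans (≡.cong (λ q → 1ℚ ℚ.- q) (swap-κ-last σ j i)) (≡.cong (1ℚ ℚ.+_) (≡.sym (κ⊖-swap i j)))))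
           (*-congˡ (reflexive (≡.cong f (swap-last σ j i)))))

  κ+β : ∀ j i x → κ⊖ j i • x + β⊖ i j • x ≋ x
  κ+β j i x = trans (sym (•-+ _ _ _)) (trans (•-congʳ (κ⊖+β⊖ j i)) (•-one x))

  -- D D attaches the symmetric factor w i · w j to the two oldest entries, and the coefficients of
  -- s add up to 1.
  S*D*D* : (f : Functional k) → S* k (D* (D* f)) ≗ᵛ D* (D* f)
  S*D*D* {k} f = ∷ʳ-elim _ λ τ i → ∷ʳ-elim (λ τ → Valid (τ ∷ʳ i) → S* k (D* (D* f)) (τ ∷ʳ i) ≋ D* (D* f)
    (τ ∷ʳ i)) (λ σ j _ → begin
    S* k (D* (D* f)) (σ ∷ʳ j ∷ʳ i)
      ≈⟨ S*-last (D* (D* f)) σ j i ⟩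
    κ⊖ j i • D* (D* f) (σ ∷ʳ j ∷ʳ i) + β⊖ i j • D* (D* f) (σ ∷ʳ i ∷ʳ j)
      ≈⟨ +-congˡ (*-congˡ (trans (D*D*-∷ʳ f σ i j) (trans (x∙yz≈y∙xz _ _ _) (sym (D*D*-∷ʳ f σ j i))))) ⟩
    κ⊖ j i • D* (D* f) (σ ∷ʳ j ∷ʳ i) + β⊖ i j • D* (D* f) (σ ∷ʳ j ∷ʳ i)
      ≈⟨ κ+β j i _ ⟩
    D* (D* f) (σ ∷ʳ j ∷ʳ i) ∎) τ

  -- Every term carries w i · w j. What is left is compared in `core`, one appended value z at a
  -- time: by `weight-exchange` for z in `0 ∷ σ`, and at once for z = j and z = i.
  D*M*D*-∷ʳ : (f : Functional (suc k)) (σ : Vec ℕ k) (j i : ℕ) → Valid (σ ∷ʳ j ∷ʳ i) →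
    (D* (M* (D* f)) ⊞ᶠ S* k (D* (M* (D* f)))) (σ ∷ʳ j ∷ʳ i) ≋ (D* (D* (M* f)) ⊞ᶠ M* (D* (D* f))) (σ ∷ʳ j ∷ʳ i)
  D*M*D*-∷ʳ {k} f σ j i v = begin
    D* (M* (D* f)) (σ ∷ʳ j ∷ʳ i) + S* k (D* (M* (D* f))) (σ ∷ʳ j ∷ʳ i)
      ≈⟨ +-cong (DMD j i) (trans (S*-last (D* (M* (D* f))) σ j i) (+-cong (*-congˡ (DMD j i)) (*-congˡ (DMD i j)))) ⟩
    w i * (w j * Q j) + (κ⊖ j i • (w i * (w j * Q j)) + β⊖ i j • (w j * (w i * Q i)))
      ≈⟨ solve 6 (λ x y p q a c → x :* (y :* a) :+ (p :* (x :* (y :* a)) :+ q :* (y :* (x :* c)))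
           := x :* (y :* ((a :+ p :* a) :+ q :* c))) refl (w i) (w j) (ι (κ⊖ j i)) (ι (β⊖ i j)) (Q j) (Q i) ⟩
    w i * (w j * ((Q j + κ⊖ j i • Q j) + β⊖ i j • Q i))
      ≈⟨ *-congˡ (*-congˡ core) ⟩
    w i * (w j * (P + T))
      ≈⟨ solve 4 (λ x y p t → x :* (y :* (p :+ t)) := x :* (y :* p) :+ x :* (y :* t)) refl _ _ _ _ ⟩
    w i * (w j * P) + w i * (w j * T)
      ≈⟨ +-cong (sym (D*D*-∷ʳ (M* f) σ j i)) (sym MDD) ⟩
    D* (D* (M* f)) (σ ∷ʳ j ∷ʳ i) + M* (D* (D* f)) (σ ∷ʳ j ∷ʳ i) ∎
    where
    N = 0 ∷ σ
    F : ℕ → Carrier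
    F z = f (suc z ∷ σ)
    P = M* f σ
    Q : ℕ → Carrier
    Q j = ∑[ z ∈ N ] ((β⊖ z j ℚ.* weight z σ) • F z) + weight j σ • F j
    T = ∑[ z ∈ N ] ((β⊖ z i ℚ.* (β⊖ z j ℚ.* weight z σ)) • F z)
        + (β⊖ j i ℚ.* weight j σ) • F j + (β⊖ i j ℚ.* weight i σ) • F i
    DMD : ∀ j i → D* (M* (D* f)) (σ ∷ʳ j ∷ʳ i) ≋ w i * (w j * Q j)
    DMD j i = trans (D*-∷ʳ (M* (D* f)) (σ ∷ʳ j) i) (*-congˡ (trans (M*-∷ʳ (D* f) σ j)
      (trans (+-cong
        (trans (∑-cong N λ z → trans (*-congˡ (D*-∷ʳ f (suc z ∷ σ) j)) (x∙yz≈y∙xz _ _ _))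
               (∑-*ˡ N (w j) _))
        (trans (*-congˡ (D*-∷ʳ f (suc j ∷ σ) j)) (x∙yz≈y∙xz _ _ _)))
      (sym (distribˡ _ _ _)))))
    pull : ∀ q z → q • D* (D* f) (suc z ∷ (σ ∷ʳ j ∷ʳ i)) ≋ (w i * w j) * (q • F z)
    pull q z = trans (*-congˡ (D*D*-∷ʳ f (suc z ∷ σ) j i))
      (solve 4 (λ q x y t → q :* (x :* (y :* t)) := (x :* y) :* (q :* t)) refl _ _ _ _)
    MDD : M* (D* (D* f)) (σ ∷ʳ j ∷ʳ i) ≋ w i * (w j * T)
    MDD = begin
      M* (D* (D* f)) (σ ∷ʳ j ∷ʳ i)
        ≈⟨ M*-∷ʳ (D* (D* f)) (σ ∷ʳ j) i ⟩
      ∑[ z ∈ 0 ∷ (σ ∷ʳ j) ] ((β⊖ z i ℚ.* weight z (σ ∷ʳ j)) • D* (D* f) (suc z ∷ (σ ∷ʳ j ∷ʳ i)))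
        + weight i (σ ∷ʳ j) • D* (D* f) (suc i ∷ (σ ∷ʳ j ∷ʳ i))
        ≈⟨ +-cong (∑-cong (0 ∷ (σ ∷ʳ j)) λ z → pull (β⊖ z i ℚ.* weight z (σ ∷ʳ j)) z) (pull (weight i (σ ∷ʳ j)) i) ⟩
      ∑[ z ∈ 0 ∷ (σ ∷ʳ j) ] ((w i * w j) * ((β⊖ z i ℚ.* weight z (σ ∷ʳ j)) • F z)) + (w i * w j) *
        (weight i (σ ∷ʳ j) • F i)
        ≈⟨ +-congʳ (trans (∑-*ˡ (0 ∷ (σ ∷ʳ j)) _ _) (*-congˡ (∑-∷ʳ N j _))) ⟩
      (w i * w j) * (∑[ z ∈ N ] ((β⊖ z i ℚ.* weight z (σ ∷ʳ j)) • F z) + (β⊖ j i ℚ.* weight j (σ ∷ʳ j)) • F j)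
        + (w i * w j) * (weight i (σ ∷ʳ j) • F i)
        ≈⟨ solve 4 (λ x y p q → (x :* y) :* p :+ (x :* y) :* q := x :* (y :* (p :+ q))) refl _ _ _ _ ⟩
      w i * (w j * (∑[ z ∈ N ] ((β⊖ z i ℚ.* weight z (σ ∷ʳ j)) • F z) + (β⊖ j i ℚ.* weight j (σ ∷ʳ j)) • F j
        + weight i (σ ∷ʳ j) • F i))
        ≈⟨ *-congˡ (*-congˡ (+-cong (+-cong
             (∑-cong N λ z → •-congʳ (≡.cong (β⊖ z i ℚ.*_) (weight-∷ʳ z σ j)))
             (•-congʳ (≡.cong (β⊖ j i ℚ.*_) (≡.trans (weight-∷ʳ j σ j)
               (≡.trans (≡.cong (ℚ._* weight j σ) (β⊖-refl j)) (ℚ.*-identityˡ _))))))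
             (•-congʳ (weight-∷ʳ i σ j)))) ⟩
      w i * (w j * T) ∎
    i∉τ = proj₂ (Valid-∷ʳ⁻ (σ ∷ʳ j) v)
    j∉σ = proj₂ (Valid-∷ʳ⁻ σ (proj₁ (Valid-∷ʳ⁻ (σ ∷ʳ j) v)))
    j≢i : j ≢ i
    j≢i ≡.refl = i∉τ (there (∈-∷ʳ-last σ))
    i∉σ : i ∉ N
    i∉σ (here p) = i∉τ (here p)
    i∉σ (there p) = i∉τ (there (∈-∷ʳ-init p))
    core : (Q j + κ⊖ j i • Q j) + β⊖ i j • Q i ≋ P + T
    core = begin
      (Q j + κ⊖ j i • Q j) + β⊖ i j • Q i
        ≈⟨ +-congʳ (trans (+-congʳ (sym (•-one _))) (sym (•-+ 1ℚ _ _))) ⟩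
      β⊖ j i • Q j + β⊖ i j • Q i
        ≈⟨ +-cong (distribˡ _ _ _) (distribˡ _ _ _) ⟩
      (β⊖ j i • (∑[ z ∈ N ] ((β⊖ z j ℚ.* weight z σ) • F z)) + β⊖ j i • weight j σ • F j)
        + (β⊖ i j • (∑[ z ∈ N ] ((β⊖ z i ℚ.* weight z σ) • F z)) + β⊖ i j • weight i σ • F i)
        ≈⟨ +-cong (+-cong (sym (∑-*ˡ N _ _)) (•-• _ _ _)) (+-cong (sym (∑-*ˡ N _ _)) (•-• _ _ _)) ⟩
      (∑[ z ∈ N ] (β⊖ j i • (β⊖ z j ℚ.* weight z σ) • F z) + (β⊖ j i ℚ.* weight j σ) • F j)
        + (∑[ z ∈ N ] (β⊖ i j • (β⊖ z i ℚ.* weight z σ) • F z) + (β⊖ i j ℚ.* weight i σ) • F i)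
        ≈⟨ solve 4 (λ a b′ c d → (a :+ b′) :+ (c :+ d) := ((a :+ c) :+ b′) :+ d) refl _ _ _ _ ⟩
      ((∑[ z ∈ N ] (β⊖ j i • (β⊖ z j ℚ.* weight z σ) • F z) + ∑[ z ∈ N ] (β⊖ i j • (β⊖ z i ℚ.* weight z σ) • F z))
        + (β⊖ j i ℚ.* weight j σ) • F j) + (β⊖ i j ℚ.* weight i σ) • F i
        ≈⟨ +-congʳ (+-congʳ (trans (sym (∑-+ N _ _)) (trans (∑-cong∈ N λ z z∈ →
             trans (+-cong (•-• _ _ _) (•-• _ _ _))
               (trans (sym (•-+ _ _ _)) (trans
               (•-congʳ (weight-exchange (weight z σ) (λ { ≡.refl → j∉σ z∈ }) (λ { ≡.refl → i∉σ z∈ }) j≢i))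
               (•-+ _ _ _))))
             (∑-+ N _ _)))) ⟩
      ((P + ∑[ z ∈ N ] ((β⊖ z i ℚ.* (β⊖ z j ℚ.* weight z σ)) • F z)) + (β⊖ j i ℚ.* weight j σ) • F j) +
        (β⊖ i j ℚ.* weight i σ) • F i
        ≈⟨ solve 4 (λ a b′ c d → ((a :+ b′) :+ c) :+ d := a :+ ((b′ :+ c) :+ d)) refl _ _ _ _ ⟩
      P + T ∎

  -- On V, this is D M D (1 + s) = M D D + D D M at the two oldest entries.
  D*M*D* : (f : Functional (suc k)) →
         D* (M* (D* f)) ⊞ᶠ S* k (D* (M* (D* f))) ≗ᵛ D* (D* (M* f)) ⊞ᶠ M* (D* (D* f))
  D*M*D* {k} f = ∷ʳ-elim _ λ τ i → ∷ʳ-elim (λ τ → Valid (τ ∷ʳ i) → LHS (τ ∷ʳ i) ≋ RHS (τ ∷ʳ i))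
    (λ σ j → D*M*D*-∷ʳ f σ j i) τ
    where
    LHS = D* (M* (D* f)) ⊞ᶠ S* k (D* (M* (D* f)))
    RHS = D* (D* (M* f)) ⊞ᶠ M* (D* (D* f))

  -- Every term carries w i and a multiple of some `F z′ z`, the value of f after z + 1 and then z′
  -- + 1 have been appended. `L₁` to `L₄` sort the left side by whether the second step extends the
  -- first and whether the oldest entry i is extended; `R₁` to `R₄` and `∑∑₂` do so for
  -- `M* (M* (D* f))`. Applying 1 + s splits `L₄` into `L₅` and `L₆`.
  M*D*M*-∷ʳ : (f : Functional (suc (suc k))) (σ : Vec ℕ k) (i : ℕ) → Valid (σ ∷ʳ i) →
    M* (D* (M* (f ⊞ᶠ S* 0 f))) (σ ∷ʳ i) ≋ D* (M* (M* f)) (σ ∷ʳ i) + M* (M* (D* f)) (σ ∷ʳ i)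
  M*D*M*-∷ʳ {k} f σ i v = begin
    M* (D* (M* g)) (σ ∷ʳ i)
      ≈⟨ trans (M*-∷ʳ (D* (M* g)) σ i)
           (+-cong (trans (∑-cong N λ z → pull (M* g) (suc z ∷ σ) (βᵢ z ℚ.* a z)) (∑-*ˡ N _ _))
           (pull (M* g) (suc i ∷ σ) (a i))) ⟩
    w i * (∑[ z ∈ N ] ((βᵢ z ℚ.* a z) • M* g (suc z ∷ σ))) + w i * (a i • M* g (suc i ∷ σ))
      ≈⟨ distribˡ _ _ _ ⟨
    w i * (∑[ z ∈ N ] ((βᵢ z ℚ.* a z) • M* g (suc z ∷ σ)) + a i • M* g (suc i ∷ σ))
      ≈⟨ *-congˡ (+-cong
           (trans (∑-cong N λ z → trans (step (βᵢ z ℚ.* a z) z)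
             (+-congˡ (∑-cong N λ z′ → •-congʳ (*-rotate′ (βᵢ z) (a z) (β⊖ z′ (suc z)) (a z′))))) (∑-+ N _ _))
           (trans (step (a i) i) (+-congˡ (∑-cong N λ z → •-congʳ (*-rotate (a i) (β⊖ z (suc i)) (a z)))))) ⟩
    w i * ((∑[ z ∈ N ] (L₁ z) + ∑[ z ∈ N ] ∑[ z′ ∈ N ] (L₂ z z′)) + (L₃ + ∑[ z ∈ N ] (L₄ z)))
      ≈⟨ *-congˡ (+-cong (+-congˡ off-diagonal) (+-congˡ (trans (∑-cong N expand₄) (∑-+ N _ _)))) ⟩
    w i * ((∑[ z ∈ N ] (L₁ z) + (∑∑₁ + ∑∑₂)) + (L₃ + (∑[ z ∈ N ] (L₅ z) + ∑[ z ∈ N ] (L₆ z))))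
      -- `L₆` is grouped with the diagonal `L₁` because for z + 1 = i its term, too, is a multiple
      -- of F (z + 1) z.
      ≈⟨ *-congˡ (solve 6 (λ p q r s t u → (p :+ (q :+ r)) :+ (s :+ (t :+ u)) := (p :+ u) :+
           ((q :+ r) :+ (s :+ t))) refl _ _ _ _ _ _) ⟩
    w i * ((∑[ z ∈ N ] (L₁ z) + ∑[ z ∈ N ] (L₆ z)) + ((∑∑₁ + ∑∑₂) + (L₃ + ∑[ z ∈ N ] (L₅ z))))
      ≈⟨ *-congˡ (+-cong diagonal (+-congˡ (+-cong last-diagonal (∑-cong N λ z → •-congʳ (arrange₅ z))))) ⟩
    w i * (((∑[ z ∈ N ] (d z • F (suc z) z) + ∑[ z ∈ N ] (R₁ z)) + ∑[ z ∈ N ] (R₂ z)) +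
      ((∑∑₁ + ∑∑₂) + (R₃ + ∑[ z ∈ N ] (R₄ z))))
      ≈⟨ solve 8 (λ w p q r s t u v → w :* (((p :+ q) :+ r) :+ ((s :+ t) :+ (u :+ v))) := w :* (p :+ s) :+ w :*
           ((q :+ u) :+ (t :+ r :+ v))) refl _ _ _ _ _ _ _ _ ⟩
    w i * (∑[ z ∈ N ] (d z • F (suc z) z) + ∑∑₁) + w i *
      ((∑[ z ∈ N ] (R₁ z) + R₃) + (∑∑₂ + ∑[ z ∈ N ] (R₂ z) + ∑[ z ∈ N ] (R₄ z)))
      ≈⟨ +-cong (trans (*-congˡ (sym (M*M* f σ))) (sym (D*-∷ʳ (M* (M* f)) σ i))) (sym MMD) ⟩
    D* (M* (M* f)) (σ ∷ʳ i) + M* (M* (D* f)) (σ ∷ʳ i) ∎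
    where
    N = 0 ∷ σ
    i∉ = proj₂ (Valid-∷ʳ⁻ σ v)
    g = f ⊞ᶠ S* 0 f
    a βᵢ d : ℕ → ℚ
    a z = weight z σ
    βᵢ z = β⊖ z i
    d z = weight z σ ℚ.* weight (suc z) σ
    c : ℕ → ℕ → ℚ
    c z z′ = pair-weight z z′ σ
    F G : ℕ → ℕ → Carrier
    F z′ z = f (suc z′ ∷ suc z ∷ σ)
    G z′ z = g (suc z′ ∷ suc z ∷ σ)
    G-F : ∀ z′ z → G z′ z ≋ β⊖ z′ z • F z′ z + β⊖ z z′ • F z z′
    G-F z′ z = trans (+-congˡ (+-cong (•-congʳ (κ⊖-suc z′ z))
      (•-congʳ (≡.cong (1ℚ ℚ.+_) (≡.trans (≡.cong ℚ.-_ (κ⊖-suc z′ z)) (≡.sym (κ⊖-swap z z′)))))))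
      (trans (sym (+-assoc _ _ _)) (+-congʳ (trans (+-congʳ (sym (•-one _))) (sym (•-+ 1ℚ _ _)))))
    G-diagonal : ∀ z → G (suc z) z ≋ (1ℚ ℚ.+ 1ℚ) • F (suc z) z
    G-diagonal z = trans (G-F (suc z) z) (trans (+-cong (•-congʳ (β⊖-1 z)) (•-zero _ (β⊖-pred z))) (+-identityʳ _))
    pull : ∀ {k} (h : Functional k) τ (q : ℚ) → q • D* h (τ ∷ʳ i) ≋ w i * (q • h τ)
    pull h τ q = trans (*-congˡ (D*-∷ʳ h τ i)) (x∙yz≈y∙xz _ _ _)
    L₁ L₄ L₅ L₆ R₁ R₂ R₄ : ℕ → Carrier
    L₂ : ℕ → ℕ → Carrier
    L₃ R₃ ∑∑₁ ∑∑₂ : Carrier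
    L₁ z    = (βᵢ z ℚ.* a z ℚ.* a (suc z)) • G (suc z) z
    L₂ z z′ = (βᵢ z ℚ.* c z z′) • G z′ z
    L₃      = (a i ℚ.* a (suc i)) • G (suc i) i
    L₄ z    = (c i z) • G z i
    L₅ z    = (c i z ℚ.* β⊖ z i) • F z i
    L₆ z    = (c i z ℚ.* β⊖ i z) • F i z
    R₁ z    = (βᵢ z ℚ.* a z ℚ.* (βᵢ (suc z) ℚ.* a (suc z))) • F (suc z) z
    R₂ z    = (βᵢ z ℚ.* c z i) • F i z
    R₃      = (a i ℚ.* (βᵢ (suc i) ℚ.* a (suc i))) • F (suc i) i
    R₄ z    = (βᵢ z ℚ.* c i z) • F z i
    ∑∑₁ = ∑[ z ∈ N ] ∑[ z′ ∈ N ] (c z z′ • F z′ z)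
    ∑∑₂ = ∑[ z ∈ N ] ∑[ z′ ∈ N ] ((βᵢ z ℚ.* βᵢ z′ ℚ.* c z z′) • F z′ z)
    step : ∀ q z → q • M* g (suc z ∷ σ) ≋ (q ℚ.* a (suc z)) • G (suc z) z + ∑[ z′ ∈ N ]
      ((q ℚ.* (β⊖ z′ (suc z) ℚ.* a z′)) • G z′ z)
    step q z = trans (*-congˡ (M*-∷ g (suc z) σ)) (trans (distribˡ _ _ _) (+-cong (•-• q _ _)
      (trans (sym (∑-*ˡ N _ _)) (∑-cong N λ z′ → •-• q _ _))))
    expand₄ : ∀ z → L₄ z ≋ L₅ z + L₆ z
    expand₄ z = trans (*-congˡ (G-F z i)) (trans (distribˡ _ _ _) (+-cong (•-• (c i z) _ _) (•-• (c i z) _ _)))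
    arrange₅ : ∀ z → c i z ℚ.* β⊖ z i ≡ βᵢ z ℚ.* c i z
    arrange₅ z = ℚ.*-comm (c i z) (β⊖ z i)
    off-diagonal : ∑[ z ∈ N ] ∑[ z′ ∈ N ] (L₂ z z′) ≋ ∑∑₁ + ∑∑₂
    off-diagonal = begin
      ∑[ z ∈ N ] ∑[ z′ ∈ N ] (L₂ z z′)
        ≈⟨ ∑-cong N (λ z → trans (∑-cong N λ z′ → trans (*-congˡ (G-F z′ z))
             (trans (distribˡ _ _ _) (+-cong (•-• (βᵢ z ℚ.* c z z′) _ _) (•-• (βᵢ z ℚ.* c z z′) _ _)))) (∑-+ N _ _)) ⟩
      ∑[ z ∈ N ] (∑[ z′ ∈ N ] ((βᵢ z ℚ.* c z z′ ℚ.* β⊖ z′ z) • F z′ z) + ∑[ z′ ∈ N ]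
        ((βᵢ z ℚ.* c z z′ ℚ.* β⊖ z z′) • F z z′))
        ≈⟨ ∑-+ N _ _ ⟩
      ∑[ z ∈ N ] ∑[ z′ ∈ N ] ((βᵢ z ℚ.* c z z′ ℚ.* β⊖ z′ z) • F z′ z) + ∑[ z ∈ N ] ∑[ z′ ∈ N ]
        ((βᵢ z ℚ.* c z z′ ℚ.* β⊖ z z′) • F z z′)
        ≈⟨ +-congˡ (∑-swap N N _) ⟩
      ∑[ z ∈ N ] ∑[ z′ ∈ N ] ((βᵢ z ℚ.* c z z′ ℚ.* β⊖ z′ z) • F z′ z) + ∑[ z ∈ N ] ∑[ z′ ∈ N ]
        ((βᵢ z′ ℚ.* c z′ z ℚ.* β⊖ z′ z) • F z′ z)
        ≈⟨ ∑-+ N _ _ ⟨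
      ∑[ z ∈ N ] (∑[ z′ ∈ N ] ((βᵢ z ℚ.* c z z′ ℚ.* β⊖ z′ z) • F z′ z) + ∑[ z′ ∈ N ]
        ((βᵢ z′ ℚ.* c z′ z ℚ.* β⊖ z′ z) • F z′ z))
        ≈⟨ ∑-cong∈ N (λ z z∈ → trans (sym (∑-+ N _ _)) (trans (∑-cong∈ N λ z′ z′∈ →
             trans (sym (•-+ _ _ _)) (trans (•-congʳ (pair-exchange z∈ z′∈ i∉)) (•-+ _ _ _))) (∑-+ N _ _))) ⟩
      ∑[ z ∈ N ] (∑[ z′ ∈ N ] (c z z′ • F z′ z) + ∑[ z′ ∈ N ] ((βᵢ z ℚ.* βᵢ z′ ℚ.* c z z′) • F z′ z))
        ≈⟨ ∑-+ N _ _ ⟩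
      ∑∑₁ + ∑∑₂ ∎
    last-diagonal : L₃ ≋ R₃
    last-diagonal = trans (*-congˡ (G-diagonal i)) (trans (•-• _ _ _) (•-congʳ
      (≡.trans (≡.cong (a i ℚ.* a (suc i) ℚ.*_) (≡.sym (β⊖-1 i)))
        (≡.sym (*-rotate (a i) (βᵢ (suc i)) (a (suc i)))))))
    diagonal : ∑[ z ∈ N ] (L₁ z) + ∑[ z ∈ N ] (L₆ z) ≋ (∑[ z ∈ N ] (d z • F (suc z) z) + ∑[ z ∈ N ] (R₁ z))
      + ∑[ z ∈ N ] (R₂ z)
    diagonal = trans (sym (∑-+ N _ _)) (trans (∑-cong∈ N each) (trans (∑-+ N _ _) (+-congʳ (∑-+ N _ _))))
      where
      -- When suc z = i, the term (z, z + 1) of D*M*M* matches the term (z, i) on the left.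
      each : ∀ z → z ∈ N → L₁ z + L₆ z ≋ (d z • F (suc z) z + R₁ z) + R₂ z
      each z z∈ with suc z ℕ.≟ i
      ... | yes ≡.refl = begin
        L₁ z + L₆ z ≈⟨ +-cong (•-zero _ (ℚ0ˡ₂ _ _ βz≡0)) (•-congʳ (pair-weight-suc z σ)) ⟩
        0# + d z • F i z ≈⟨ trans (+-identityˡ _) (trans (sym (+-identityʳ _)) (sym (+-identityʳ _))) ⟩
        (d z • F i z + 0#) + 0# ≈⟨ +-cong (+-congˡ (sym (•-zero _ (ℚ0ˡ₂ _ _ βz≡0)))) (sym (•-zero _ (ℚ0ˡ _ βz≡0))) ⟩
        (d z • F i z + R₁ z) + R₂ z ∎
        where
        βz≡0 : βᵢ z ≡ 0ℚ
        βz≡0 = β⊖-pred z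
        ℚ0ˡ : ∀ {p} q → p ≡ 0ℚ → p ℚ.* q ≡ 0ℚ
        ℚ0ˡ q ≡.refl = ℚ.*-zeroˡ q
        ℚ0ˡ₂ : ∀ {p} q r → p ≡ 0ℚ → p ℚ.* q ℚ.* r ≡ 0ℚ
        ℚ0ˡ₂ q r p≡0 = ℚ0ˡ r (ℚ0ˡ q p≡0)
      ... | no sz≢i = +-cong
        (trans (*-congˡ (G-diagonal z)) (trans (•-• _ _ _) (trans (•-congʳ (pair-diagonal z∈ i∉ sz≢i)) (•-+ _ _ _))))
        (•-congʳ (pair-with-last z∈ i∉ sz≢i))
    MMD : M* (M* (D* f)) (σ ∷ʳ i) ≋ w i * ((∑[ z ∈ N ] (R₁ z) + R₃) + (∑∑₂ + ∑[ z ∈ N ] (R₂ z) + ∑[ z ∈ N ] (R₄ z)))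
    MMD = begin
      M* (M* (D* f)) (σ ∷ʳ i)
        ≈⟨ M*M* (D* f) (σ ∷ʳ i) ⟩
      ∑[ z ∈ N′ ] ((weight z σ′ ℚ.* weight (suc z) σ′) • D* f ((suc (suc z) ∷ suc z ∷ σ) ∷ʳ i))
        + ∑[ z ∈ N′ ] ∑[ z′ ∈ N′ ] (pair-weight z z′ σ′ • D* f ((suc z′ ∷ suc z ∷ σ) ∷ʳ i))
        ≈⟨ +-cong (∑-cong N′ λ z → trans (pull f (suc (suc z) ∷ suc z ∷ σ) _)
             (*-congˡ (•-congʳ (≡.cong₂ ℚ._*_ (weight-∷ʳ z σ i) (weight-∷ʳ (suc z) σ i)))))
             (∑-cong N′ λ z → trans (∑-cong N′ λ z′ → trans (pull f (suc z′ ∷ suc z ∷ σ) _)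
               (*-congˡ (•-congʳ (pair-weight-∷ʳ z z′ σ i)))) (∑-*ˡ N′ _ _)) ⟩
      ∑[ z ∈ N′ ] (w i * ((βᵢ z ℚ.* a z ℚ.* (βᵢ (suc z) ℚ.* a (suc z))) • F (suc z) z))
        + ∑[ z ∈ N′ ] (w i * (∑[ z′ ∈ N′ ] ((βᵢ z ℚ.* βᵢ z′ ℚ.* c z z′) • F z′ z)))
        ≈⟨ trans (+-cong (∑-*ˡ N′ _ _) (∑-*ˡ N′ _ _)) (sym (distribˡ _ _ _)) ⟩
      w i * (∑[ z ∈ N′ ] (R₁ z) + ∑[ z ∈ N′ ] ∑[ z′ ∈ N′ ] ((βᵢ z ℚ.* βᵢ z′ ℚ.* c z z′) • F z′ z))
        ≈⟨ *-congˡ (+-cong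
             (trans (∑-∷ʳ N i _) (+-congˡ (•-congʳ (≡.cong (ℚ._* (βᵢ (suc i) ℚ.* a (suc i))) (βᵢi* (a i))))))
             (trans (∑-∷ʳ N i _) (+-cong
               (trans (∑-cong N λ z → trans (∑-∷ʳ N i _) (+-congˡ (•-congʳ (last-factor z)))) (∑-+ N _ _))
               (trans (∑-∷ʳ N i _) (trans (+-cong (∑-cong N λ z → •-congʳ (first-factor z))
                 (•-zero _ last-last)) (+-identityʳ _)))))) ⟩
      w i * ((∑[ z ∈ N ] (R₁ z) + R₃) + (∑∑₂ + ∑[ z ∈ N ] (R₂ z) + ∑[ z ∈ N ] (R₄ z))) ∎
      where
      σ′ = σ ∷ʳ i
      N′ = 0 ∷ σ′
      βᵢi* : ∀ q → βᵢ i ℚ.* q ≡ q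
      βᵢi* q = ≡.trans (≡.cong (ℚ._* q) (β⊖-refl i)) (ℚ.*-identityˡ q)
      last-factor : ∀ z → βᵢ z ℚ.* βᵢ i ℚ.* c z i ≡ βᵢ z ℚ.* c z i
      last-factor z = ≡.cong (ℚ._* c z i) (≡.trans (ℚ.*-comm (βᵢ z) (βᵢ i)) (βᵢi* (βᵢ z)))
      first-factor : ∀ z → βᵢ i ℚ.* βᵢ z ℚ.* c i z ≡ βᵢ z ℚ.* c i z
      first-factor z = ≡.cong (ℚ._* c i z) (βᵢi* (βᵢ z))
      last-last : βᵢ i ℚ.* βᵢ i ℚ.* c i i ≡ 0ℚ
      last-last = ≡.trans (≡.cong (βᵢ i ℚ.* βᵢ i ℚ.*_) (pair-weight-refl i σ)) (ℚ.*-zeroʳ (βᵢ i ℚ.* βᵢ i))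

  -- On V, this is (1 + s) M D M = M M D + D M M at the two newest entries.
  M*D*M* : (f : Functional (suc (suc k))) → M* (D* (M* (f ⊞ᶠ S* 0 f))) ≗ᵛ D* (M* (M* f)) ⊞ᶠ M* (M* (D* f))
  M*D*M* f = ∷ʳ-elim _ (M*D*M*-∷ʳ f)

-- Commutation of the rotation R with M, D and s

module Rotation (K : ℚ-Algebra) (w : ℕ → ℚ-Algebra.Carrier K) where
  open ℚ-Algebra K
  open Sums K
  open Solver using (solve; _:=_; _:+_; _:-_)
  open import Relation.Binary.Reasoning.Setoid setoid
  open Operators K w

  ≗-sym : {f g : Functional k} → f ≗ᵛ g → g ≗ᵛ f
  ≗-sym f≗g σ v = sym (f≗g σ v)

  ≗-trans : {f g h : Functional k} → f ≗ᵛ g → g ≗ᵛ h → f ≗ᵛ h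
  ≗-trans f≗g g≗h σ v = trans (f≗g σ v) (g≗h σ v)

  M*D*M*-⊞ : (f g : Functional (suc (suc k))) (σ : Vec ℕ (suc k)) → Valid σ →
    M* (D* (M* (f ⊞ᶠ g))) σ ≋ M* (D* (M* f)) σ + M* (D* (M* g)) σ
  M*D*M*-⊞ f g σ v = trans (M*-cong (D*-cong (λ τ _ → M*-⊞ f g τ)) σ v)
    (trans (M*-cong (λ τ _ → D*-⊞ (M* f) (M* g) τ) σ v) (M*-⊞ (D* (M* f)) (D* (M* g)) σ))

  solve-for : ∀ {x y p q} → x + y ≋ p + q → y ≋ (p + q) - x
  solve-for {x} {y} {p} {q} eq = trans (solve 2 (λ x y → y := (x :+ y) :- x) refl x y) (+-congʳ eq)

  M*D*M*S* : (f : Functional (suc (suc k))) → M* (D* (M* (S* 0 f))) ≗ᵛ (D* (M* (M* f)) ⊞ᶠ M* (M* (D* f))) ⊝ M*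
    (D* (M* f))
  M*D*M*S* f σ v = solve-for (trans (sym (M*D*M*-⊞ f (S* 0 f) σ v)) (M*D*M* f σ v))

  S*D*M*D* : (f : Functional (suc k)) → S* k (D* (M* (D* f))) ≗ᵛ (D* (D* (M* f)) ⊞ᶠ M* (D* (D* f))) ⊝ D* (M* (D* f))
  S*D*M*D* f σ v = solve-for (D*M*D* f σ v)

  -- On V, R M = s M R: rotating after marking leaves the rotated entry newest, rotating before
  -- leaves the marked one newest. It follows from s M M = M M and the relation for M D M, solved
  -- for its term with s.
  M*R* : (f : Functional (suc (suc k))) → M* (R* f) ≗ᵛ R* (M* (S* 0 f))
  M*R* f σ v = begin
    M* (R* f) σ                                     ≈⟨ M*-⊝ (D* (M* f)) (M* (D* f)) σ ⟩
    M* (D* (M* f)) σ - M* (M* (D* f)) σ               ≈⟨ solve 3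
      (λ x y z → x :- y := z :- ((z :+ y) :- x)) refl _ _ _ ⟩
    D* (M* (M* f)) σ - ((D* (M* (M* f)) σ + M* (M* (D* f)) σ) - M* (D* (M* f)) σ)
      ≈⟨ +-cong (D*-cong (M*M*S* f) σ v) (-‿cong (M*D*M*S* f σ v)) ⟨
    D* (M* (M* (S* 0 f))) σ - M* (D* (M* (S* 0 f))) σ   ∎

  S*R* : ∀ t (f : Functional (suc k)) → suc t < k → S* t (R* f) ≗ᵛ R* (S* (suc t) f)
  S*R* t f t<k σ v = trans (S*-⊝ t (D* (M* f)) (M* (D* f)) σ) (+-cong
    (trans (S*D* t (M* f) t<k σ v) (D*-cong (S*M* t f) σ v))
    (-‿cong (trans (S*M* t (D* f) σ v) (M*-cong (S*D* (suc t) f (s≤s t<k)) σ v))))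

  -- On V, D R = R D s with s at the two oldest entries: R moves the oldest entry away, so D forgets
  -- the second oldest.
  R*D* : (f : Functional (suc k)) → R* (D* f) ≗ᵛ S* k (D* (R* f))
  R*D* {k} f σ v = sym (begin
    S* k (D* (R* f)) σ
      ≈⟨ S*-cong k (λ τ _ → D*-⊝ (D* (M* f)) (M* (D* f)) τ) σ v ⟩
    S* k (D* (D* (M* f)) ⊝ D* (M* (D* f))) σ
      ≈⟨ S*-⊝ k (D* (D* (M* f))) (D* (M* (D* f))) σ ⟩
    S* k (D* (D* (M* f))) σ - S* k (D* (M* (D* f))) σ
      ≈⟨ +-cong (S*D*D* (M* f) σ v) (-‿cong (S*D*M*D* f σ v)) ⟩
    D* (D* (M* f)) σ - ((D* (D* (M* f)) σ + M* (D* (D* f)) σ) - D* (M* (D* f)) σ)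
      ≈⟨ solve 3 (λ x y z → z :- ((z :+ y) :- x) := x :- y) refl _ _ _ ⟩
    D* (M* (D* f)) σ - M* (D* (D* f)) σ ∎)

  R*R* : (f : Functional (suc k)) → R* (R* f) ≗ᵛ
       (D* (M* (D* (M* f))) ⊝ D* (M* (M* (D* f)))) ⊝ (M* (D* (D* (M* f))) ⊝ M* (D* (M* (D* f))))
  R*R* f σ v = +-cong
    (trans (D*-cong (λ τ _ → M*-⊝ (D* (M* f)) (M* (D* f)) τ) σ v) (D*-⊝ (M* (D* (M* f))) (M* (M* (D* f))) σ))
    (-‿cong (trans (M*-cong (λ τ _ → D*-⊝ (D* (M* f)) (M* (D* f)) τ) σ v) (M*-⊝ (D* (D* (M* f))) (D* (M* (D* f))) σ)))

  S*M*D*M*D* : (f : Functional (suc (suc k))) → S* k (M* (D* (M* (D* f)))) ≗ᵛ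
            (M* (D* (D* (M* f))) ⊞ᶠ M* (M* (D* (D* f)))) ⊝ M* (D* (M* (D* f)))
  S*M*D*M*D* {k} f σ v = trans (S*M* k (D* (M* (D* f))) σ v) (trans (M*-cong (S*D*M*D* f) σ v)
    (trans (M*-⊝ (D* (D* (M* f)) ⊞ᶠ M* (D* (D* f))) (D* (M* (D* f))) σ)
      (+-congʳ (M*-⊞ (D* (D* (M* f))) (M* (D* (D* f))) σ))))

  -- On V, R R s = s R R, with s at the two oldest entries on the left and at the two newest on the
  -- right: two rotations carry one pair to the other. Both sides are expanded into words in M and
  -- D, from which s is then eliminated.
  S*R*R* : (f : Functional (suc (suc k))) → S* k (R* (R* f)) ≗ᵛ R* (R* (S* 0 f))
  S*R*R* {k} f σ v = begin
    S* k (R* (R* f)) σ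
      ≈⟨ trans (S*-cong k (R*R* f) σ v)
           (trans (S*-⊝ k (DMDM ⊝ DMMD) (MDDM ⊝ MDMD) σ)
           (+-cong (S*-⊝ k DMDM DMMD σ) (-‿cong (S*-⊝ k MDDM MDMD σ)))) ⟩
    (S* k DMDM σ - S* k DMMD σ) - (S* k MDDM σ - S* k MDMD σ)
      ≈⟨ +-cong (+-cong (S*D*M*D* (M* f) σ v) (-‿cong SDMMD)) (-‿cong (+-cong SMDDM (-‿cong (S*M*D*M*D* f σ v)))) ⟩
    (((DDMM σ + MDDM σ) - DMDM σ) - ((((MDDM σ + MMDD σ) - MDMD σ) + ((MDDM′ σ + MMDD σ) - MDMD′ σ)) - MMDD σ))
      - (MDDM σ - ((MDDM σ + MMDD σ) - MDMD σ))
      ≈⟨ +-congʳ (+-congˡ (-‿cong (+-congʳ (+-congˡ (+-congˡ (-‿cong eq₄)))))) ⟩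
    (((DDMM σ + MDDM σ) - DMDM σ) -
      ((((MDDM σ + MMDD σ) - MDMD σ) + ((MDDM′ σ + MMDD σ) - ((DMMD σ + MMDD σ) - MDMD σ))) - MMDD σ))
      - (MDDM σ - ((MDDM σ + MMDD σ) - MDMD σ))
      ≈⟨ solve 7 (λ y a₁ a₂ a₃ a₃′ a₄ h →
           (((y :+ a₃) :- a₁) :- ((((a₃ :+ h) :- a₄) :+ ((a₃′ :+ h) :- ((a₂ :+ h) :- a₄))) :- h)) :-
             (a₃ :- ((a₃ :+ h) :- a₄))
           := (((y :+ a₂) :- a₁) :- a₂) :- (a₃′ :- ((a₂ :+ h) :- a₄)))
           refl (DDMM σ) (DMDM σ) (DMMD σ) (MDDM σ) (MDDM′ σ) (MDMD σ) (MMDD σ) ⟩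
    (((DDMM σ + DMMD σ) - DMDM σ) - DMMD σ) - (MDDM′ σ - ((DMMD σ + MMDD σ) - MDMD σ))
      ≈⟨ +-cong (+-cong eq₁ (-‿cong eq₂)) (-‿cong (+-congˡ (-‿cong eq₄))) ⟨
    (D* (M* (D* (M* f′))) σ - D* (M* (M* (D* f′))) σ) - (MDDM′ σ - MDMD′ σ)
      ≈⟨ R*R* f′ σ v ⟨
    R* (R* f′) σ ∎
    where
    f′ = S* 0 f
    DMDM DMMD MDDM MDMD MMDD DDMM MDDM′ MDMD′ : Functional (suc (suc k))
    DMDM  = D* (M* (D* (M* f)))
    DMMD  = D* (M* (M* (D* f)))
    MDDM  = M* (D* (D* (M* f)))
    MDMD  = M* (D* (M* (D* f)))
    MMDD  = M* (M* (D* (D* f)))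
    DDMM  = D* (D* (M* (M* f)))
    MDDM′ = M* (D* (D* (M* f′)))
    MDMD′ = M* (D* (M* (D* f′)))
    S₀D : D* f′ ≗ᵛ S* 0 (D* f)
    S₀D = ≗-sym (S*D* 0 f (s≤s (s≤s z≤n)))
    eq₄′ : MDMD′ ≗ᵛ (DMMD ⊞ᶠ MMDD) ⊝ MDMD
    eq₄′ = ≗-trans (M*-cong (D*-cong (M*-cong S₀D))) (M*D*M*S* (D* f))
    eq₄ : MDMD′ σ ≋ (DMMD σ + MMDD σ) - MDMD σ
    eq₄ = eq₄′ σ v
    eq₁ : D* (M* (D* (M* f′))) σ ≋ (DDMM σ + DMMD σ) - DMDM σ
    eq₁ = trans (D*-cong (M*D*M*S* f) σ v) (trans (D*-⊝ (D* (M* (M* f)) ⊞ᶠ M* (M* (D* f))) (M* (D* (M* f))) σ)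
      (+-congʳ (D*-⊞ (D* (M* (M* f))) (M* (M* (D* f))) σ)))
    eq₂ : D* (M* (M* (D* f′))) σ ≋ DMMD σ
    eq₂ = D*-cong (≗-trans (M*-cong (M*-cong S₀D)) (M*M*S* (D* f))) σ v
    MMDD′ : M* (M* (D* (D* f′))) ≗ᵛ MMDD
    MMDD′ = ≗-trans (M*-cong (M*-cong (≗-trans (D*-cong S₀D) (≗-sym (S*D* 0 (D* f) (s≤s (s≤s z≤n)))))))
      (M*M*S* (D* (D* f)))
    SMDDM : S* k MDDM σ ≋ MDDM σ
    SMDDM = trans (S*M* k (D* (D* (M* f))) σ v) (M*-cong (S*D*D* (M* f)) σ v)
    SMMDD : S* k MMDD σ ≋ MMDD σ
    SMMDD = trans (S*M* k (M* (D* (D* f))) σ v)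
      (M*-cong (≗-trans (S*M* (suc k) (D* (D* f))) (M*-cong (S*D*D* f))) σ v)
    -- None of the relations moves s past `DMMD` directly. The relation for M D M rewrites it in
    -- words that do admit this.
    DMMD-as : DMMD ≗ᵛ (MDMD ⊞ᶠ MDMD′) ⊝ MMDD
    DMMD-as τ vτ = trans (solve 3 (λ a₂ a₄ h → a₂ := (a₄ :+ ((a₂ :+ h) :- a₄)) :- h) refl (DMMD τ) (MDMD τ) (MMDD τ))
      (+-congʳ (+-congˡ (sym (eq₄′ τ vτ))))
    SDMMD : S* k DMMD σ ≋ (((MDDM σ + MMDD σ) - MDMD σ) + ((MDDM′ σ + MMDD σ) - MDMD′ σ)) - MMDD σ
    SDMMD = trans (S*-cong k DMMD-as σ v) (trans (S*-⊝ k (MDMD ⊞ᶠ MDMD′) MMDD σ) (+-cong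
      (trans (S*-⊞ k MDMD MDMD′ σ) (+-cong (S*M*D*M*D* f σ v)
        (trans (S*M*D*M*D* f′ σ v) (+-congʳ (+-congˡ (MMDD′ σ v))))))
      (-‿cong SMMDD)))

-- The vectors Φ(a) and the rule for forgetting their oldest entry

size : Vec ℕ k → ℕ
size []      = 0
size (q ∷ α) = suc q ℕ.+ size α

size-∷ʳ : ∀ (α : Vec ℕ k) q → size (α ∷ʳ q) ≡ suc q ℕ.+ size α
size-∷ʳ []      q = ≡.refl
size-∷ʳ (x ∷ α) q = ≡.cong suc (≡.trans (≡.cong (x ℕ.+_) (size-∷ʳ α q))
  (≡.trans (ℕ.+-suc x (q ℕ.+ size α)) (≡.trans (≡.cong suc (≡.trans (≡.sym (ℕ.+-assoc x q (size α)))
  (≡.trans (≡.cong (ℕ._+ size α) (ℕ.+-comm x q)) (ℕ.+-assoc q x (size α))))) (≡.sym (ℕ.+-suc q (x ℕ.+ size α))))))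

module Bump (K : ℚ-Algebra) where
  open ℚ-Algebra K

  -- Exponents are stored less 1, so the exponents m + 1 and q + 1 add up to one stored as q + m +
  -- 1.
  bump : ℕ → Vec ℕ k → (Vec ℕ k → Carrier) → Carrier
  bump m []      F = 0#
  bump m (q ∷ α) F = F (suc (q ℕ.+ m) ∷ α) + bump m α (F ∘ (q ∷_))

  bump-cong : ∀ m (α : Vec ℕ k) {F G : Vec ℕ k → Carrier} → (∀ γ → F γ ≋ G γ) → bump m α F ≋ bump m α G
  bump-cong m []      F≈G = refl
  bump-cong m (q ∷ α) F≈G = +-cong (F≈G _) (bump-cong m α λ γ → F≈G (q ∷ γ))

  bump-∷ʳ : ∀ m (α : Vec ℕ k) q (F : Vec ℕ (suc k) → Carrier) →
            bump m (α ∷ʳ q) F ≋ bump m α (F ∘ (_∷ʳ q)) + F (α ∷ʳ suc (q ℕ.+ m))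
  bump-∷ʳ m []      q F = +-comm _ _
  bump-∷ʳ m (x ∷ α) q F = trans (+-congˡ (bump-∷ʳ m α q (F ∘ (x ∷_)))) (sym (+-assoc _ _ _))

-- u i j stands for ∑_c x_c^(j+1) e_(i-1)(x without x_c).
record Newton (K : ℚ-Algebra) : Set where
  open ℚ-Algebra K
  field
    ε   : ℕ → Carrier
    u   : ℕ → ℕ → Carrier
    ε-0 : ε 0 ≋ 1#
    u-0 : ∀ i → u (suc i) 0 ≋ ι (fromℕ (suc i)) * ε (suc i)
    u-suc : ∀ i j → u (suc i) (suc j) ≋ ε (suc i) * u 1 j - u (suc (suc i)) j

-- The ratio is specified by a product because a ℚ-algebra has no division in general.
record Ratios {K : ℚ-Algebra} (newton : Newton K) : Set where
  open ℚ-Algebra K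
  open Newton newton
  field
    w   : ℕ → Carrier
    w-ε : ∀ i → w (suc i) * ε i ≋ ε (suc i)

module PowerVectors (K : ℚ-Algebra) (newton : Newton K) (ratios : Ratios newton) where
  open ℚ-Algebra K
  open Newton newton
  open Ratios ratios
  open Sums K
  open Solver using (solve; _:=_; _:+_; _:*_; _:-_; :-_; con)
  open import Relation.Binary.Reasoning.Setoid setoid
  open import Algebra.Properties.Ring ring using (-0#≈0#)
  open Operators K w
  open Rotation K w
  open Bump K

  -- Φ α f is the value of f at the vector Φ(a), where a is α read backwards with all
  -- entries increased by 1; the first argument of Φ′ is fuel.
  Φ′ : ℕ → Vec ℕ k → Functional k → Carrier
  Φ′ n       []          f = f []
  Φ′ zero    (q ∷ α)     f = 0#
  Φ′ (suc n) (zero ∷ α)  f = Φ′ n α (M* f)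
  Φ′ (suc n) (suc q ∷ α) f = Φ′ n (α ∷ʳ q) (R* f)

  Φ : Vec ℕ k → Functional k → Carrier
  Φ α = Φ′ (size α) α

  Φ-suc : ∀ q (α : Vec ℕ k) f → Φ (suc q ∷ α) f ≡ Φ (α ∷ʳ q) (R* f)
  Φ-suc q α f = ≡.cong (λ n → Φ′ n (α ∷ʳ q) (R* f)) (≡.sym (size-∷ʳ α q))

  Φ′-cong : ∀ n (α : Vec ℕ k) {f g} → f ≗ᵛ g → Φ′ n α f ≋ Φ′ n α g
  Φ′-cong n       []          f≗g = f≗g [] ([] ∷ [])
  Φ′-cong zero    (q ∷ α)     f≗g = refl
  Φ′-cong (suc n) (zero ∷ α)  f≗g = Φ′-cong n α (M*-cong f≗g)
  Φ′-cong (suc n) (suc q ∷ α) f≗g = Φ′-cong n (α ∷ʳ q) (R*-cong f≗g)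

  Φ-cong : ∀ (α : Vec ℕ k) {f g} → f ≗ᵛ g → Φ α f ≋ Φ α g
  Φ-cong α = Φ′-cong (size α) α

  R*-⊝ : (f g : Functional (suc k)) → R* (f ⊝ g) ≗ᵛ R* f ⊝ R* g
  R*-⊝ f g σ v = trans (+-cong
    (trans (D*-cong (λ τ _ → M*-⊝ f g τ) σ v) (D*-⊝ (M* f) (M* g) σ))
    (-‿cong (trans (M*-cong (λ τ _ → D*-⊝ f g τ) σ v) (M*-⊝ (D* f) (D* g) σ))))
    (solve 4 (λ x y z t → (x :- y) :- (z :- t) := (x :- z) :- (y :- t)) refl _ _ _ _)

  Φ′-⊝ : ∀ n (α : Vec ℕ k) f g → Φ′ n α (f ⊝ g) ≋ Φ′ n α f - Φ′ n α g
  Φ′-⊝ n       []          f g = refl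
  Φ′-⊝ zero    (q ∷ α)     f g = sym (-‿inverseʳ 0#)
  Φ′-⊝ (suc n) (zero ∷ α)  f g = trans (Φ′-cong n α (λ τ _ → M*-⊝ f g τ)) (Φ′-⊝ n α (M* f) (M* g))
  Φ′-⊝ (suc n) (suc q ∷ α) f g = trans (Φ′-cong n (α ∷ʳ q) (R*-⊝ f g)) (Φ′-⊝ n (α ∷ʳ q) (R* f) (R* g))

  -- Exchanging the entries turns c = 1/d into -c: the cross terms c (1 - c) cancel and c² + (1 -
  -- c)(1 + c) = 1.
  S*₀-involutive : (f : Functional (suc (suc k))) → S* 0 (S* 0 f) ≗ᵛ f
  S*₀-involutive f (y ∷ x ∷ σ) _ = begin
    κ⊖ y x • S* 0 f (y ∷ x ∷ σ) + (1ℚ ℚ.- κ⊖ y x) • S* 0 f (x ∷ y ∷ σ)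
      ≈⟨ +-congˡ (*-congˡ (+-cong (•-congʳ (κ⊖-swap x y)) (•-congʳ (≡.cong (λ q → 1ℚ ℚ.- q) (κ⊖-swap x y))))) ⟩
    κ⊖ y x • (κ⊖ y x • f (y ∷ x ∷ σ) + (1ℚ ℚ.- κ⊖ y x) • f (x ∷ y ∷ σ))
      + (1ℚ ℚ.- κ⊖ y x) • ((ℚ.- κ⊖ y x) • f (x ∷ y ∷ σ) + (1ℚ ℚ.- (ℚ.- κ⊖ y x)) • f (y ∷ x ∷ σ))
      ≈⟨ +-cong (*-congˡ (+-congˡ (*-congʳ ι-1-)))
           (*-cong ι-1- (+-cong (*-congʳ (ι-neg _)) (*-congʳ (trans ι-1- (+-congˡ (-‿cong (ι-neg _))))))) ⟩
    c * (c * f₁ + (ι 1ℚ - c) * f₂) + (ι 1ℚ - c) * ((- c) * f₂ + (ι 1ℚ - - c) * f₁)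
      ≈⟨ solve 3 (λ c f₁ f₂ → c :* (c :* f₁ :+ (con 1ℚ :- c) :* f₂) :+ (con 1ℚ :- c) :*
           ((:- c) :* f₂ :+ (con 1ℚ :- :- c) :* f₁) := f₁) refl c f₁ f₂ ⟩
    f (y ∷ x ∷ σ) ∎
    where
    c  = ι (κ⊖ y x)
    f₁ = f (y ∷ x ∷ σ)
    f₂ = f (x ∷ y ∷ σ)
    ι-1- : ∀ {p} → ι (1ℚ ℚ.- p) ≋ ι 1ℚ - ι p
    ι-1- {p} = trans (ι-+ 1ℚ (ℚ.- p)) (+-congˡ (ι-neg p))

  suc-size : ∀ q (α : Vec ℕ k) {n} → size (suc q ∷ α) ≤ suc n → size (α ∷ʳ q) ≤ n
  suc-size q α (s≤s p) = ℕ.≤-trans (ℕ.≤-reflexive (size-∷ʳ α q)) p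

  zero-size : ∀ (α : Vec ℕ k) {n} → size (zero ∷ α) ≤ suc n → size α ≤ n
  zero-size α (s≤s p) = p

  -- Induction on the total exponent. At the two newest entries the cases are s M M = M M, R M = s M
  -- R in both directions, and R R s = s R R, which turns the question into one about the two oldest
  -- entries of a smaller vector. Swaps further back commute with M and R.
  Φ-swap : ∀ n (α : Vec ℕ k) t f → size α ≤ n → suc t < k → Φ (swap t α) f ≋ Φ α (S* t f)
  Φ-swap n       []                        t       f _ ()
  Φ-swap zero    (_ ∷ _)                   t       f ()
  Φ-swap (suc n) (_ ∷ [])                  t       f _ (s≤s ())
  Φ-swap (suc n) (zero ∷ zero ∷ α)         zero    f _ _ = Φ-cong α (≗-sym (M*M*S* f))
  Φ-swap (suc n) (zero ∷ suc q ∷ α)        zero    f _ _ = begin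
    Φ (suc q ∷ zero ∷ α) f        ≡⟨ Φ-suc q (zero ∷ α) f ⟩
    Φ (α ∷ʳ q) (M* (R* f))         ≈⟨ Φ-cong (α ∷ʳ q) (M*R* f) ⟩
    Φ (α ∷ʳ q) (R* (M* (S* 0 f)))   ≡⟨ Φ-suc q α (M* (S* 0 f)) ⟨
    Φ (suc q ∷ α) (M* (S* 0 f))    ∎
  Φ-swap (suc n) (suc q ∷ zero ∷ α)        zero    f _ _ = begin
    Φ (suc q ∷ α) (M* f)                ≡⟨ Φ-suc q α (M* f) ⟩
    Φ (α ∷ʳ q) (R* (M* f))              ≈⟨ Φ-cong (α ∷ʳ q) (R*-cong (M*-cong (S*₀-involutive f))) ⟨
    Φ (α ∷ʳ q) (R* (M* (S* 0 (S* 0 f)))) ≈⟨ Φ-cong (α ∷ʳ q) (M*R* (S* 0 f)) ⟨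
    Φ (α ∷ʳ q) (M* (R* (S* 0 f)))        ≡⟨ Φ-suc q (zero ∷ α) (S* 0 f) ⟨
    Φ (suc q ∷ zero ∷ α) (S* 0 f)       ∎
  Φ-swap {suc (suc k)} (suc n) (suc q ∷ suc r ∷ α) zero f p _ = begin
    Φ (suc r ∷ suc q ∷ α) f                     ≡⟨ Φ-suc r (suc q ∷ α) f ⟩
    Φ (suc q ∷ (α ∷ʳ r)) (R* f)                 ≡⟨ Φ-suc q (α ∷ʳ r) (R* f) ⟩
    Φ (α ∷ʳ r ∷ʳ q) (R* (R* f))                 ≡⟨ ≡.cong (λ γ → Φ γ (R* (R* f))) (swap-last α q r) ⟨
    Φ (swap k (α ∷ʳ q ∷ʳ r)) (R* (R* f))        ≈⟨ Φ-swap n (α ∷ʳ q ∷ʳ r) k (R* (R* f)) size≤n ℕ.≤-refl ⟩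
    Φ (α ∷ʳ q ∷ʳ r) (S* k (R* (R* f)))           ≈⟨ Φ-cong (α ∷ʳ q ∷ʳ r) (S*R*R* f) ⟩
    Φ (α ∷ʳ q ∷ʳ r) (R* (R* (S* 0 f)))           ≡⟨ Φ-suc r (α ∷ʳ q) (R* (S* 0 f)) ⟨
    Φ (suc r ∷ (α ∷ʳ q)) (R* (S* 0 f))           ≡⟨ Φ-suc q (suc r ∷ α) (S* 0 f) ⟨
    Φ (suc q ∷ suc r ∷ α) (S* 0 f)               ∎
    where
    size≤n : size (α ∷ʳ q ∷ʳ r) ≤ n
    size≤n = ℕ.≤-trans (suc-size r (α ∷ʳ q) (ℕ.n≤1+n _)) (suc-size q (suc r ∷ α) p)
  Φ-swap (suc n) (zero ∷ x ∷ α)            (suc t) f p (s≤s t<k) =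
    trans (Φ-swap n (x ∷ α) t (M* f) (zero-size (x ∷ α) p) t<k) (Φ-cong (x ∷ α) (S*M* t f))
  Φ-swap (suc n) (suc q ∷ x ∷ α)           (suc t) f p (s≤s t<k) = begin
    Φ (suc q ∷ swap t (x ∷ α)) f           ≡⟨ Φ-suc q (swap t (x ∷ α)) f ⟩
    Φ (swap t (x ∷ α) ∷ʳ q) (R* f)         ≡⟨ ≡.cong (λ γ → Φ γ (R* f)) (swap-∷ʳ t (x ∷ α) q t<k) ⟨
    Φ (swap t (x ∷ α ∷ʳ′ q)) (R* f)        ≈⟨ Φ-swap n (x ∷ α ∷ʳ′ q) t (R* f) (suc-size q (x ∷ α) p)
      (ℕ.m<n⇒m<1+n t<k) ⟩
    Φ (x ∷ α ∷ʳ′ q) (S* t (R* f))           ≈⟨ Φ-cong (x ∷ α ∷ʳ′ q) (S*R* t f t<k) ⟩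
    Φ (x ∷ α ∷ʳ′ q) (R* (S* (suc t) f))     ≡⟨ Φ-suc q (x ∷ α) (S* (suc t) f) ⟨
    Φ (suc q ∷ x ∷ α) (S* (suc t) f)        ∎
    where
    infixr 5 _∷ʳ′_
    _∷ʳ′_ : ∀ {k} → Vec ℕ k → ℕ → Vec ℕ (suc k)
    _∷ʳ′_ = _∷ʳ_

  iterate-R* : ℕ → Functional (suc k) → Functional (suc k)
  iterate-R* zero    g = g
  iterate-R* (suc j) g = iterate-R* j (R* g)

  iterate-R*-suc : ∀ j (g : Functional (suc k)) → iterate-R* (suc j) g ≡ R* (iterate-R* j g)
  iterate-R*-suc zero    g = ≡.refl
  iterate-R*-suc (suc j) g = iterate-R*-suc j (R* g)

  Φ-single : ∀ m g → Φ (m ∷ []) g ≋ iterate-R* m g (1 ∷ [])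
  Φ-single zero    g = trans (+-identityʳ _) (•-one _)
  Φ-single (suc m) g = trans (reflexive (Φ-suc m [] g)) (Φ-single m (R* g))

  -- The factor (i + 1) eᵢ clears the denominators of the weights and of the ratio. So normalised,
  -- the values at i + 1 obey the recursion `u-suc`.
  R*-single : ∀ i (g : Functional 1) →
    (ι (fromℕ (suc i)) * ε i) * R* g (suc i ∷ []) ≋
    ε (suc i) * g (1 ∷ []) - (ι (fromℕ (suc (suc i))) * ε (suc i)) * g (suc (suc i) ∷ [])
  R*-single i g = begin
    (ν * ε i) * (w (suc i) * (1ℚ • g₁ + 0#) - (p • (w (suc i) * g₁) + (q • (w (suc i) * g₂) + 0#)))
      ≈⟨ *-congˡ (+-cong (*-congˡ (trans (+-identityʳ _) (•-one _))) (-‿cong (+-congˡ (+-identityʳ _)))) ⟩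
    (ν * ε i) * (w (suc i) * g₁ - (p • (w (suc i) * g₁) + q • (w (suc i) * g₂)))
      ≈⟨ solve 7 (λ ν ε w g₁ g₂ p q → (ν :* ε) :* (w :* g₁ :- (p :* (w :* g₁) :+ q :* (w :* g₂)))
           := (w :* ε) :* ((ν :- ν :* p) :* g₁) :- (ν :* q) :* (w :* ε) :* g₂) refl ν (ε i) (w (suc i)) g₁ g₂
             (ι p) (ι q) ⟩
    (w (suc i) * ε i) * ((ν - ν * ι p) * g₁) - (ν * ι q) * (w (suc i) * ε i) * g₂
      ≈⟨ +-cong (*-cong (w-ε i) (trans (*-congʳ p-eq) (•-one _))) (-‿cong (*-congʳ (*-cong q-eq (w-ε i)))) ⟩
    ε (suc i) * g₁ - (ι (fromℕ (suc (suc i))) * ε (suc i)) * g₂ ∎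
    where
    ν = ι (fromℕ (suc i))
    g₁ = g (1 ∷ [])
    g₂ = g (suc (suc i) ∷ [])
    p = weight 0 (suc i ∷ [])
    q = weight (suc i) (suc i ∷ [])
    p-eq : ν - ν * ι p ≋ ι 1ℚ
    p-eq = trans (solve 2 (λ ν p → ν :- ν :* p := ν :* (con 1ℚ :- p)) refl ν (ι p))
      (trans (*-congˡ (trans (+-congˡ (sym (ι-neg p))) (sym (ι-+ 1ℚ (ℚ.- p))))) (trans (sym (ι-* _ _))
      (ι-cong (fromℕ-weight-0 i))))
    q-eq : ν * ι q ≋ ι (fromℕ (suc (suc i)))
    q-eq = trans (sym (ι-* _ _)) (ι-cong (fromℕ-weight-suc i))

  -- All i are needed at once, since one R leads from the entry i + 1 to the entries 1 and i + 2.
  iterate-R*-D* : ∀ j i (f : Functional 0) →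
    (ι (fromℕ (suc i)) * ε i) * iterate-R* j (D* f) (suc i ∷ []) ≋ u (suc i) j * f []
  iterate-R*-D* zero    i f = begin
    (ι (fromℕ (suc i)) * ε i) * (w (suc i) * f []) ≈⟨ solve 4
      (λ n ε w f → (n :* ε) :* (w :* f) := (n :* (w :* ε)) :* f) refl _ _ _ _ ⟩
    (ι (fromℕ (suc i)) * (w (suc i) * ε i)) * f [] ≈⟨ *-congʳ (trans (*-congˡ (w-ε i)) (sym (u-0 i))) ⟩
    u (suc i) 0 * f []                             ∎
  iterate-R*-D* (suc j) i f = begin
    (ι (fromℕ (suc i)) * ε i) * iterate-R* (suc j) (D* f) (suc i ∷ [])
      ≡⟨ ≡.cong (λ h → (ι (fromℕ (suc i)) * ε i) * h (suc i ∷ [])) (iterate-R*-suc j (D* f)) ⟩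
    (ι (fromℕ (suc i)) * ε i) * R* (iterate-R* j (D* f)) (suc i ∷ [])
      ≈⟨ R*-single i (iterate-R* j (D* f)) ⟩
    ε (suc i) * iterate-R* j (D* f) (1 ∷ []) - (ι (fromℕ (suc (suc i))) * ε (suc i)) * iterate-R* j (D* f)
      (suc (suc i) ∷ [])
      ≈⟨ +-cong (*-congˡ (iterate-R*-D*₁ j f)) (-‿cong (iterate-R*-D* j (suc i) f)) ⟩
    ε (suc i) * (u 1 j * f []) - u (suc (suc i)) j * f []
      ≈⟨ solve 4 (λ ε u u′ f → ε :* (u :* f) :- u′ :* f := (ε :* u :- u′) :* f) refl _ _ _ _ ⟩
    (ε (suc i) * u 1 j - u (suc (suc i)) j) * f []
      ≈⟨ *-congʳ (u-suc i j) ⟨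
    u (suc i) (suc j) * f [] ∎
    where
    iterate-R*-D*₁ : ∀ j f → iterate-R* j (D* f) (1 ∷ []) ≋ u 1 j * f []
    iterate-R*-D*₁ j f = trans (trans (sym (*-identityˡ _))
      (*-congʳ (sym (trans (*-cong ι-1 ε-0) (*-identityˡ 1#))))) (iterate-R*-D* j 0 f)

  Φ-D*-single : ∀ m f → Φ (m ∷ []) (D* f) ≋ u 1 m * f []
  Φ-D*-single m f = begin
    Φ (m ∷ []) (D* f)                    ≈⟨ Φ-single m (D* f) ⟩
    iterate-R* m (D* f) (1 ∷ [])          ≈⟨ trans (sym (*-identityˡ _))
      (*-congʳ (sym (trans (*-cong ι-1 ε-0) (*-identityˡ 1#)))) ⟩
    (ι 1ℚ * ε 0) * iterate-R* m (D* f) (1 ∷ []) ≈⟨ iterate-R*-D* m 0 f ⟩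
    u 1 m * f []                        ∎

  -- Induction on the total exponent, peeling off the newest entry. If its exponent is 1, then D M =
  -- M D - R, and the term with R is the bump at that entry. Otherwise D R = R D s, and `Φ-swap`
  -- absorbs s.
  Φ-D* : ∀ n (α : Vec ℕ k) m f → size (α ∷ʳ m) ≤ n →
        Φ (α ∷ʳ m) (D* f) ≋ u 1 m * Φ α f - bump m α (λ γ → Φ γ f)
  Φ-D* n       []          m f _ = trans (Φ-D*-single m f) (trans (sym (+-identityʳ _)) (+-congˡ (sym -0#≈0#)))
  Φ-D* zero    (q ∷ α)     m f ()
  Φ-D* (suc n) (zero ∷ α)  m f p = begin
    Φ (α ∷ʳ m) (M* (D* f))
      ≈⟨ Φ-cong (α ∷ʳ m) (λ σ _ → solve 2 (λ x y → x := y :- (y :- x)) refl _ _) ⟩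
    Φ (α ∷ʳ m) (D* (M* f) ⊝ R* f)
      ≈⟨ Φ′-⊝ (size (α ∷ʳ m)) (α ∷ʳ m) (D* (M* f)) (R* f) ⟩
    Φ (α ∷ʳ m) (D* (M* f)) - Φ (α ∷ʳ m) (R* f)
      ≈⟨ +-cong (Φ-D* n α m (M* f) (zero-size (α ∷ʳ m) p)) (-‿cong (reflexive (≡.sym (Φ-suc m α f)))) ⟩
    (u 1 m * Φ α (M* f) - bump m α (λ γ → Φ γ (M* f))) - Φ (suc m ∷ α) f
      ≈⟨ solve 3 (λ x y z → (x :- y) :- z := x :- (z :+ y)) refl _ _ _ ⟩
    u 1 m * Φ α (M* f) - (Φ (suc m ∷ α) f + bump m α (λ γ → Φ γ (M* f))) ∎
  Φ-D* {suc k} (suc n) (suc q ∷ α) m f p = begin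
    Φ (suc q ∷ (α ∷ʳ m)) (D* f)          ≡⟨ Φ-suc q (α ∷ʳ m) (D* f) ⟩
    Φ (α ∷ʳ m ∷ʳ q) (R* (D* f))          ≈⟨ Φ-cong (α ∷ʳ m ∷ʳ q) (R*D* f) ⟩
    Φ (α ∷ʳ m ∷ʳ q) (S* k (D* (R* f)))    ≈⟨ Φ-swap n (α ∷ʳ m ∷ʳ q) k (D* (R* f)) size≤ ℕ.≤-refl ⟨
    Φ (swap k (α ∷ʳ m ∷ʳ q)) (D* (R* f)) ≡⟨ ≡.cong (λ γ → Φ γ (D* (R* f))) (swap-last α m q) ⟩
    Φ (α ∷ʳ q ∷ʳ m) (D* (R* f))          ≈⟨ Φ-D* n (α ∷ʳ q) m (R* f) size≤′ ⟩
    u 1 m * Φ (α ∷ʳ q) (R* f) - bump m (α ∷ʳ q) (λ γ → Φ γ (R* f))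
      ≈⟨ +-cong (*-congˡ (reflexive (≡.sym (Φ-suc q α f))))
           (-‿cong (trans (bump-∷ʳ m α q (λ γ → Φ γ (R* f))) (trans (+-comm _ _)
           (+-cong (reflexive (≡.sym (Φ-suc (suc (q ℕ.+ m)) α f)))
             (bump-cong m α λ γ → reflexive (≡.sym (Φ-suc q γ f))))))) ⟩
    u 1 m * Φ (suc q ∷ α) f - bump m (suc q ∷ α) (λ γ → Φ γ f) ∎
    where
    size≤ : size (α ∷ʳ m ∷ʳ q) ≤ n
    size≤ = suc-size q (α ∷ʳ m) p
    size≤′ : size (α ∷ʳ q ∷ʳ m) ≤ n
    size≤′ = ℕ.≤-trans (ℕ.≤-reflexive (≡.trans (size-∷ʳ (α ∷ʳ q) m) (≡.trans (≡.cong (suc m ℕ.+_) (size-∷ʳ α q))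
      (≡.trans (swap-+ m q (size α)) (≡.sym
        (≡.trans (size-∷ʳ (α ∷ʳ m) q) (≡.cong (suc q ℕ.+_) (size-∷ʳ α m)))))))) size≤
      where
      swap-+ : ∀ m q s → suc m ℕ.+ (suc q ℕ.+ s) ≡ suc q ℕ.+ (suc m ℕ.+ s)
      swap-+ m q s = ≡.trans (≡.sym (ℕ.+-assoc (suc m) (suc q) s))
        (≡.trans (≡.cong (ℕ._+ s) (ℕ.+-comm (suc m) (suc q))) (ℕ.+-assoc (suc q) (suc m) s))

-- Sums over distinct colours

module ColourSums (K : ℚ-Algebra) {l : ℕ} (x : Fin l → ℚ-Algebra.Carrier K) where
  open ℚ-Algebra K
  open Sums K
  open Bump K
  open Solver using (solve; _:=_; _:+_; _:*_; _:-_; :-_)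
  open import Relation.Binary.Reasoning.Setoid setoid
  open import Algebra.Properties.Ring ring using (-0#≈0#)

  Colour : Set
  Colour = Fin l

  power : Colour → ℕ → Carrier
  power y zero    = x y
  power y (suc q) = x y * power y q

  power-+ : ∀ y m q → power y m * power y q ≋ power y (suc (q ℕ.+ m))
  power-+ y m zero    = *-comm _ _
  power-+ y m (suc q) = trans (x∙yz≈y∙xz _ _ _) (*-congˡ (power-+ y m q))

  distinct : Colour → Colour → Carrier
  distinct y z = if does (y Fin.≟ z) then 0# else 1#

  new : Colour → Vec Colour k → Carrier
  new y []      = 1#
  new y (z ∷ c) = distinct y z * new y c

  new-∷ʳ : ∀ y (c : Vec Colour k) z → new y (c ∷ʳ z) ≋ distinct y z * new y c
  new-∷ʳ y []      z = refl
  new-∷ʳ y (t ∷ c) z = trans (*-congˡ (new-∷ʳ y c z)) (x∙yz≈y∙xz _ _ _)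

  distinct-comm : ∀ y z → distinct y z ≋ distinct z y
  distinct-comm y z with y Fin.≟ z | z Fin.≟ y
  ... | yes _      | yes _  = refl
  ... | yes ≡.refl | no ¬p  = contradiction ≡.refl ¬p
  ... | no ¬p      | yes ≡.refl = contradiction ≡.refl ¬p
  ... | no _       | no _   = refl

  distinct-idem : ∀ y z → distinct y z * distinct y z ≋ distinct y z
  distinct-idem y z with y Fin.≟ z
  ... | yes _ = zeroˡ _
  ... | no _  = *-identityˡ _

  ∑-tabulate : ∀ {n} (h : Fin n → Colour) (g : Colour → Carrier) z → (∀ i → h i ≢ z) →
               ∑[ y ∈ tabulate h ] (distinct y z * g y) ≋ ∑ (tabulate h) g
  ∑-tabulate {zero}  h g z h≢z = refl
  ∑-tabulate {suc n} h g z h≢z with h zero Fin.≟ z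
  ... | yes eq = contradiction eq (h≢z zero)
  ... | no _   = +-cong (*-identityˡ _) (∑-tabulate (h ∘ suc) g z (h≢z ∘ suc))

  ∑-distinct′ : ∀ {n} (h : Fin n → Colour) (g : Colour → Carrier) i → (∀ {i j} → h i ≡ h j → i ≡ j) →
               ∑[ y ∈ tabulate h ] (distinct y (h i) * g y) ≋ ∑ (tabulate h) g - g (h i)
  ∑-distinct′ h g zero inj with h zero Fin.≟ h zero
  ... | no ¬p = contradiction ≡.refl ¬p
  ... | yes _ = trans (+-cong (zeroˡ _) (∑-tabulate (h ∘ suc) g (h zero) λ i eq → Fin.0≢1+n (≡.sym (inj eq))))
    (trans (+-identityˡ _) (solve 2 (λ p q → q := (p :+ q) :- p) refl _ _))
  ∑-distinct′ h g (suc i) inj with h zero Fin.≟ h (suc i)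
  ... | yes eq = contradiction (inj eq) Fin.0≢1+n
  ... | no _ = trans (+-cong (*-identityˡ _) (∑-distinct′ (h ∘ suc) g i (Fin.suc-injective ∘ inj)))
    (solve 3 (λ p q r → p :+ (q :- r) := (p :+ q) :- r) refl _ _ _)

  ∑-distinct : (g : Colour → Carrier) → ∀ z → ∑[ y ∈ allFin l ] (distinct y z * g y) ≋ ∑ (allFin l) g - g z
  ∑-distinct g z = ∑-distinct′ (λ i → i) g z (λ eq → eq)

  Functionalᶜ : ℕ → Set
  Functionalᶜ k = Vec Colour k → Carrier

  grow : ℕ → Functionalᶜ (suc k) → Functionalᶜ k
  grow q f c = ∑[ y ∈ allFin l ] ((new y c * power y q) * f (y ∷ c))

  forgetᶜ : Functionalᶜ k → Functionalᶜ (suc k)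
  forgetᶜ f c = f (init c)

  grow-cong : ∀ q {f g : Functionalᶜ (suc k)} → (∀ c → f c ≋ g c) → ∀ c → grow q f c ≋ grow q g c
  grow-cong q f≈g c = ∑-cong (allFin l) λ y → *-congˡ (f≈g (y ∷ c))

  -- The head of α belongs to the newest vertex, whose colour is summed innermost, once the older
  -- colours are fixed.
  S : Vec ℕ k → Functionalᶜ k → Carrier
  S []      f = f []
  S (q ∷ α) f = S α (grow q f)

  S-cong : ∀ (α : Vec ℕ k) {f g : Functionalᶜ k} → (∀ c → f c ≋ g c) → S α f ≋ S α g
  S-cong []      f≈g = f≈g []
  S-cong (q ∷ α) f≈g = S-cong α (grow-cong q f≈g)

  S-⊝ : ∀ (α : Vec ℕ k) (f g : Functionalᶜ k) → S α (λ c → f c - g c) ≋ S α f - S α g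
  S-⊝ []      f g = refl
  S-⊝ (q ∷ α) f g = trans (S-cong α λ c →
      trans (∑-cong (allFin l) λ y → solve 3 (λ p r s → p :* (r :- s) := p :* r :+ :- (p :* s)) refl _ _ _)
        (trans (∑-+ (allFin l) _ _) (+-congˡ (∑-neg (allFin l) _))))
    (S-⊝ α (grow q f) (grow q g))

  -- Sums over distinct colours do not depend on the order of choice: here the
  -- oldest colour is chosen last instead of first.
  S-rotate : ∀ (α : Vec ℕ k) m (h : Colour → Functionalᶜ k) →
    S (α ∷ʳ m) (λ c → new (last c) (init c) * h (last c) (init c)) ≋
    S α (λ c → ∑[ z ∈ allFin l ] ((new z c * power z m) * h z c))
  S-rotate []      m h = ∑-cong (allFin l) λ y → *-congˡ (*-identityˡ _)
  S-rotate {suc k} (q ∷ α) m h = begin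
    S (α ∷ʳ m) (grow q (λ c → new (last c) (init c) * h (last c) (init c)))
      ≈⟨ S-cong (α ∷ʳ m) (∷ʳ-elim _ λ c z → step c z) ⟩
    S (α ∷ʳ m) (λ c → new (last c) (init c) * h′ (last c) (init c))
      ≈⟨ S-rotate α m h′ ⟩
    S α (λ c → ∑[ z ∈ allFin l ] ((new z c * power z m) * h′ z c))
      ≈⟨ S-cong α (λ c → trans (trans (∑-cong (allFin l) λ z → sym (∑-*ˡ (allFin l) _ _))
           (∑-swap (allFin l) (allFin l) _))
           (∑-cong (allFin l) λ y → trans (∑-cong (allFin l) λ z →
             solve 6 (λ a p n r d f → (n :* r) :* (((d :* a) :* p) :* f) := (a :* p) :* (((d :* n) :* r) :* f)) refl
               (new y c) (power y q) (new z c) (power z m) (distinct z y) (h z (y ∷ c)))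
             (∑-*ˡ (allFin l) _ _))) ⟩
    S α (grow q (λ c → ∑[ z ∈ allFin l ] ((new z c * power z m) * h z c))) ∎
    where
    h′ : Colour → Functionalᶜ k
    h′ z c = ∑[ y ∈ allFin l ] (((distinct z y * new y c) * power y q) * h z (y ∷ c))
    G : Functionalᶜ (suc (suc k))
    G c = new (last c) (init c) * h (last c) (init c)
    G-∷ʳ : ∀ y (c : Vec Colour k) z → G (y ∷ (c ∷ʳ z)) ≋ (distinct z y * new z c) * h z (y ∷ c)
    G-∷ʳ y c z = reflexive (≡.cong₂ (λ t d → new t d * h t d) (last-∷ʳ z (y ∷ c)) (init-∷ʳ z (y ∷ c)))
    step : ∀ (c : Vec Colour k) z → grow q G (c ∷ʳ z) ≋
      new (last (c ∷ʳ z)) (init (c ∷ʳ z)) * h′ (last (c ∷ʳ z)) (init (c ∷ʳ z))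
    step c z = begin
      grow q G (c ∷ʳ z)
        ≈⟨ ∑-cong (allFin l) (λ y → begin
             (new y (c ∷ʳ z) * power y q) * G (y ∷ (c ∷ʳ z))
               ≈⟨ *-cong (*-congʳ (trans (new-∷ʳ y c z) (*-congʳ (distinct-comm y z)))) (G-∷ʳ y c z) ⟩
             ((distinct z y * new y c) * power y q) * ((distinct z y * new z c) * h z (y ∷ c))
               ≈⟨ solve 5 (λ d n p n′ f → ((d :* n) :* p) :* ((d :* n′) :* f) := n′ :*
                    ((((d :* d) :* n) :* p) :* f)) refl _ _ _ _ _ ⟩
             new z c * (((distinct z y * distinct z y * new y c) * power y q) * h z (y ∷ c))
               ≈⟨ *-congˡ (*-congʳ (*-congʳ (*-congʳ (distinct-idem z y)))) ⟩
             new z c * (((distinct z y * new y c) * power y q) * h z (y ∷ c)) ∎) ⟩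
      ∑[ y ∈ allFin l ] (new z c * (((distinct z y * new y c) * power y q) * h z (y ∷ c)))
        ≈⟨ ∑-*ˡ (allFin l) _ _ ⟩
      new z c * h′ z c
        ≡⟨ ≡.cong₂ (λ t d → new t d * h′ t d) (last-∷ʳ z c) (init-∷ʳ z c) ⟨
      new (last (c ∷ʳ z)) (init (c ∷ʳ z)) * h′ (last (c ∷ʳ z)) (init (c ∷ʳ z)) ∎

  power-sum : ℕ → Carrier
  power-sum m = ∑[ y ∈ allFin l ] (power y m)

  -- Inclusion-exclusion on the newest colour y: it ranges over all colours outside the kept ones,
  -- less the case that y is the forgotten colour, where the two exponents add up. `S-rotate` brings
  -- this case into the form of a bump.
  S-forget : ∀ (α : Vec ℕ k) m (f : Functionalᶜ k) →
             S (α ∷ʳ m) (forgetᶜ f) ≋ power-sum m * S α f - bump m α (λ γ → S γ f)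
  S-forget []      m f = begin
    ∑[ y ∈ allFin l ] ((1# * power y m) * f []) ≈⟨ ∑-cong (allFin l)
      (λ y → trans (*-congʳ (*-identityˡ _)) (*-comm _ _)) ⟩
    ∑[ y ∈ allFin l ] (f [] * power y m)        ≈⟨ trans (∑-*ˡ (allFin l) _ _) (*-comm _ _) ⟩
    power-sum m * f []                          ≈⟨ trans (sym (+-identityʳ _)) (+-congˡ (sym -0#≈0#)) ⟩
    power-sum m * f [] - 0#                     ∎
  S-forget {suc k} (q ∷ α) m f = begin
    S (α ∷ʳ m) (grow q (forgetᶜ f))
      ≈⟨ S-cong (α ∷ʳ m) (∷ʳ-elim _ step) ⟩
    S (α ∷ʳ m) (λ c → forgetᶜ (grow q f) c - H c)
      ≈⟨ S-⊝ (α ∷ʳ m) (forgetᶜ (grow q f)) H ⟩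
    S (α ∷ʳ m) (forgetᶜ (grow q f)) - S (α ∷ʳ m) H
      ≈⟨ +-cong (S-forget α m (grow q f)) (-‿cong (trans (S-rotate α m h) (S-cong α λ c → ∑-cong (allFin l) λ z →
           trans (solve 4 (λ n p p′ f → (n :* p) :* (p′ :* f) := (n :* (p :* p′)) :* f) refl _ _ _ _)
             (*-congʳ (*-congˡ (power-+ z m q)))))) ⟩
    (power-sum m * S α (grow q f) - bump m α (λ γ → S γ (grow q f))) - S α (grow (suc (q ℕ.+ m)) f)
      ≈⟨ solve 3 (λ x y z → (x :- y) :- z := x :- (z :+ y)) refl _ _ _ ⟩
    power-sum m * S α (grow q f) - (S α (grow (suc (q ℕ.+ m)) f) + bump m α (λ γ → S γ (grow q f))) ∎
    where
    h : Colour → Functionalᶜ k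
    h z c = power z q * f (z ∷ c)
    H : Functionalᶜ (suc k)
    H c = new (last c) (init c) * h (last c) (init c)
    step : ∀ c z → grow q (forgetᶜ f) (c ∷ʳ z) ≋ forgetᶜ (grow q f) (c ∷ʳ z) - H (c ∷ʳ z)
    step c z = begin
      ∑[ y ∈ allFin l ] ((new y (c ∷ʳ z) * power y q) * f (init (y ∷ (c ∷ʳ z))))
        ≈⟨ ∑-cong (allFin l) (λ y → trans (*-cong (*-congʳ (new-∷ʳ y c z)) (reflexive (≡.cong f (init-∷ʳ z (y ∷ c)))))
             (solve 4 (λ d n p f → ((d :* n) :* p) :* f := d :* ((n :* p) :* f)) refl _ _ _ _)) ⟩
      ∑[ y ∈ allFin l ] (distinct y z * ((new y c * power y q) * f (y ∷ c)))
        ≈⟨ ∑-distinct _ z ⟩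
      grow q f c - (new z c * power z q) * f (z ∷ c)
        ≈⟨ +-congˡ (-‿cong (*-assoc _ _ _)) ⟩
      grow q f c - new z c * h z c
        ≡⟨ ≡.cong₂ (λ t d → grow q f d - new t d * h t d) (last-∷ʳ z c) (init-∷ʳ z c) ⟨
      forgetᶜ (grow q f) (c ∷ʳ z) - H (c ∷ʳ z) ∎

-- Newton's identities in finitely many variables

module ElementarySymmetric (K : ℚ-Algebra) where
  open ℚ-Algebra K
  open Sums K
  open Solver using (solve; _:=_; _:+_; _:*_; _:-_; :-_; con)
  open import Relation.Binary.Reasoning.Setoid setoid

  pow : Carrier → ℕ → Carrier
  pow x zero    = x
  pow x (suc j) = x * pow x j

  elem : Vec Carrier k → ℕ → Carrier
  elem xs       zero    = 1#
  elem []       (suc i) = 0#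
  elem (x ∷ xs) (suc i) = elem xs (suc i) + x * elem xs i

  -- marked xs j i = ∑_c x_c^(j+1) eᵢ(xs without x_c)
  marked : Vec Carrier k → ℕ → ℕ → Carrier
  marked []       j i       = 0#
  marked (x ∷ xs) j zero    = pow x j + marked xs j zero
  marked (x ∷ xs) j (suc i) = pow x j * elem xs (suc i) + (marked xs j (suc i) + x * marked xs j i)

  -- A squarefree monomial of degree i + 1 arises once for each of its i + 1 variables.
  marked-0 : ∀ (xs : Vec Carrier k) i → marked xs 0 i ≋ ι (fromℕ (suc i)) * elem xs (suc i)
  marked-0 []       i       = sym (zeroʳ _)
  marked-0 (x ∷ xs) zero    = begin
    x + marked xs 0 0                   ≈⟨ +-congˡ (marked-0 xs 0) ⟩
    x + ι 1ℚ * elem xs 1                ≈⟨ +-cong (sym (*-identityʳ x)) (trans (*-congʳ ι-1) (*-identityˡ _)) ⟩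
    x * 1# + elem xs 1                  ≈⟨ trans (sym (•-one _)) (*-congˡ (+-comm _ _)) ⟩
    ι 1ℚ * (elem xs 1 + x * 1#)         ∎
  marked-0 (x ∷ xs) (suc i) = begin
    x * elem xs (suc i) + (marked xs 0 (suc i) + x * marked xs 0 i)
      ≈⟨ +-congˡ (+-cong (marked-0 xs (suc i)) (*-congˡ (marked-0 xs i))) ⟩
    x * elem xs (suc i) + (ι (fromℕ (suc (suc i))) * elem xs (suc (suc i)) + x *
      (ι (fromℕ (suc i)) * elem xs (suc i)))
      ≈⟨ +-congˡ (+-congʳ (*-congʳ N+1)) ⟩
    x * elem xs (suc i) + ((ι 1ℚ + ι (fromℕ (suc i))) * elem xs (suc (suc i)) + x *
      (ι (fromℕ (suc i)) * elem xs (suc i)))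
      ≈⟨ solve 4 (λ x p q n → x :* p :+ ((con 1ℚ :+ n) :* q :+ x :* (n :* p)) := (con 1ℚ :+ n) :* (q :+ x :* p))
           refl _ _ _ _ ⟩
    (ι 1ℚ + ι (fromℕ (suc i))) * (elem xs (suc (suc i)) + x * elem xs (suc i))
      ≈⟨ *-congʳ N+1 ⟨
    ι (fromℕ (suc (suc i))) * (elem xs (suc (suc i)) + x * elem xs (suc i)) ∎
    where
    N+1 : ι (fromℕ (suc (suc i))) ≋ ι 1ℚ + ι (fromℕ (suc i))
    N+1 = trans (ι-cong (fromℕ-suc (suc i))) (ι-+ 1ℚ _)

  -- For each c, split e_{i+1} by whether a monomial contains x_c, multiply by x_c^(j+1) and sum
  -- over c. The proof unfolds this by induction on the variables.
  elem-marked : ∀ (xs : Vec Carrier k) j i →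
                elem xs (suc i) * marked xs j 0 ≋ marked xs j (suc i) + marked xs (suc j) i
  elem-marked []       j i       = trans (zeroʳ _) (sym (+-identityʳ 0#))
  elem-marked (x ∷ xs) j zero    = begin
    (elem xs 1 + x * 1#) * (xʲ + U₀) ≈⟨ *-congʳ (+-congˡ (*-identityʳ x)) ⟩
    (elem xs 1 + x) * (xʲ + U₀)      ≈⟨ solve 4 (λ E x xʲ U → (E :+ x) :* (xʲ :+ U) := (xʲ :* E :+ x :* xʲ) :+
      (E :* U :+ x :* U)) refl _ _ _ _ ⟩
    (xʲ * elem xs 1 + x * xʲ) + (elem xs 1 * U₀ + x * U₀) ≈⟨ +-congˡ (+-congʳ (elem-marked xs j 0)) ⟩
    (xʲ * elem xs 1 + x * xʲ) + ((marked xs j 1 + marked xs (suc j) 0) + x * U₀)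
      ≈⟨ solve 5 (λ a p u v t → (a :+ p) :+ ((u :+ v) :+ t) := (a :+ (u :+ t)) :+ (p :+ v)) refl _ _ _ _ _ ⟩
    (xʲ * elem xs 1 + (marked xs j 1 + x * U₀)) + (x * xʲ + marked xs (suc j) 0) ∎
    where
    xʲ = pow x j
    U₀ = marked xs j 0
  elem-marked (x ∷ xs) j (suc i) = begin
    (E₂ + x * E₁) * (xʲ + U₀)
      ≈⟨ solve 5 (λ E E′ x xʲ U → (E :+ x :* E′) :* (xʲ :+ U) := (xʲ :* E :+ (x :* xʲ) :* E′) :+
           (E :* U :+ x :* (E′ :* U))) refl _ _ _ _ _ ⟩
    (xʲ * E₂ + (x * xʲ) * E₁) + (E₂ * U₀ + x * (E₁ * U₀))
      ≈⟨ +-congˡ (+-cong (elem-marked xs j (suc i)) (*-congˡ (elem-marked xs j i))) ⟩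
    (xʲ * E₂ + (x * xʲ) * E₁) + ((marked xs j (suc (suc i)) + marked xs (suc j) (suc i)) + x *
      (marked xs j (suc i) + marked xs (suc j) i))
      ≈⟨ solve 7 (λ a c u v x s t → (a :+ c) :+ ((u :+ v) :+ x :* (s :+ t)) := (a :+ (u :+ x :* s)) :+
           (c :+ (v :+ x :* t))) refl _ _ _ _ _ _ _ ⟩
    (xʲ * E₂ + (marked xs j (suc (suc i)) + x * marked xs j (suc i))) +
      ((x * xʲ) * E₁ + (marked xs (suc j) (suc i) + x * marked xs (suc j) i)) ∎
    where
    xʲ  = pow x j
    U₀ = marked xs j 0
    E₁ = elem xs (suc i)
    E₂ = elem xs (suc (suc i))

  newton : Vec Carrier k → Newton K
  newton xs = record
    { ε = elem xs
    ; u = λ { zero j → 0# ; (suc i) j → marked xs j i }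
    ; ε-0 = refl
    ; u-0 = marked-0 xs
    ; u-suc = λ i j → sym (trans (+-congʳ (elem-marked xs j i)) (solve 2 (λ p q → (p :+ q) :- p := q) refl _ _))
    }

-- The ring of formal power series

module SeriesRing where
  open ≡
  open import Algebra.Properties.CommutativeMonoid.Sum ℚ.+-0-commutativeMonoid
    using (sum; sum-cong-≗; ∑-distrib-+)

  open ≡-Reasoning

  -- The sum of t i j over i + j = m. With t a function of both indices, inductions can shift either
  -- one.
  conv : (ℕ → ℕ → ℚ) → ℕ → ℚ
  conv t m = sum {suc m} λ i → t (toℕ i) (m ∸ toℕ i)

  conv-cong : ∀ m {s t : ℕ → ℕ → ℚ} → (∀ i j → s i j ≡ t i j) → conv s m ≡ conv t m
  conv-cong m s≡t = sum-cong-≗ {suc m} λ i → s≡t (toℕ i) (m ∸ toℕ i)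

  conv-+ : ∀ m (s t : ℕ → ℕ → ℚ) → conv (λ i j → s i j ℚ.+ t i j) m ≡ conv s m ℚ.+ conv t m
  conv-+ m s t = ∑-distrib-+ {suc m} (λ i → s (toℕ i) (m ∸ toℕ i)) (λ i → t (toℕ i) (m ∸ toℕ i))

  conv-last : ∀ t m → conv t (suc m) ≡ conv (λ i j → t i (suc j)) m ℚ.+ t (suc m) 0
  conv-last t zero    = trans (cong (t 0 1 ℚ.+_) (ℚ.+-identityʳ (t 1 0)))
    (cong (ℚ._+ t 1 0) (sym (ℚ.+-identityʳ (t 0 1))))
  conv-last t (suc m) = trans (cong (t 0 (suc (suc m)) ℚ.+_) (conv-last (t ∘ suc) m))
    (sym (ℚ.+-assoc (t 0 (suc (suc m))) (conv (λ i j → t (suc i) (suc j)) m) (t (suc (suc m)) 0)))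

  conv-flip : ∀ t m → conv t m ≡ conv (flip t) m
  conv-flip t zero    = refl
  conv-flip t (suc m) = trans (cong (t 0 (suc m) ℚ.+_) (conv-flip (t ∘ suc) m))
    (trans (ℚ.+-comm (t 0 (suc m)) (conv (flip (t ∘ suc)) m)) (sym (conv-last (flip t) m)))

  -- Both sides sum t p q r over p + q + r = m; the induction peels off the terms with p = 0.
  conv-assoc : ∀ (t : ℕ → ℕ → ℕ → ℚ) m →
    conv (λ i j → conv (λ p q → t p q j) i) m ≡ conv (λ p r → conv (t p) r) m
  conv-assoc t zero    = refl
  conv-assoc t (suc m) = begin
    (t 0 0 (suc m) ℚ.+ 0ℚ) ℚ.+ conv (λ i j → t 0 (suc i) j ℚ.+ conv (λ p q → t (suc p) q j) i) m
      ≡⟨ cong₂ ℚ._+_ (ℚ.+-identityʳ (t 0 0 (suc m))) (conv-+ m (t 0 ∘ suc) (λ i j → conv (λ p q → t (suc p) q j) i)) ⟩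
    t 0 0 (suc m) ℚ.+ (conv (t 0 ∘ suc) m ℚ.+ conv (λ i j → conv (λ p q → t (suc p) q j) i) m)
      ≡⟨ ℚ.+-assoc (t 0 0 (suc m)) (conv (t 0 ∘ suc) m) (conv (λ i j → conv (λ p q → t (suc p) q j) i) m) ⟨
    conv (t 0) (suc m) ℚ.+ conv (λ i j → conv (λ p q → t (suc p) q j) i) m
      ≡⟨ cong (conv (t 0) (suc m) ℚ.+_) (conv-assoc (t ∘ suc) m) ⟩
    conv (t 0) (suc m) ℚ.+ conv (λ p r → conv (t (suc p)) r) m ∎

  ≈-trans : ∀ {F G H : Series} → F ≈ G → G ≈ H → F ≈ H
  ≈-trans F≈G G≈H α = trans (F≈G α) (G≈H α)

  ⊗-cong : ∀ {F F′ H H′} → F ≈ F′ → H ≈ H′ → F ⊗ H ≈ F′ ⊗ H′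
  ⊗-cong F≈F′ H≈H′ []      = cong₂ ℚ._*_ (F≈F′ []) (H≈H′ [])
  ⊗-cong F≈F′ H≈H′ (m ∷ α) = conv-cong m λ i j → ⊗-cong (F≈F′ ∘ (i ∷_)) (H≈H′ ∘ (j ∷_)) α

  ⊗-comm : ∀ F H → F ⊗ H ≈ H ⊗ F
  ⊗-comm F H []      = ℚ.*-comm (F []) (H [])
  ⊗-comm F H (m ∷ α) = trans (conv-cong m λ i j → ⊗-comm (slice F i) (slice H j) α)
    (conv-flip (λ i j → (slice H j ⊗ slice F i) α) m)

  ⊗-distribʳ : ∀ H F G → (F ⊕ G) ⊗ H ≈ F ⊗ H ⊕ G ⊗ H
  ⊗-distribʳ H F G []      = ℚ.*-distribʳ-+ (H []) (F []) (G [])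
  ⊗-distribʳ H F G (m ∷ α) = trans (conv-cong m λ i j → ⊗-distribʳ (slice H j) (slice F i) (slice G i) α)
    (conv-+ m (λ i j → (slice F i ⊗ slice H j) α) (λ i j → (slice G i ⊗ slice H j) α))

  ⊗-distribˡ : ∀ H F G → H ⊗ (F ⊕ G) ≈ H ⊗ F ⊕ H ⊗ G
  ⊗-distribˡ H F G α = trans (⊗-comm H (F ⊕ G) α)
    (trans (⊗-distribʳ H F G α) (cong₂ ℚ._+_ (⊗-comm F H α) (⊗-comm G H α)))

  ∑⊗ : ∀ n (T : Fin n → Series) H α → ((λ β → sum λ i → T i β) ⊗ H) α ≡ sum λ i → (T i ⊗ H) α
  ∑⊗ zero    T H α = ⊗-zeroˡ (length α) H (λ _ _ → refl) α refl
  ∑⊗ (suc n) T H α = trans (⊗-distribʳ H (T zero) (λ β → sum λ i → T (suc i) β) α)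
    (cong ((T zero ⊗ H) α ℚ.+_) (∑⊗ n (T ∘ suc) H α))

  ⊗-assoc : ∀ F G H → (F ⊗ G) ⊗ H ≈ F ⊗ (G ⊗ H)
  ⊗-assoc F G H []      = ℚ.*-assoc (F []) (G []) (H [])
  ⊗-assoc F G H (m ∷ α) = begin
    conv (λ i j → (slice (F ⊗ G) i ⊗ slice H j) α) m
      ≡⟨ conv-cong m (λ i j → ∑⊗ (suc i) (λ p → slice F (toℕ p) ⊗ slice G (i ∸ toℕ p)) (slice H j) α) ⟩
    conv (λ i j → conv (λ p q → ((slice F p ⊗ slice G q) ⊗ slice H j) α) i) m
      ≡⟨ conv-assoc (λ p q j → ((slice F p ⊗ slice G q) ⊗ slice H j) α) m ⟩
    conv (λ p r → conv (λ q j → ((slice F p ⊗ slice G q) ⊗ slice H j) α) r) m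
      -- `∑⊗` pulls a sum out of a left factor, hence the two uses of commutativity.
      ≡⟨ conv-cong m (λ p r → trans (conv-cong r λ q j → trans (⊗-assoc (slice F p) (slice G q) (slice H j) α)
           (⊗-comm (slice F p) _ α))
           (trans (sym (∑⊗ (suc r) (λ q → slice G (toℕ q) ⊗ slice H (r ∸ toℕ q)) (slice F p) α))
             (⊗-comm (slice (G ⊗ H) r) (slice F p) α))) ⟩
    conv (λ p r → (slice F p ⊗ slice (G ⊗ H) r) α) m ∎

  slice-const-suc : ∀ q i → slice (const q) (suc i) ≈ λ _ → 0ℚ
  slice-const-suc q i α = refl

  conv-first : ∀ t m → (∀ i j → t (suc i) j ≡ 0ℚ) → conv t m ≡ t 0 m
  conv-first t zero    t≡0 = ℚ.+-identityʳ (t 0 0)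
  conv-first t (suc m) t≡0 = trans (cong (t 0 (suc m) ℚ.+_) (∑-0 (suc m) λ i → t≡0 (toℕ i) (m ∸ toℕ i)))
    (ℚ.+-identityʳ (t 0 (suc m)))

  const-⊗ : ∀ q F α → (const q ⊗ F) α ≡ q ℚ.* F α
  const-⊗ q F []      = refl
  const-⊗ q F (m ∷ α) = trans
    (conv-first (λ i j → (slice (const q) i ⊗ slice F j) α) m λ i j → ⊗-zeroˡ (length α) (slice F j)
      (λ β _ → slice-const-suc q i β) α refl)
    (const-⊗ q (slice F m) α)

  ⊗-identityˡ : ∀ F → const 1ℚ ⊗ F ≈ F
  ⊗-identityˡ F α = trans (const-⊗ 1ℚ F α) (ℚ.*-identityˡ (F α))

  negate : Series → Series
  negate F α = ℚ.- F α

  const-map₁ : ∀ (f : ℚ → ℚ) → f 0ℚ ≡ 0ℚ → ∀ q α → const (f q) α ≡ f (const q α)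
  const-map₁ f f0 q α with does (All.all? (ℕ._≟ 0) α)
  ... | true  = refl
  ... | false = sym f0

  const-map₂ : ∀ (f : ℚ → ℚ → ℚ) → f 0ℚ 0ℚ ≡ 0ℚ → ∀ p q α → const (f p q) α ≡ f (const p α) (const q α)
  const-map₂ f f0 p q α with does (All.all? (ℕ._≟ 0) α)
  ... | true  = refl
  ... | false = sym f0

  seriesRing : CommutativeRing _ _
  seriesRing = record
    { Carrier = Series
    ; _≈_ = _≈_
    ; _+_ = _⊕_
    ; _*_ = _⊗_
    ; -_ = negate
    ; 0# = const 0ℚ
    ; 1# = const 1ℚ
    ; isCommutativeRing = record
      { isRing = record
        { +-isAbelianGroup = record
          { isGroup = record
            { isMonoid = record
              { isSemigroup = record
                { isMagma = record
                  { isEquivalence = record { refl = λ _ → refl ; sym = λ F≈G α → sym (F≈G α) ; trans = ≈-trans }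
                  ; ∙-cong = λ F≈F′ G≈G′ α → cong₂ ℚ._+_ (F≈F′ α) (G≈G′ α)
                  }
                ; assoc = λ F G H α → ℚ.+-assoc (F α) (G α) (H α)
                }
              ; identity = (λ F α → trans (cong (ℚ._+ F α) (const-0 α)) (ℚ.+-identityˡ (F α)))
                         , (λ F α → trans (cong (F α ℚ.+_) (const-0 α)) (ℚ.+-identityʳ (F α)))
              }
            ; inverse = (λ F α → trans (ℚ.+-inverseˡ (F α)) (sym (const-0 α)))
                      , (λ F α → trans (ℚ.+-inverseʳ (F α)) (sym (const-0 α)))
            ; ⁻¹-cong = λ F≈G α → cong ℚ.-_ (F≈G α)
            }
          ; comm = λ F G α → ℚ.+-comm (F α) (G α)
          }
        ; *-cong = λ {F} {F′} {G} {G′} → ⊗-cong {F} {F′} {G} {G′}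
        ; *-assoc = ⊗-assoc
        ; *-identity = ⊗-identityˡ , λ F → ≈-trans (⊗-comm F (const 1ℚ)) (⊗-identityˡ F)
        ; distrib = ⊗-distribˡ , ⊗-distribʳ
        }
      ; *-comm = ⊗-comm
      }
    }

  seriesAlgebra : ℚ-Algebra
  seriesAlgebra = record
    { commutativeRing = seriesRing
    ; ι = const
    ; ι-+ = const-map₂ ℚ._+_ refl
    ; ι-* = λ p q α → trans (const-map₁ (p ℚ.*_) (ℚ.*-zeroʳ p) q α) (sym (const-⊗ p (const q) α))
    ; ι-neg = const-map₁ ℚ.-_ refl
    ; ι-0 = λ _ → refl
    ; ι-1 = λ _ → refl
    }

open SeriesRing

-- Fractions in the elementary symmetric functions

module Fractions where

  module 𝕊 = ℚ-Algebra seriesAlgebra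
  open import Relation.Binary.Reasoning.Setoid 𝕊.setoid
  open Sums seriesAlgebra using (module Solver)
  open Solver using (solve; _:=_; _:+_; _:*_; _:-_; :-_; con)
  open ℚ⟨e⟩

  infix 4 _≃_
  _≃_ : ℚ⟨e⟩ → ℚ⟨e⟩ → Set
  φ ≃ ψ = ⟦ num φ ⟧ ⊗ ⟦ den ψ ⟧ ≈ ⟦ num ψ ⟧ ⊗ ⟦ den φ ⟧

  ⊗-congʳ : ∀ {F G} H → F ≈ G → F ⊗ H ≈ G ⊗ H
  ⊗-congʳ {F} {G} H F≈G = ⊗-cong {F} {G} {H} {H} F≈G λ _ → ≡.refl

  ⊗-congˡ : ∀ {F G} H → F ≈ G → H ⊗ F ≈ H ⊗ G
  ⊗-congˡ {F} {G} H F≈G = ⊗-cong {H} {H} {F} {G} (λ _ → ≡.refl) F≈G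

  ⊕-cong : ∀ {F G F′ G′} → F ≈ G → F′ ≈ G′ → F ⊕ F′ ≈ G ⊕ G′
  ⊕-cong F≈G F′≈G′ α = ≡.cong₂ ℚ._+_ (F≈G α) (F′≈G′ α)

  infixl 6 _⊟_
  _⊟_ : ℚ[e] → ℚ[e] → ℚ[e]
  P ⊟ R = P ⊞ con (ℚ.- 1ℚ) ⊠ R

  ⟦⊟⟧ : ∀ P R α → ⟦ P ⊟ R ⟧ α ≡ ⟦ P ⟧ α ℚ.- ⟦ R ⟧ α
  ⟦⊟⟧ P R α = ≡.cong (⟦ P ⟧ α ℚ.+_)
    (≡.trans (const-⊗ (ℚ.- 1ℚ) ⟦ R ⟧ α)
    (≡.trans (≡.sym (ℚ.neg-distribˡ-* 1ℚ (⟦ R ⟧ α))) (≡.cong ℚ.-_ (ℚ.*-identityˡ (⟦ R ⟧ α)))))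

  -- If P and R differed at α, then P - R and Q would be nonzero with product 0. The difference is
  -- formed syntactically so that `⊠-nonZero` applies; equality of rationals is stable, which makes
  -- the argument by contradiction constructive.
  ⊗-cancelʳ : ∀ P R Q → NonZeroPoly Q → ⟦ P ⟧ ⊗ ⟦ Q ⟧ ≈ ⟦ R ⟧ ⊗ ⟦ Q ⟧ → ⟦ P ⟧ ≈ ⟦ R ⟧
  ⊗-cancelʳ P R Q Q≉0 PQ≈RQ α = decidable-stable (⟦ P ⟧ α ℚ.≟ ⟦ R ⟧ α) λ Pα≢Rα →
    ⊠-nonZero (P ⊟ R) Q
      (λ P-R≈0 → Pα≢Rα (minus-zero (⟦ P ⟧ α) (⟦ R ⟧ α) (≡.trans (≡.sym (⟦⊟⟧ P R α)) (≡.trans (P-R≈0 α) (const-0 α)))))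
      Q≉0
      (begin
        (⟦ P ⟧ ⊕ const (ℚ.- 1ℚ) ⊗ ⟦ R ⟧) ⊗ ⟦ Q ⟧
          ≈⟨ solve 3 (λ p r q → (p :+ con (ℚ.- 1ℚ) :* r) :* q := p :* q :- r :* q) 𝕊.refl ⟦ P ⟧ ⟦ R ⟧ ⟦ Q ⟧ ⟩
        ⟦ P ⟧ ⊗ ⟦ Q ⟧ ⊕ negate (⟦ R ⟧ ⊗ ⟦ Q ⟧)
          ≈⟨ ⊕-cong {⟦ P ⟧ ⊗ ⟦ Q ⟧} {⟦ R ⟧ ⊗ ⟦ Q ⟧} PQ≈RQ (λ _ → ≡.refl) ⟩
        ⟦ R ⟧ ⊗ ⟦ Q ⟧ ⊕ negate (⟦ R ⟧ ⊗ ⟦ Q ⟧)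
          ≈⟨ 𝕊.-‿inverseʳ (⟦ R ⟧ ⊗ ⟦ Q ⟧) ⟩
        const 0ℚ ∎)
    where
    minus-zero : ∀ p r → p ℚ.- r ≡ 0ℚ → p ≡ r
    minus-zero p r p-r≡0 = ≡.trans (≡.sym (ℚ-cancel p r)) (≡.trans (≡.cong (ℚ._+ r) p-r≡0) (ℚ.+-identityˡ r))
      where
      ℚ-cancel : ∀ p r → p ℚ.- r ℚ.+ r ≡ p
      ℚ-cancel p r = ≡.trans (ℚ.+-assoc p (ℚ.- r) r) (≡.trans (≡.cong (p ℚ.+_) (ℚ.+-inverseˡ r)) (ℚ.+-identityʳ p))

  -- Cross-multiplication chains together only after the middle denominator is cancelled.
  ≃-trans : ∀ {φ ψ χ} → φ ≃ ψ → ψ ≃ χ → φ ≃ χ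
  ≃-trans {P // Q ⟨ _ ⟩} {P′ // Q′ ⟨ Q′≉0 ⟩} {P″ // Q″ ⟨ _ ⟩} eq₁ eq₂ =
    ⊗-cancelʳ (P ⊠ Q″) (P″ ⊠ Q) Q′ Q′≉0 (begin
      (p ⊗ q″) ⊗ q′  ≈⟨ solve 3 (λ p q q′ → (p :* q) :* q′ := (p :* q′) :* q) 𝕊.refl p q″ q′ ⟩
      (p ⊗ q′) ⊗ q″  ≈⟨ ⊗-congʳ q″ eq₁ ⟩
      (p′ ⊗ q) ⊗ q″  ≈⟨ solve 3 (λ p q q′ → (p :* q) :* q′ := (p :* q′) :* q) 𝕊.refl p′ q q″ ⟩
      (p′ ⊗ q″) ⊗ q  ≈⟨ ⊗-congʳ q eq₂ ⟩
      (p″ ⊗ q′) ⊗ q  ≈⟨ solve 3 (λ p q q′ → (p :* q) :* q′ := (p :* q′) :* q) 𝕊.refl p″ q′ q ⟩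
      (p″ ⊗ q) ⊗ q′  ∎)
    where
    p  = ⟦ P ⟧
    p′ = ⟦ P′ ⟧
    p″ = ⟦ P″ ⟧
    q  = ⟦ Q ⟧
    q′ = ⟦ Q′ ⟧
    q″ = ⟦ Q″ ⟧

  +ᶠ-cong : ∀ {φ φ′ ψ ψ′} → φ ≃ φ′ → ψ ≃ ψ′ → φ +ᶠ ψ ≃ φ′ +ᶠ ψ′
  +ᶠ-cong {P // Q ⟨ _ ⟩} {P′ // Q′ ⟨ _ ⟩} {R // S ⟨ _ ⟩} {R′ // S′ ⟨ _ ⟩} eq₁ eq₂ = begin
    (p ⊗ s ⊕ r ⊗ q) ⊗ (q′ ⊗ s′)
      ≈⟨ solve 6 (λ p q r s q′ s′ → (p :* s :+ r :* q) :* (q′ :* s′) := (p :* q′) :* (s :* s′) :+ (r :* s′) :*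
           (q :* q′)) 𝕊.refl p q r s q′ s′ ⟩
    (p ⊗ q′) ⊗ (s ⊗ s′) ⊕ (r ⊗ s′) ⊗ (q ⊗ q′)
      ≈⟨ ⊕-cong {(p ⊗ q′) ⊗ (s ⊗ s′)} {(p′ ⊗ q) ⊗ (s ⊗ s′)} (⊗-congʳ (s ⊗ s′) eq₁) (⊗-congʳ (q ⊗ q′) eq₂) ⟩
    (p′ ⊗ q) ⊗ (s ⊗ s′) ⊕ (r′ ⊗ s) ⊗ (q ⊗ q′)
      ≈⟨ solve 6 (λ p q r s q′ s′ → (p :* s :+ r :* q) :* (q′ :* s′) := (p :* q′) :* (s′ :* s) :+ (r :* s′) :*
           (q′ :* q)) 𝕊.refl p′ q′ r′ s′ q s ⟨
    (p′ ⊗ s′ ⊕ r′ ⊗ q′) ⊗ (q ⊗ s) ∎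
    where
    p  = ⟦ P ⟧
    p′ = ⟦ P′ ⟧
    q  = ⟦ Q ⟧
    q′ = ⟦ Q′ ⟧
    r  = ⟦ R ⟧
    r′ = ⟦ R′ ⟧
    s  = ⟦ S ⟧
    s′ = ⟦ S′ ⟧

  *ᶠ-cong : ∀ {φ φ′ ψ ψ′} → φ ≃ φ′ → ψ ≃ ψ′ → φ *ᶠ ψ ≃ φ′ *ᶠ ψ′
  *ᶠ-cong {P // Q ⟨ _ ⟩} {P′ // Q′ ⟨ _ ⟩} {R // S ⟨ _ ⟩} {R′ // S′ ⟨ _ ⟩} eq₁ eq₂ = begin
    (p ⊗ r) ⊗ (q′ ⊗ s′)   ≈⟨ solve 4 (λ p q r s → (p :* r) :* (q :* s) := (p :* q) :* (r :* s)) 𝕊.refl p q′ r s′ ⟩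
    (p ⊗ q′) ⊗ (r ⊗ s′)   ≈⟨ ⊗-cong {p ⊗ q′} {p′ ⊗ q} {r ⊗ s′} {r′ ⊗ s} eq₁ eq₂ ⟩
    (p′ ⊗ q) ⊗ (r′ ⊗ s)   ≈⟨ solve 4 (λ p q r s → (p :* r) :* (q :* s) := (p :* q) :* (r :* s)) 𝕊.refl p′ q r′ s ⟨
    (p′ ⊗ r′) ⊗ (q ⊗ s)   ∎
    where
    p  = ⟦ P ⟧
    p′ = ⟦ P′ ⟧
    q  = ⟦ Q ⟧
    q′ = ⟦ Q′ ⟧
    r  = ⟦ R ⟧
    r′ = ⟦ R′ ⟧
    s  = ⟦ S ⟧
    s′ = ⟦ S′ ⟧

  negᶠ : ℚ⟨e⟩ → ℚ⟨e⟩
  negᶠ (P // Q ⟨ Q≉0 ⟩) = (con (ℚ.- 1ℚ) ⊠ P) // Q ⟨ Q≉0 ⟩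

  negᶠ-cong : ∀ {φ ψ} → φ ≃ ψ → negᶠ φ ≃ negᶠ ψ
  negᶠ-cong {P // Q ⟨ _ ⟩} {P′ // Q′ ⟨ _ ⟩} eq = begin
    (const (ℚ.- 1ℚ) ⊗ ⟦ P ⟧) ⊗ ⟦ Q′ ⟧   ≈⟨ ⊗-assoc (const (ℚ.- 1ℚ)) ⟦ P ⟧ ⟦ Q′ ⟧ ⟩
    const (ℚ.- 1ℚ) ⊗ (⟦ P ⟧ ⊗ ⟦ Q′ ⟧)   ≈⟨ ⊗-congˡ (const (ℚ.- 1ℚ)) eq ⟩
    const (ℚ.- 1ℚ) ⊗ (⟦ P′ ⟧ ⊗ ⟦ Q ⟧)   ≈⟨ ⊗-assoc (const (ℚ.- 1ℚ)) ⟦ P′ ⟧ ⟦ Q ⟧ ⟨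
    (const (ℚ.- 1ℚ) ⊗ ⟦ P′ ⟧) ⊗ ⟦ Q ⟧   ∎

  fractionRing : CommutativeRing _ _
  fractionRing = record
    { Carrier = ℚ⟨e⟩
    ; _≈_ = _≃_
    ; _+_ = _+ᶠ_
    ; _*_ = _*ᶠ_
    ; -_ = negᶠ
    ; 0# = fromℚ 0ℚ
    ; 1# = fromℚ 1ℚ
    ; isCommutativeRing = record
      { isRing = record
        { +-isAbelianGroup = record
          { isGroup = record
            { isMonoid = record
              { isSemigroup = record
                { isMagma = record
                  { isEquivalence = record
                    { refl = λ _ → ≡.refl
                    ; sym = λ eq α → ≡.sym (eq α)
                    ; trans = λ {φ} {ψ} {χ} → ≃-trans {φ} {ψ} {χ}
                    }
                  ; ∙-cong = λ {φ} {φ′} {ψ} {ψ′} → +ᶠ-cong {φ} {φ′} {ψ} {ψ′}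
                  }
                ; assoc = λ φ ψ χ → solve 6 (λ p q r s t u →
                    ((p :* s :+ r :* q) :* u :+ t :* (q :* s)) :* (q :* (s :* u)) :=
                    (p :* (s :* u) :+ (r :* u :+ t :* s) :* q) :* ((q :* s) :* u)) 𝕊.refl
                    ⟦ num φ ⟧ ⟦ den φ ⟧ ⟦ num ψ ⟧ ⟦ den ψ ⟧ ⟦ num χ ⟧ ⟦ den χ ⟧
                }
              ; identity = (λ φ → solve 2 (λ p q → (con 0ℚ :* q :+ p :* con 1ℚ) :* q := p :* (con 1ℚ :* q))
                𝕊.refl ⟦ num φ ⟧ ⟦ den φ ⟧)
                         , (λ φ → solve 2 (λ p q → (p :* con 1ℚ :+ con 0ℚ :* q) :* q := p :* (q :* con 1ℚ))
                           𝕊.refl ⟦ num φ ⟧ ⟦ den φ ⟧)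
              }
            ; inverse = (λ φ → solve 2 (λ p q → ((con (ℚ.- 1ℚ) :* p) :* q :+ p :* q) :* con 1ℚ := con 0ℚ :*
              (q :* q)) 𝕊.refl ⟦ num φ ⟧ ⟦ den φ ⟧)
                      , (λ φ → solve 2 (λ p q → (p :* q :+ (con (ℚ.- 1ℚ) :* p) :* q) :* con 1ℚ := con 0ℚ :*
                        (q :* q)) 𝕊.refl ⟦ num φ ⟧ ⟦ den φ ⟧)
            ; ⁻¹-cong = λ {φ} {ψ} → negᶠ-cong {φ} {ψ}
            }
          ; comm = λ φ ψ → solve 4 (λ p q r s → (p :* s :+ r :* q) :* (s :* q) := (r :* q :+ p :* s) :*
            (q :* s)) 𝕊.refl
              ⟦ num φ ⟧ ⟦ den φ ⟧ ⟦ num ψ ⟧ ⟦ den ψ ⟧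
          }
        ; *-cong = λ {φ} {φ′} {ψ} {ψ′} → *ᶠ-cong {φ} {φ′} {ψ} {ψ′}
        ; *-assoc = λ φ ψ χ → solve 6 (λ p q r s t u →
            ((p :* r) :* t) :* (q :* (s :* u)) := (p :* (r :* t)) :* ((q :* s) :* u)) 𝕊.refl
            ⟦ num φ ⟧ ⟦ den φ ⟧ ⟦ num ψ ⟧ ⟦ den ψ ⟧ ⟦ num χ ⟧ ⟦ den χ ⟧
        ; *-identity = (λ φ → solve 2 (λ p q → (con 1ℚ :* p) :* q := p :* (con 1ℚ :* q)) 𝕊.refl ⟦ num φ ⟧ ⟦ den φ ⟧)
                     , (λ φ → solve 2 (λ p q → (p :* con 1ℚ) :* q := p :* (q :* con 1ℚ)) 𝕊.refl ⟦ num φ ⟧ ⟦ den φ ⟧)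
        ; distrib = (λ φ ψ χ → solve 6 (λ p q r s t u →
              (p :* (r :* u :+ t :* s)) :* ((q :* s) :* (q :* u)) :=
              ((p :* r) :* (q :* u) :+ (p :* t) :* (q :* s)) :* (q :* (s :* u))) 𝕊.refl
              ⟦ num φ ⟧ ⟦ den φ ⟧ ⟦ num ψ ⟧ ⟦ den ψ ⟧ ⟦ num χ ⟧ ⟦ den χ ⟧)
                  , (λ φ ψ χ → solve 6 (λ p q r s t u →
              ((r :* u :+ t :* s) :* p) :* ((s :* q) :* (u :* q)) :=
              ((r :* p) :* (u :* q) :+ (t :* p) :* (s :* q)) :* ((s :* u) :* q)) 𝕊.refl
              ⟦ num φ ⟧ ⟦ den φ ⟧ ⟦ num ψ ⟧ ⟦ den ψ ⟧ ⟦ num χ ⟧ ⟦ den χ ⟧)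
        }
      ; *-comm = λ φ ψ → solve 4 (λ p q r s → (p :* r) :* (s :* q) := (r :* p) :* (q :* s)) 𝕊.refl
          ⟦ num φ ⟧ ⟦ den φ ⟧ ⟦ num ψ ⟧ ⟦ den ψ ⟧
      }
    }

  polynomial : ℚ[e] → ℚ⟨e⟩
  polynomial P = P // con 1ℚ ⟨ const-nonZero ℚ.1≢0 ⟩

  polynomial-cong : ∀ P R → ⟦ P ⟧ ≈ ⟦ R ⟧ → polynomial P ≃ polynomial R
  polynomial-cong P R = ⊗-congʳ (const 1ℚ)

  polynomial-injective : ∀ P R → polynomial P ≃ polynomial R → ⟦ P ⟧ ≈ ⟦ R ⟧
  polynomial-injective P R = ⊗-cancelʳ P R (con 1ℚ) (const-nonZero ℚ.1≢0)

  polynomial-⊞ : ∀ P R → polynomial (P ⊞ R) ≃ polynomial P +ᶠ polynomial R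
  polynomial-⊞ P R = solve 2 (λ p r → (p :+ r) :* (con 1ℚ :* con 1ℚ) := (p :* con 1ℚ :+ r :* con 1ℚ) :* con 1ℚ)
    𝕊.refl ⟦ P ⟧ ⟦ R ⟧

  polynomial-⊠ : ∀ P R → polynomial (P ⊠ R) ≃ polynomial P *ᶠ polynomial R
  polynomial-⊠ P R = solve 2 (λ p r → (p :* r) :* (con 1ℚ :* con 1ℚ) := (p :* r) :* con 1ℚ) 𝕊.refl ⟦ P ⟧ ⟦ R ⟧

  e-ratio-gen : ∀ i → e-ratio (suc i) i *ᶠ polynomial (gen i) ≃ polynomial (gen (suc i))
  e-ratio-gen i = solve 2 (λ p q → (p :* q) :* con 1ℚ := p :* (q :* con 1ℚ)) 𝕊.refl (e (suc i)) (e i)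

  fractionAlgebra : ℚ-Algebra
  fractionAlgebra = record
    { commutativeRing = fractionRing
    ; ι = fromℚ
    ; ι-+ = λ p q → 𝔽.trans {fromℚ (p ℚ.+ q)} {polynomial (con p ⊞ con q)} {fromℚ p +ᶠ fromℚ q}
        (polynomial-cong (con (p ℚ.+ q)) (con p ⊞ con q) (𝕊.ι-+ p q)) (polynomial-⊞ (con p) (con q))
    ; ι-* = λ p q → 𝔽.trans {fromℚ (p ℚ.* q)} {polynomial (con p ⊠ con q)} {fromℚ p *ᶠ fromℚ q}
        (polynomial-cong (con (p ℚ.* q)) (con p ⊠ con q) (𝕊.ι-* p q)) (polynomial-⊠ (con p) (con q))
    ; ι-neg = λ p → polynomial-cong (con (ℚ.- p)) (con (ℚ.- 1ℚ) ⊠ con p)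
        (𝕊.trans (𝕊.ι-neg p) (solve 1 (λ x → :- x := con (ℚ.- 1ℚ) :* x) 𝕊.refl (const p)))
    ; ι-0 = λ _ → ≡.refl
    ; ι-1 = λ _ → ≡.refl
    }
    where module 𝔽 = CommutativeRing fractionRing

open Fractions

-- Words of operations, and series in the first l variables

data Word : ℕ → Set where
  end    : Word 0
  mark   : Word (suc k) → Word k
  unmark : Word k → Word (suc k)

all-0 : ∀ α → ℕ.sum α ≡ 0 → All.All (_≡ 0) α
all-0 []       _ = []
all-0 (zero ∷ α) p = ≡.refl ∷ all-0 α p
sum-0 : ∀ {α} → All.All (_≡ 0) α → ℕ.sum α ≡ 0
sum-0 []              = ≡.refl
sum-0 (≡.refl ∷ rest) = sum-0 rest
≤1 : ∀ {α} → All.All (_≡ 0) α → All.All (ℕ._≤ 1) α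
≤1 = All.map λ { ≡.refl → z≤n }
e-0 : e 0 ≈ const 1ℚ
e-0 α = if-⇔ (All.all? (ℕ._≤? 1) α ×-dec ℕ.sum α ℕ.≟ 0) (All.all? (ℕ._≟ 0) α)
  (λ (_ , p) → all-0 α p) (λ p → ≤1 p , sum-0 p)

-- The recursion of `Newton` solved inside ℚ[e₁, e₂, ...]; `u-poly 1 m` is the power sum of degree m
-- + 1.
u-poly : ℕ → ℕ → ℚ[e]
u-poly i zero    = con (fromℕ i) ⊠ gen i
u-poly i (suc j) = gen i ⊠ u-poly 1 j ⊟ u-poly (suc i) j

-- Renames every variable to the next one, which frees x₁.
lift : Series → Series
lift F []          = F []
lift F (zero ∷ α)  = F α
lift F (suc m ∷ α) = 0ℚ

var₀ : Series
var₀ (suc zero ∷ α) = const 1ℚ α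
var₀ _              = 0ℚ

var : Fin l → Series
var zero    = var₀
var (suc c) = lift (var c)

module 𝒞 (l : ℕ) = ColourSums seriesAlgebra (var {l})
open ElementarySymmetric seriesAlgebra

valueᶜ : ∀ l → Word k → 𝒞.Functionalᶜ l k
valueᶜ l end        c = const 1ℚ
valueᶜ l (mark w)     = 𝒞.grow l 0 (valueᶜ l w)
valueᶜ l (unmark w)   = 𝒞.forgetᶜ l (valueᶜ l w)

infix 4 _≈⟨_⟩_
-- Equality once all variables but the first l are set to 0. Products respect it because `⊗` relates
-- coefficients at lists of the same length.
_≈⟨_⟩_ : Series → ℕ → Series → Set
F ≈⟨ l ⟩ H = ∀ α → length α ≡ l → F α ≡ H α

⊗-cong-≈⟨⟩ : ∀ l {F F′ H H′} → F ≈⟨ l ⟩ F′ → H ≈⟨ l ⟩ H′ → F ⊗ H ≈⟨ l ⟩ F′ ⊗ H′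
⊗-cong-≈⟨⟩ zero    F≈F′ H≈H′ []      p = ≡.cong₂ ℚ._*_ (F≈F′ [] p) (H≈H′ [] p)
⊗-cong-≈⟨⟩ (suc l) F≈F′ H≈H′ (m ∷ α) p = conv-cong m λ i j →
  ⊗-cong-≈⟨⟩ l (λ β |β| → F≈F′ (i ∷ β) (≡.cong suc |β|)) (λ β |β| → H≈H′ (j ∷ β) (≡.cong suc |β|)) α
    (ℕ.suc-injective p)

vars : ∀ l → Vec Series l
vars l = Vec.tabulate (var {l})

shift : Series → ℕ → List ℕ → ℚ
shift F zero    α = F α
shift F (suc m) α = 0ℚ

lift-⊗ : ∀ x F m α → (lift x ⊗ F) (m ∷ α) ≡ (x ⊗ slice F m) α
lift-⊗ x F m α = conv-first (λ i j → (slice (lift x) i ⊗ slice F j) α) m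
  λ i j → ⊗-zeroˡ (length α) (slice F j) (λ _ _ → ≡.refl) α ≡.refl

elem-lift : ∀ (xs : Vec Series k) i m α → elem (Vec.map lift xs) i (m ∷ α) ≡ shift (elem xs i) m α
elem-lift xs       zero    zero    α = ≡.refl
elem-lift xs       zero    (suc m) α = ≡.refl
elem-lift []       (suc i) zero    α = ≡.refl
elem-lift []       (suc i) (suc m) α = ≡.refl
elem-lift (x ∷ xs) (suc i) m       α = ≡.trans
  (≡.cong₂ ℚ._+_ (elem-lift xs (suc i) m α) (≡.trans (lift-⊗ x (elem (Vec.map lift xs) i) m α)
    (⊗-cong {x} {x} {slice (elem (Vec.map lift xs) i) m} {shift (elem xs i) m} (λ _ → ≡.refl)
      (elem-lift xs i m) α))) (collect m)
  where
  collect : ∀ m → shift (elem xs (suc i)) m α ℚ.+ (x ⊗ shift (elem xs i) m) α ≡ shift (elem (x ∷ xs) (suc i)) m α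
  collect zero    = ≡.refl
  collect (suc m) = ≡.trans (ℚ.+-identityˡ _) (⊗-zeroʳ (length α) x (λ _ _ → ≡.refl) α ≡.refl)

unshift : Series → ℕ → List ℕ → ℚ
unshift F zero    α = 0ℚ
unshift F (suc m) α = F (m ∷ α)

var₀-⊗ : ∀ F m α → (var₀ ⊗ F) (m ∷ α) ≡ unshift F m α
var₀-⊗ F zero    α = ≡.trans (ℚ.+-identityʳ _) (⊗-zeroˡ (length α) (slice F 0) (λ _ _ → ≡.refl) α ≡.refl)
var₀-⊗ F (suc m) α = ≡.trans (≡.cong₂ ℚ._+_ (⊗-zeroˡ (length α) (slice F (suc m)) (λ _ _ → ≡.refl) α ≡.refl)
  (≡.trans (conv-first (λ i j → (slice var₀ (suc i) ⊗ slice F j) α) m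
      λ i j → ⊗-zeroˡ (length α) (slice F j) (λ _ _ → ≡.refl) α ≡.refl)
    (⊗-identityˡ (slice F m) α))) (ℚ.+-identityˡ (F (m ∷ α)))

-- Split by the exponent of x₁ in e_{i+1}(x₁, rest) = e_{i+1}(rest) + x₁ eᵢ(rest): exponent 0 sees
-- the first term, exponent 1 the second, and larger ones neither.
elem-vars : ∀ l i → e i ≈⟨ l ⟩ elem (vars l) i
elem-vars zero    zero    []      _ = ≡.refl
elem-vars zero    (suc i) []      _ = ≡.refl
elem-vars (suc l) zero    (m ∷ α) p = e-0 (m ∷ α)
elem-vars (suc l) (suc i) (m ∷ α) p = ≡.sym (≡.trans
  (≡.cong₂ ℚ._+_
    (≡.trans (≡.cong (λ (xs : Vec Series l) → elem xs (suc i) (m ∷ α)) (tabulate-∘ lift var))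
      (elem-lift (vars l) (suc i) m α))
    (≡.trans (var₀-⊗ (elem (Vec.tabulate (lift ∘ var)) i) m α) (unshift-lift m)))
  (split m))
  where
  |α| = ℕ.suc-injective p
  E : Series
  E []      = 0ℚ
  E (m ∷ α) = shift (elem (vars l) i) m α
  unshift-lift : ∀ m → unshift (elem (Vec.tabulate (lift ∘ var)) i) m α ≡ unshift E m α
  unshift-lift zero    = ≡.refl
  unshift-lift (suc m) = ≡.trans (≡.cong (λ (xs : Vec Series l) → elem xs i (m ∷ α)) (tabulate-∘ lift var))
    (elem-lift (vars l) i m α)
  split : ∀ m → shift (elem (vars l) (suc i)) m α ℚ.+ unshift E m α ≡ e (suc i) (m ∷ α)
  split zero          = ≡.trans (ℚ.+-identityʳ _) (≡.sym (elem-vars l (suc i) α |α|))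
  split (suc zero)    = ≡.trans (ℚ.+-identityˡ _) (≡.sym (elem-vars l i α |α|))
  split (suc (suc m)) = ≡.refl

-- Both sides obey the recursion of `Newton`, with the same e by `elem-vars`.
marked-vars : ∀ l i j → ⟦ u-poly (suc i) j ⟧ ≈⟨ l ⟩ marked (vars l) j i
marked-vars l i zero    α p = ≡.trans (⊗-cong-≈⟨⟩ l {const (fromℕ (suc i))} {const (fromℕ (suc i))}
  (λ _ _ → ≡.refl) (elem-vars l (suc i)) α p)
  (≡.sym (marked-0 (vars l) i α))
marked-vars l i (suc j) α p = ≡.trans (⟦⊟⟧ (gen (suc i) ⊠ u-poly 1 j) (u-poly (suc (suc i)) j) α)
  (≡.trans (≡.cong₂ ℚ._-_ (⊗-cong-≈⟨⟩ l (elem-vars l (suc i)) (marked-vars l 0 j) α p) (marked-vars l (suc i) j α p))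
    (≡.sym (Newton.u-suc (newton (vars l)) i j α)))

marked-power-sum : ∀ l m → marked (vars l) m 0 ≈ 𝒞.power-sum l m
marked-power-sum l m = go l (var {l}) (λ i → i)
  where
  pow-power : ∀ {l} (c : Fin l) m → pow (var c) m ≡ 𝒞.power l c m
  pow-power c zero    = ≡.refl
  pow-power c (suc m) = ≡.cong (var c ⊗_) (pow-power c m)
  go : ∀ k (h : Fin k → Series) (ι : Fin k → Fin l) → marked
    (Vec.tabulate {n = k} (var ∘ ι)) m 0 ≈ Sums.∑ seriesAlgebra (Vec.tabulate ι) (λ y → 𝒞.power l y m)
  go zero    h ι α = ≡.refl
  go (suc k) h ι α = ≡.cong₂ ℚ._+_ (≡.cong (λ F → F α) (pow-power (ι zero) m)) (go k (h ∘ suc) (ι ∘ suc) α)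

power-sum-poly : ∀ l m → ⟦ u-poly 1 m ⟧ ≈⟨ l ⟩ 𝒞.power-sum l m
power-sum-poly l m α p = ≡.trans (marked-vars l 0 m α p) (marked-power-sum l m α)

-- A homomorphism τ from ℚ(e₁, e₂, …), its restriction η to ℚ[e₁, e₂, …] and its
-- values on eₛ/eₛ₋₁.  Only the identity is needed; the abstraction prevents
-- fractions from being unfolded.
record Evaluation (K : ℚ-Algebra) : Set where
  open ℚ-Algebra K
    using (Carrier; 0#; 1#; ι; ι-0; ι-1; sym; trans; +-cong; *-cong; _≋_) renaming (_+_ to _+ᵏ_; _*_ to _*ᵏ_)
  field
    τ       : ℚ⟨e⟩ → Carrier
    τ-cong  : ∀ φ ψ → φ ≃ ψ → τ φ ≋ τ ψ
    τ-con   : ∀ q → τ (fromℚ q) ≋ ι q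
    τ-+     : ∀ φ ψ → τ (φ +ᶠ ψ) ≋ τ φ +ᵏ τ ψ
    τ-*     : ∀ φ ψ → τ (φ *ᶠ ψ) ≋ τ φ *ᵏ τ ψ
    η       : ℚ[e] → Carrier
    η-τ     : ∀ P → η P ≋ τ (polynomial P)
    ratio   : ℕ → Carrier
    ratio-τ : ∀ s → ratio s ≋ τ (e-ratio s (s ∸ 1))

  η-cong : ∀ P R → ⟦ P ⟧ ≈ ⟦ R ⟧ → η P ≋ η R
  η-cong P R P≈R = trans (η-τ P) (trans (τ-cong (polynomial P) (polynomial R) (polynomial-cong P R P≈R))
    (sym (η-τ R)))

  η-con : ∀ q → η (con q) ≋ ι q
  η-con q = trans (η-τ (con q)) (τ-con q)

  η-0 : η (con 0ℚ) ≋ 0#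
  η-0 = trans (η-con 0ℚ) ι-0

  η-1 : η (con 1ℚ) ≋ 1#
  η-1 = trans (η-con 1ℚ) ι-1

  η-⊞ : ∀ P R → η (P ⊞ R) ≋ η P +ᵏ η R
  η-⊞ P R = trans (η-τ (P ⊞ R)) (trans (τ-cong (polynomial (P ⊞ R)) (polynomial P +ᶠ polynomial R) (polynomial-⊞ P R))
    (trans (τ-+ (polynomial P) (polynomial R)) (+-cong (sym (η-τ P)) (sym (η-τ R)))))

  η-⊠ : ∀ P R → η (P ⊠ R) ≋ η P *ᵏ η R
  η-⊠ P R = trans (η-τ (P ⊠ R)) (trans (τ-cong (polynomial (P ⊠ R)) (polynomial P *ᶠ polynomial R) (polynomial-⊠ P R))
    (trans (τ-* (polynomial P) (polynomial R)) (*-cong (sym (η-τ P)) (sym (η-τ R)))))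

  ratio-gen : ∀ i → ratio (suc i) *ᵏ η (gen i) ≋ η (gen (suc i))
  ratio-gen i = trans (*-cong (ratio-τ (suc i)) (η-τ (gen i)))
    (trans (sym (τ-* (e-ratio (suc i) i) (polynomial (gen i))))
    (trans (τ-cong (e-ratio (suc i) i *ᶠ polynomial (gen i)) (polynomial (gen (suc i))) (e-ratio-gen i))
      (sym (η-τ (gen (suc i))))))

-- One polynomial for both evaluations of a word

module Representation (K : ℚ-Algebra) (evaluation : Evaluation K) where
  open ℚ-Algebra K
  open Evaluation evaluation
  open Sums.Solver K using () renaming (solve to solveᵏ; _:=_ to _:=ᵏ_; _:*_ to _:*ᵏ_; :-_ to :-ᵏ_; con to conᵏ)
  open Bump K

  η-⊟ : ∀ P R → η (P ⊟ R) ≋ η P - η R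
  η-⊟ P R = trans (η-⊞ P (con (ℚ.- 1ℚ) ⊠ R)) (+-congˡ (trans (η-⊠ (con (ℚ.- 1ℚ)) R)
    (trans (*-congʳ (η-con (ℚ.- 1ℚ))) (solveᵏ 1 (λ x → conᵏ (ℚ.- 1ℚ) :*ᵏ x :=ᵏ :-ᵏ x) refl (η R)))))

  newtonᵏ : Newton K
  newtonᵏ = record
    { ε = λ i → η (gen i)
    ; u = λ i j → η (u-poly i j)
    ; ε-0 = trans (η-cong (gen 0) (con 1ℚ) e-0) η-1
    ; u-0 = λ i → trans (η-⊠ (con (fromℕ (suc i))) (gen (suc i))) (*-congʳ (η-con (fromℕ (suc i))))
    ; u-suc = λ i j → trans (η-⊟ (gen (suc i) ⊠ u-poly 1 j) (u-poly (suc (suc i)) j))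
      (+-congʳ (η-⊠ (gen (suc i)) (u-poly 1 j)))
    }

  ratiosᵏ : Ratios newtonᵏ
  ratiosᵏ = record { w = ratio ; w-ε = ratio-gen }

  open Operators K ratio public
  open PowerVectors K newtonᵏ ratiosᵏ public using (Φ; Φ-D*)

  value : Word k → Functional k
  value end        σ = 1#
  value (mark w)     = M* (value w)
  value (unmark w)   = D* (value w)

  -- The same P has to serve every l, since the coefficient at an exponent list will be read off
  -- with as many variables as the list is long.
  Represents : Carrier → (ℕ → Series) → Set
  Represents φ F = Σ ℚ[e] λ P → η P ≋ φ × (∀ l → ⟦ P ⟧ ≈⟨ l ⟩ F l)

  represents-bump : ∀ m (α : Vec ℕ k) {F : Vec ℕ k → Carrier} {G : ∀ l → Vec ℕ k → Series} →
    (∀ γ → Represents (F γ) (λ l → G l γ)) →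
    Represents (bump m α F) (λ l → Bump.bump seriesAlgebra m α (G l))
  represents-bump m []      r = con 0ℚ , η-0 , (λ l α _ → ≡.refl)
  represents-bump m (q ∷ α) {F} {G} r with r (suc (q ℕ.+ m) ∷ α) | represents-bump m α {F ∘ (q ∷_)} {λ l → G l ∘
    (q ∷_)} (r ∘ (q ∷_))
  ... | P , P≃ , P≈ | R , R≃ , R≈ = P ⊞ R , trans (η-⊞ P R) (+-cong P≃ R≃) , λ l β p → ≡.cong₂ ℚ._+_ (P≈ l β p)
       (R≈ l β p)

  represents-unmark : ∀ (w : Word k) (γ : Vec ℕ k) m →
    Represents (Φ γ (value w)) (λ l → 𝒞.S l γ (valueᶜ l w)) →
    Represents (bump m γ (λ γ → Φ γ (value w))) (λ l → Bump.bump seriesAlgebra m γ (λ γ → 𝒞.S l γ (valueᶜ l w))) →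
    Represents (Φ (γ ∷ʳ m) (D* (value w))) (λ l → 𝒞.S l (γ ∷ʳ m) (𝒞.forgetᶜ l (valueᶜ l w)))
  represents-unmark w γ m (P , P≃ , P≈) (R , R≃ , R≈) = u-poly 1 m ⊠ P ⊟ R
    , trans (η-⊟ (u-poly 1 m ⊠ P) R) (trans (+-cong (trans (η-⊠ (u-poly 1 m) P) (*-congˡ P≃)) (-‿cong R≃))
        (sym (Φ-D* _ γ m (value w) ℕ.≤-refl)))
    , λ l β p → ≡.trans (⟦⊟⟧ (u-poly 1 m ⊠ P) R β)
        (≡.trans (≡.cong₂ ℚ._-_ (⊗-cong-≈⟨⟩ l (power-sum-poly l m) (P≈ l) β p) (R≈ l β p))
          (≡.sym (𝒞.S-forget l γ m (valueᶜ l w) β)))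

  -- All α are treated at once because unmarking leads to bumped vectors. Marking prepends 0 by
  -- definition of both `Φ` and `S`; unmarking matches `Φ-D*` with `S-forget`.
  represents : (w : Word k) (α : Vec ℕ k) → Represents (Φ α (value w)) (λ l → 𝒞.S l α (valueᶜ l w))
  represents end        []      = con 1ℚ , η-1 , (λ _ _ _ → ≡.refl)
  represents (mark w)   α       = represents w (0 ∷ α)
  represents (unmark w) = ∷ʳ-elim _ λ γ m → represents-unmark w γ m (represents w γ)
    (represents-bump m γ (represents w))

-- Coefficients of colour sums count proper colourings

module Colourings where
  open ≡
  open ListMembership using () renaming (_∈_ to _∈ˡ_; _∉_ to _∉ˡ_)

  forgetWord : ∀ d → Word (k ∸ d) → Word k
  forgetWord             zero    w = w
  forgetWord {k = zero}  (suc d) w = w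
  forgetWord {k = suc k} (suc d) w = unmark (forgetWord d w)

  forgetAllWord : Word k
  forgetAllWord {k = zero}  = end
  forgetAllWord {k = suc k} = unmark forgetAllWord

  buildWord : ∀ {s} m → (Fin m → ℕ) → Word s
  buildWord         zero    r = forgetAllWord
  buildWord {s = s} (suc m) r = forgetWord (s ∸ r zero) (mark (buildWord m (r ∘ suc)))

  -- Enough vertices are marked at every step for s ∸ (s ∸ r) = r to hold; each step leaves r + 1 of
  -- them.
  Admissible : ℕ → ∀ m → (Fin m → ℕ) → Set
  Admissible s zero    r = ⊤
  Admissible s (suc m) r = r zero ≤ s × Admissible (suc (r zero)) m (r ∘ suc)

  keep : {X : Set} → ∀ d → Vec X k → Vec X (k ∸ d)
  keep             zero    c = c
  keep {k = zero}  (suc d) c = c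
  keep {k = suc k} (suc d) c = keep d (init c)

  take-++-length : ∀ {X : Set} j (xs ys : List X) → j ≤ length xs → take j (xs List.++ ys) ≡ take j xs
  take-++-length zero    xs       ys p       = refl
  take-++-length (suc j) (x ∷ xs) ys (s≤s p) = cong (x ∷_) (take-++-length j xs ys p)

  toList-keep : ∀ {X : Set} d (c : Vec X k) → toList (keep d c) ≡ take (k ∸ d) (toList c)
  toList-keep             zero    c = sym (List.take-all _ (toList c) (ℕ.≤-reflexive (length-toList c)))
  toList-keep {k = zero}  (suc d) [] = refl
  toList-keep {k = suc k} (suc d) c with initLast c
  ... | c′ , z , refl = trans (toList-keep d c′) (sym (trans (cong (take (k ∸ d)) (toList-∷ʳ z c′))
    (take-++-length (k ∸ d) (toList c′) (z ∷ []) (ℕ.≤-trans (ℕ.m∸n≤m k d) (ℕ.≤-reflexive (sym (length-toList c′)))))))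

  module _ (l : ℕ) where
    open 𝒞 l
    open Sums seriesAlgebra using (∑; ∑-cong)

    new-list : Fin l → List (Fin l) → Series
    new-list y []      = const 1ℚ
    new-list y (z ∷ h) = distinct y z ⊗ new-list y h

    new-toList : ∀ y (c : Vec (Fin l) k) → new y c ≡ new-list y (toList c)
    new-toList y []      = refl
    new-toList y (z ∷ c) = cong (distinct y z ⊗_) (new-toList y c)

    -- Here h is the whole history of colours, newest first, so that forgetting vertices becomes a
    -- `take`.
    colour-sum : ∀ m → (Fin m → ℕ) → List (Fin l) → Series
    colour-sum zero    r h = const 1ℚ
    colour-sum (suc m) r h = ∑ (allFin l) λ y → (new-list y (take (r zero) h) ⊗ var y) ⊗ colour-sum m (r ∘ suc)
      (y ∷ h)

    valueᶜ-forgetWord : ∀ d (w : Word (k ∸ d)) c → valueᶜ l (forgetWord d w) c ≡ valueᶜ l w (keep d c)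
    valueᶜ-forgetWord             zero    w c = refl
    valueᶜ-forgetWord {k = zero}  (suc d) w c = refl
    valueᶜ-forgetWord {k = suc k} (suc d) w c = valueᶜ-forgetWord d w (init c)

    valueᶜ-forgetAllWord : ∀ (c : Vec (Fin l) k) → valueᶜ l forgetAllWord c ≡ const 1ℚ
    valueᶜ-forgetAllWord {k = zero}  c = refl
    valueᶜ-forgetAllWord {k = suc k} c = valueᶜ-forgetAllWord (init c)

    take-take : ∀ {X : Set} {i j} (xs : List X) → i ≤ j → take i (take j xs) ≡ take i xs
    take-take {i = zero}          xs       p       = refl
    take-take {i = suc i} {suc j} []       p       = refl
    take-take {i = suc i} {suc j} (x ∷ xs) (s≤s p) = cong (x ∷_) (take-take xs p)

    -- Invariant: the s marked colours are the s newest of the history. A forgotten colour is never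
    -- asked for again, since each r is at most the current s.
    valueᶜ-buildWord : ∀ {s} m r (c : Vec (Fin l) s) h → toList c ≡ take s h → Admissible s m r →
                       valueᶜ l (buildWord m r) c ≈ colour-sum m r h
    valueᶜ-buildWord         zero    r c h eq _ = λ α → cong (λ F → F α) (valueᶜ-forgetAllWord c)
    valueᶜ-buildWord {s = s} (suc m) r c h eq (r≤s , adm) = ≈-trans
      {valueᶜ l (buildWord (suc m) r) c} {grow 0 (valueᶜ l (buildWord m (r ∘ suc))) c′} {colour-sum (suc m) r h}
      (λ α → cong (λ F → F α) (valueᶜ-forgetWord (s ∸ r zero) (mark (buildWord m (r ∘ suc))) c))
      (∑-cong (allFin l) λ y → ⊗-cong
        {new y c′ ⊗ var y} {new-list y (take (r zero) h) ⊗ var y} {valueᶜ l (buildWord m (r ∘ suc))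
          (y ∷ c′)} {colour-sum m (r ∘ suc) (y ∷ h)}
        (λ α → cong (λ F → (F ⊗ var y) α) (trans (new-toList y c′) (cong (new-list y) eq′)))
        (valueᶜ-buildWord m (r ∘ suc) (y ∷ c′) (y ∷ h)
          (cong (y ∷_) (trans eq′ (cong (λ j → take j h) (sym s∸[s∸r]≡r))))
          (subst (λ j → Admissible (suc j) m (r ∘ suc)) (sym s∸[s∸r]≡r) adm)))
      where
      c′ = keep (s ∸ r zero) c
      s∸[s∸r]≡r : s ∸ (s ∸ r zero) ≡ r zero
      s∸[s∸r]≡r = ℕ.m∸[m∸n]≡n r≤s
      eq′ : toList c′ ≡ take (r zero) h
      eq′ = trans (toList-keep (s ∸ r zero) c) (trans (cong₂ take s∸[s∸r]≡r eq) (take-take h r≤s))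

    -- Division of the monomial by x_c, with `nothing` if x_c does not divide it.
    decrement : ∀ {l} → Fin l → List ℕ → Maybe (List ℕ)
    decrement c       []           = nothing
    decrement zero    (zero ∷ α)   = nothing
    decrement zero    (suc m ∷ α)  = just (m ∷ α)
    decrement (suc c) (m ∷ α)      = maybe (λ β → just (m ∷ β)) nothing (decrement c α)

    var-⊗ : ∀ {l} (c : Fin l) F α → length α ≡ l → (var c ⊗ F) α ≡ maybe F 0ℚ (decrement c α)
    var-⊗ zero    F (zero ∷ α)  p = var₀-⊗ F zero α
    var-⊗ zero    F (suc m ∷ α) p = var₀-⊗ F (suc m) α
    var-⊗ (suc c) F (m ∷ α)     p = trans (lift-⊗ (var c) F m α)
      (trans (var-⊗ c (slice F m) α (ℕ.suc-injective p)) (unmaybe (decrement c α)))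
      where
      unmaybe : ∀ x → maybe (slice F m) 0ℚ x ≡ maybe F 0ℚ (maybe (λ β → just (m ∷ β)) nothing x)
      unmaybe nothing  = refl
      unmaybe (just β) = refl

    increment : ∀ {l} → Fin l → List ℕ → List ℕ
    increment c       []      = []
    increment zero    (m ∷ α) = suc m ∷ α
    increment (suc c) (m ∷ α) = m ∷ increment c α

    decrement-increment : ∀ {l} (c : Fin l) α → length α ≡ l → decrement c (increment c α) ≡ just α
    decrement-increment zero    (m ∷ α) p = refl
    decrement-increment (suc c) (m ∷ α) p = cong (maybe (λ β → just (m ∷ β)) nothing)
      (decrement-increment c α (ℕ.suc-injective p))

    increment-decrement : ∀ {l} (c : Fin l) α {β} → decrement c α ≡ just β → increment c β ≡ α
    increment-decrement zero    (suc m ∷ α) refl = refl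
    increment-decrement (suc c) (m ∷ α) eq with decrement c α in eq′
    increment-decrement (suc c) (m ∷ α) refl | just β = cong (m ∷_) (increment-decrement c α eq′)

    tabulate-increment : ∀ {j} (f g : Fin j → ℕ) i → f i ≡ suc (g i) → (∀ c → c ≢ i → f c ≡ g c) →
                         List.tabulate f ≡ increment i (List.tabulate g)
    tabulate-increment f g zero    same other = cong₂ _∷_ same (List.tabulate-cong λ c → other (suc c) λ ())
    tabulate-increment f g (suc i) same other = cong₂ _∷_ (other zero λ ())
      (tabulate-increment (f ∘ suc) (g ∘ suc) i same λ c c≢i → other (suc c) (c≢i ∘ Fin.suc-injective))

    content-∷ : ∀ {l} (y : Fin l) (κ : Vec (Fin l) m) → content (y ∷ κ) ≡ increment y (content κ)
    content-∷ {l = l} y κ = tabulate-increment _ _ y same other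
      where
      same : Vec.count (Fin._≟ y) (y ∷ κ) ≡ suc (Vec.count (Fin._≟ y) κ)
      same with y Fin.≟ y
      ... | yes _ = refl
      ... | no ¬p = contradiction refl ¬p
      other : ∀ c → c ≢ y → Vec.count (Fin._≟ c) (y ∷ κ) ≡ Vec.count (Fin._≟ c) κ
      other c c≢y with y Fin.≟ c
      ... | yes p = contradiction (sym p) c≢y
      ... | no _  = refl

    length-content : ∀ {l} (κ : Vec (Fin l) m) → length (content κ) ≡ l
    length-content κ = List.length-tabulate _

    content-∷⇒ : ∀ {l} (y : Fin l) (κ : Vec (Fin l) m) {α} → content (y ∷ κ) ≡ α → decrement y α ≡ just (content κ)
    content-∷⇒ y κ {α} eq = trans (cong (decrement y) (trans (sym eq) (content-∷ y κ)))
      (decrement-increment y (content κ) (length-content κ))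

    content-∷⇐ : ∀ {l} (y : Fin l) (κ : Vec (Fin l) m) {α β} → decrement y α ≡ just β → content κ ≡ β →
      content (y ∷ κ) ≡ α
    content-∷⇐ y κ {α} eq refl = trans (content-∷ y κ) (increment-decrement y α eq)

    open DecMembership (Fin._≟_ {l}) using () renaming (_∈?_ to _∈ˡ?_)

    -- Follows the recursion of `colour-sum`; the positional form `Separated` is the one to compare
    -- with edges.
    Sequential : ∀ m → (Fin m → ℕ) → List (Fin l) → Vec (Fin l) m → Set
    Sequential zero    r h []      = ⊤
    Sequential (suc m) r h (y ∷ κ) = y ∉ˡ take (r zero) h × Sequential m (r ∘ suc) (y ∷ h) κ

    sequential? : ∀ m r h (κ : Vec (Fin l) m) → Dec (Sequential m r h κ)
    sequential? zero    r h []      = yes tt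
    sequential? (suc m) r h (y ∷ κ) = ¬? (y ∈ˡ? take (r zero) h) ×-dec sequential? m (r ∘ suc) (y ∷ h) κ

    counted : ∀ m r h (α : List ℕ) (κ : Vec (Fin l) m) → Dec (Sequential m r h κ × content κ ≡ α)
    counted m r h α κ = sequential? m r h κ ×-dec List.≡-dec ℕ._≟_ (content κ) α

    number : {X : Set} {P : X → Set} → Decidable P → List X → ℚ
    number P? xs = fromℕ (length (filter P? xs))

    number-++ : {X : Set} {P : X → Set} (P? : Decidable P) (xs ys : List X) →
                number P? (xs List.++ ys) ≡ number P? xs ℚ.+ number P? ys
    number-++ P? xs ys = trans (cong (λ zs → fromℕ (length zs)) (List.filter-++ P? xs ys))
      (trans (cong fromℕ (List.length-++ (filter P? xs)))
        (fromℤ-+ (+ length (filter P? xs)) (+ length (filter P? ys))))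

    number-map : {X Y : Set} {P : Y → Set} (P? : Decidable P) (f : X → Y) (xs : List X) →
                 number P? (List.map f xs) ≡ number (P? ∘ f) xs
    number-map P? f []       = refl
    number-map P? f (x ∷ xs) with does (P? (f x))
    ... | true  = cong (λ j → fromℕ (suc j)) (natural f xs)
      where
      natural : ∀ f xs → length (filter P? (List.map f xs)) ≡ length (filter (P? ∘ f) xs)
      natural f []       = refl
      natural f (x ∷ xs) with does (P? (f x))
      ... | true  = cong suc (natural f xs)
      ... | false = natural f xs
    ... | false = number-map P? f xs

    number-cong : {X : Set} {P Q : X → Set} (P? : Decidable P) (Q? : Decidable Q) →
                  (∀ x → P x → Q x) → (∀ x → Q x → P x) → ∀ xs → number P? xs ≡ number Q? xs
    number-cong P? Q? P⇒Q Q⇒P xs = cong (λ zs → fromℕ (length zs))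
      (List.filter-≐ P? Q? ((λ {x} → P⇒Q x) , (λ {x} → Q⇒P x)) xs)

    number-none : {X : Set} {P : X → Set} (P? : Decidable P) → (∀ x → ¬ P x) → ∀ xs → number P? xs ≡ 0ℚ
    number-none P? ¬P []       = refl
    number-none P? ¬P (x ∷ xs) with P? x
    ... | yes p = contradiction p (¬P x)
    ... | no _  = number-none P? ¬P xs

    number-product : ∀ {P : Vec (Fin l) (suc m) → Set} (P? : Decidable P) (G : Fin l → Series) κs α →
      (∀ y → G y α ≡ number (P? ∘ (y ∷_)) κs) → ∀ {j} (g : Fin j → Fin l) →
      ∑ (Vec.tabulate g) G α ≡ number P? (cartesianProductWith _∷_ (List.tabulate g) κs)
    number-product P? G κs α eq {zero}  g = const-0 α
    number-product P? G κs α eq {suc j} g = trans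
      (cong₂ ℚ._+_ (trans (eq (g zero)) (sym (number-map P? (g zero ∷_) κs))) (number-product P? G κs α eq (g ∘ suc)))
      (sym (number-++ P? (List.map (g zero ∷_) κs) _))

    new-list-∈ : ∀ y h → y ∈ˡ h → new-list y h ≈ const 0ℚ
    new-list-∈ y (z ∷ h) (here refl) with y Fin.≟ y
    ... | yes _ = λ α → trans (const-⊗ 0ℚ (new-list y h) α) (trans (ℚ.*-zeroˡ (new-list y h α)) (sym (const-0 α)))
    ... | no ¬p = contradiction refl ¬p
    new-list-∈ y (z ∷ h) (there y∈h) α = trans
      (⊗-cong {distinct y z} {distinct y z} (λ _ → refl) (new-list-∈ y h y∈h) α)
      (ℚ-Algebra.zeroʳ seriesAlgebra (distinct y z) α)

    new-list-∉ : ∀ y h → y ∉ˡ h → new-list y h ≈ const 1ℚ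
    new-list-∉ y []      y∉h = λ _ → refl
    new-list-∉ y (z ∷ h) y∉h with y Fin.≟ z
    ... | yes refl = contradiction (here refl) y∉h
    ... | no _     = λ α → trans (⊗-identityˡ (new-list y h) α) (new-list-∉ y h (y∉h ∘ there) α)

    -- Induction on the vertices: a first colour y among the r newest contributes 0 on both sides,
    -- and any other one divides the monomial by x_y.
    colour-sum-number : ∀ m r h α → length α ≡ l →
      colour-sum m r h α ≡ number (counted m r h α) (colourings m l)
    colour-sum-number zero r h α |α| with List.≡-dec ℕ._≟_ (content {l = l} []) α
    ... | yes refl = if-⇔ (All.all? (ℕ._≟ 0) α) (yes tt) _ (λ _ → all-zero l)
      where
      all-zero : ∀ j → All.All (_≡ 0) (List.tabulate {n = j} (λ _ → 0))
      all-zero zero    = []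
      all-zero (suc j) = refl ∷ all-zero j
    ... | no ¬p = if-⇔ (All.all? (ℕ._≟ 0) α) (no ¬p) (zeros l α |α|) (λ p → contradiction p ¬p)
      where
      zeros : ∀ j α → length α ≡ j → All.All (_≡ 0) α → List.tabulate {n = j} (λ _ → 0) ≡ α
      zeros zero    []      _ _             = refl
      zeros (suc j) (_ ∷ α) p (refl ∷ rest) = cong (0 ∷_) (zeros j α (ℕ.suc-injective p) rest)
    colour-sum-number (suc m) r h α |α| = number-product (counted (suc m) r h α)
      (λ y → (new-list y (take (r zero) h) ⊗ var y) ⊗ colour-sum m (r ∘ suc) (y ∷ h)) (colourings m l) α each id
      where
      each : ∀ y → ((new-list y (take (r zero) h) ⊗ var y) ⊗ colour-sum m (r ∘ suc) (y ∷ h)) α ≡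
                   number (counted (suc m) r h α ∘ (y ∷_)) (colourings m l)
      each y = by-membership (y ∈ˡ? take (r zero) h)
        where
        ν  = new-list y (take (r zero) h)
        CS = colour-sum m (r ∘ suc) (y ∷ h)
        P? = counted (suc m) r h α ∘ (y ∷_)
        by-decrement : y ∉ˡ take (r zero) h → ∀ d → decrement y α ≡ d → maybe CS 0ℚ d ≡ number P? (colourings m l)
        by-decrement y∉ nothing  eq = sym
          (number-none P? (λ κ (_ , cont) → nothing≢just (trans (sym eq) (content-∷⇒ y κ cont))) (colourings m l))
          where
          nothing≢just : ∀ {X : Set} {x : X} → ¬ (nothing ≡ just x)
          nothing≢just ()
        by-decrement y∉ (just β) eq = trans
          (colour-sum-number m (r ∘ suc) (y ∷ h) β |β|)
          (number-cong (counted m (r ∘ suc) (y ∷ h) β) P?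
            (λ κ (sq , cont) → (y∉ , sq) , content-∷⇐ y κ eq cont)
            (λ κ ((_ , sq) , cont) → sq , just-injective (trans (sym (content-∷⇒ y κ cont)) eq))
            (colourings m l))
          where
          length-increment : ∀ {l} (c : Fin l) α → length (increment c α) ≡ length α
          length-increment c       []      = refl
          length-increment zero    (m ∷ α) = refl
          length-increment (suc c) (m ∷ α) = cong suc (length-increment c α)
          |β| : length β ≡ l
          |β| = trans (sym (length-increment y β)) (trans (cong length (increment-decrement y α eq)) |α|)
        by-membership : Dec (y ∈ˡ take (r zero) h) → ((ν ⊗ var y) ⊗ CS) α ≡ number P? (colourings m l)
        by-membership (yes y∈) = trans
          (⊗-cong {ν ⊗ var y} {const 0ℚ} {CS} {CS}
            (λ β → trans (⊗-cong {ν} {const 0ℚ} {var y} {var y} (new-list-∈ y (take (r zero) h) y∈) (λ _ → refl) β)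
               (ℚ-Algebra.zeroˡ seriesAlgebra (var y) β))
            (λ _ → refl) α)
          (trans (trans (const-⊗ 0ℚ CS α) (ℚ.*-zeroˡ (CS α)))
            (sym (number-none P? (λ κ ((y∉ , _) , _) → y∉ y∈) (colourings m l))))
        by-membership (no y∉) = trans
          (⊗-cong {ν ⊗ var y} {var y} {CS} {CS}
            (λ β → trans (⊗-cong {ν} {const 1ℚ} {var y} {var y} (new-list-∉ y (take (r zero) h) y∉) (λ _ → refl) β)
               (⊗-identityˡ (var y) β))
            (λ _ → refl) α)
          (trans (var-⊗ y CS α |α|) (by-decrement y∉ (decrement y α) refl))

    Separated : ∀ m → (Fin m → ℕ) → Vec (Fin l) m → Set
    Separated m r κ = ∀ u v → toℕ u < toℕ v → toℕ v ≤ toℕ u ℕ.+ r v → lookup κ u ≢ lookup κ v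

    -- Of the r v vertices before v, the v nearest are coloured by κ itself, and the remaining r v ∸
    -- v reach back into the history h.
    SeparatedFrom : ∀ m → (Fin m → ℕ) → List (Fin l) → Vec (Fin l) m → Set
    SeparatedFrom m r h κ = ∀ v → lookup κ v ∉ˡ take (r v ∸ toℕ v) h

    sequential⇒separated : ∀ m r h κ → Sequential m r h κ → Separated m r κ × SeparatedFrom m r h κ
    sequential⇒separated zero    r h []      _ = (λ ()) , λ ()
    sequential⇒separated (suc m) r h (y ∷ κ) (y∉ , sq) with sequential⇒separated m (r ∘ suc) (y ∷ h) κ sq
    ... | sep , from = sep′ , from′
      where
      take-suc : ∀ R v → suc v ≤ R → R ∸ v ≡ suc (R ∸ suc v)
      take-suc (suc R) zero    p       = refl
      take-suc (suc R) (suc v) (s≤s p) = take-suc R v p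
      sep′ : Separated (suc m) r (y ∷ κ)
      sep′ zero    (suc v) _         v≤ eq = from v
        (subst (λ j → lookup κ v ∈ˡ take j (y ∷ h)) (sym (take-suc (r (suc v)) (toℕ v) v≤)) (here (sym eq)))
      sep′ (suc u) (suc v) (s≤s u<v) (s≤s v≤) = sep u v u<v v≤
      from′ : SeparatedFrom (suc m) r h (y ∷ κ)
      from′ zero    = y∉
      from′ (suc v) y∈ with suc (toℕ v) ℕ.≤? r (suc v)
      ... | yes p = from v (subst (λ j → lookup κ v ∈ˡ take j (y ∷ h)) (sym (take-suc (r (suc v)) (toℕ v) p))
           (there y∈))
      ... | no ¬p with r (suc v) ∸ suc (toℕ v) | ℕ.m≤n⇒m∸n≡0 (ℕ.≤-trans (ℕ.s≤s⁻¹ (ℕ.≰⇒> ¬p)) (ℕ.n≤1+n (toℕ v)))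
      from′ (suc v) () | no ¬p | _ | refl

    separated⇒sequential : ∀ m r h κ → Separated m r κ → SeparatedFrom m r h κ → Sequential m r h κ
    separated⇒sequential zero    r h []      sep from = tt
    separated⇒sequential (suc m) r h (y ∷ κ) sep from = from zero ,
      separated⇒sequential m (r ∘ suc) (y ∷ h) κ (λ u v u<v v≤ → sep (suc u) (suc v) (s≤s u<v) (s≤s v≤)) from′
      where
      from′ : SeparatedFrom m (r ∘ suc) (y ∷ h) κ
      from′ v κv∈ with r (suc v) ∸ toℕ v in eq
      from′ v (here κv≡y)  | suc j = sep zero (suc v) (s≤s z≤n)
        (ℕ.≰⇒> λ R≤v → case-zero (trans (sym eq) (ℕ.m≤n⇒m∸n≡0 R≤v))) (sym κv≡y)
        where
        case-zero : ¬ (suc j ≡ 0)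
        case-zero ()
      from′ v (there κv∈) | suc j = from (suc v)
        (subst (λ i → lookup κ v ∈ˡ take i h) (pred-∸ (r (suc v)) (toℕ v) eq) κv∈)
        where
        pred-∸ : ∀ R v {j} → R ∸ v ≡ suc j → j ≡ R ∸ suc v
        pred-∸ (suc R) zero    refl = refl
        pred-∸ (suc R) (suc v) eq   = pred-∸ R v eq

  module _ {n : ℕ} (G : Graph n) (nui : NaturalUnitInterval G) where
    open Graph G

    degree : Fin n → ℕ
    degree v = length (smallerNeighbours G v)

    -- An up-closed set of numbers below v is the interval of its c largest elements.
    count-interval : ∀ {n j} {P : Fin j → Set} (P? : Decidable P) (g : Fin n → Fin j) v → v ≤ n →
      (∀ u → P (g u) → toℕ u < v) → (∀ u u′ → P (g u) → toℕ u ≤ toℕ u′ → toℕ u′ < v → P (g u′)) →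
      let c = length (filter P? (List.tabulate g)) in
      c ≤ v × (∀ u → P (g u) → v ≤ toℕ u ℕ.+ c) × (∀ u → toℕ u < v → v ≤ toℕ u ℕ.+ c → P (g u))
    count-interval {zero}  P? g v       v≤n       below up = z≤n , (λ ()) , λ ()
    count-interval {suc n} P? g zero    v≤n       below up with P? (g zero)
    ... | yes p = contradiction (below zero p) λ ()
    ... | no ¬p with count-interval P? (g ∘ suc) zero z≤n
         (λ u p → contradiction (below (suc u) p) λ ()) (λ _ _ _ _ ())
    ... | c≤0 , _ , _ = c≤0 , (λ u p → contradiction (below u p) λ ()) , λ _ ()
    count-interval {suc n} {P = P} P? g (suc v) (s≤s v≤n) below up
      with count-interval P? (g ∘ suc) v v≤n (λ u p → ℕ.s≤s⁻¹ (below (suc u) p))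
             (λ u u′ p u≤u′ u′<v → up (suc u) (suc u′) p (s≤s u≤u′) (s≤s u′<v)) | P? (g zero)
    ... | c≤v , lower , member | yes p = s≤s c≤v ,
      (λ u _ → ℕ.≤-trans (s≤s (all-members v v≤n lower λ u u<v → up zero (suc u) p z≤n (s≤s u<v)))
        (ℕ.m≤n+m _ (toℕ u))) , λ u u<v _ → up zero u p z≤n u<v
      where
      all-members : ∀ {n c} {P : Fin n → Set} v → v ≤ n → (∀ u → P u → v ≤ toℕ u ℕ.+ c) →
        (∀ u → toℕ u < v → P u) → v ≤ c
      all-members zero    _       _     _   = z≤n
      all-members (suc v) (s≤s _) lower all = lower zero (all zero (s≤s z≤n))
    ... | c≤v , lower , member | no ¬p = ℕ.m≤n⇒m≤1+n c≤v , lower′ , member′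
      where
      c = length (filter P? (List.tabulate (g ∘ suc)))
      lower′ : ∀ u → P (g u) → suc v ≤ toℕ u ℕ.+ c
      lower′ zero    p = contradiction p ¬p
      lower′ (suc u) p = s≤s (lower u p)
      member′ : ∀ u → toℕ u < suc v → suc v ≤ toℕ u ℕ.+ c → P (g u)
      member′ zero    _         v<c      = contradiction c≤v (ℕ.<⇒≱ v<c)
      member′ (suc u) (s≤s u<v) (s≤s v≤) = member u u<v v≤

    -- The unit interval property makes the smaller neighbours of v up-closed below v, so their
    -- number determines them.
    smaller-neighbours : ∀ v → let r = degree v in
      r ≤ toℕ v × (∀ u → toℕ u < toℕ v → u ~ v → toℕ v ≤ toℕ u ℕ.+ r) ×
        (∀ u → toℕ u < toℕ v → toℕ v ≤ toℕ u ℕ.+ r → u ~ v)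
    smaller-neighbours v with count-interval (λ u → (u Fin.<? v) ×-dec (u ~? v)) id (toℕ v)
      (ℕ.<⇒≤ (Fin.toℕ<n v)) (λ _ → proj₁) up
      where
      up : ∀ u u′ → u Fin.< v × u ~ v → toℕ u ≤ toℕ u′ → toℕ u′ < toℕ v → u′ Fin.< v × u′ ~ v
      up u u′ (u<v , u~v) u≤u′ u′<v with ℕ.m≤n⇒m<n∨m≡n u≤u′
      ... | inj₁ u<u′ = u′<v , proj₂ (nui u~v u<v u′ u<u′ u′<v)
      ... | inj₂ u≡u′ = u′<v , subst (_~ v) (Fin.toℕ-injective u≡u′) u~v
    ... | r≤v , lower , member = r≤v , (λ u u<v u~v → lower u (u<v , u~v)) , λ u u<v v≤ → proj₂ (member u u<v v≤)

    -- If v has c + 1 smaller neighbours, the smallest is t = u - c. For c > 0, t < u < v and the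
    -- unit interval property gives t ~ u, so u has at least c smaller neighbours.
    degree-step : ∀ u v → toℕ v ≡ suc (toℕ u) → degree v ≤ suc (degree u)
    degree-step u v v≡1+u = bound (degree v) refl
      where
      bound : ∀ r → degree v ≡ r → r ≤ suc (degree u)
      bound zero    _   = z≤n
      bound (suc c) r≡ with ℕ.m≤n⇒m<n∨m≡n (ℕ.m∸n≤m (toℕ u) c)
      ... | inj₂ u∸c≡u = s≤s (ℕ.≤-trans (ℕ.≤-reflexive c≡0) z≤n)
        where
        c≤u : c ≤ toℕ u
        c≤u = ℕ.s≤s⁻¹ (subst₂ _≤_ r≡ v≡1+u (proj₁ (smaller-neighbours v)))
        c≡0 : c ≡ 0
        c≡0 = ℕ.+-cancelˡ-≡ (toℕ u) c 0
          (trans (cong (ℕ._+ c) (sym u∸c≡u)) (trans (ℕ.m∸n+n≡m c≤u) (sym (ℕ.+-identityʳ (toℕ u)))))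
      ... | inj₁ u∸c<u = s≤s (ℕ.+-cancelˡ-≤ (toℕ u ∸ c) c (degree u)
              (ℕ.≤-trans (ℕ.≤-reflexive (ℕ.m∸n+n≡m c≤u))
                (subst (λ t → toℕ u ≤ t ℕ.+ degree u) toℕ-t (proj₁ (proj₂ (smaller-neighbours u)) t t<u t~u))))
        where
        c≤u : c ≤ toℕ u
        c≤u = ℕ.s≤s⁻¹ (subst₂ _≤_ r≡ v≡1+u (proj₁ (smaller-neighbours v)))
        t : Fin n
        t = Fin.fromℕ< (ℕ.<-trans u∸c<u (Fin.toℕ<n u))
        toℕ-t : toℕ t ≡ toℕ u ∸ c
        toℕ-t = Fin.toℕ-fromℕ< _
        t<u : toℕ t < toℕ u
        t<u = subst (_< toℕ u) (sym toℕ-t) u∸c<u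
        u<v : toℕ u < toℕ v
        u<v = ℕ.≤-reflexive (sym v≡1+u)
        t~v : t ~ v
        t~v = proj₂ (proj₂ (smaller-neighbours v)) t (ℕ.<-trans t<u u<v)
          (ℕ.≤-reflexive (trans v≡1+u (sym
            (trans (cong₂ ℕ._+_ toℕ-t r≡) (trans (ℕ.+-suc (toℕ u ∸ c) c) (cong suc (ℕ.m∸n+n≡m c≤u)))))))
        t~u : t ~ u
        t~u = proj₁ (nui t~v (ℕ.<-trans t<u u<v) u t<u u<v)

    -- By `degree-step`, the degree + 1 vertices marked after one step suffice for the next.
    admissible : Admissible 0 n degree
    admissible = go n id (λ v v≡0 → subst (degree v ≤_) v≡0 (proj₁ (smaller-neighbours v))) (λ _ _ eq → eq)
      where
      go : ∀ m {s} (g : Fin m → Fin n) → (∀ v → toℕ v ≡ 0 → degree (g v) ≤ s) →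
           (∀ u v → toℕ v ≡ suc (toℕ u) → toℕ (g v) ≡ suc (toℕ (g u))) → Admissible s m (degree ∘ g)
      go zero    g first step = tt
      go (suc m) g first step = first zero refl ,
        go m (g ∘ suc) (λ v v≡0 → degree-step (g zero) (g (suc v)) (step zero (suc v) (cong suc v≡0)))
          (λ u v eq → step (suc u) (suc v) (cong suc eq))

    separated⇒proper : ∀ {l} (κ : Vec (Fin l) n) → Separated l n degree κ → Proper G κ
    separated⇒proper κ sep u v u~v with ℕ.<-cmp (toℕ u) (toℕ v)
    ... | tri< u<v _ _ = sep u v u<v (proj₁ (proj₂ (smaller-neighbours v)) u u<v u~v)
    ... | tri≈ _ u≡v _ = contradiction u~v (irrefl (Fin.toℕ-injective u≡v))
    ... | tri> _ _ v<u = sep v u v<u (proj₁ (proj₂ (smaller-neighbours u)) v v<u (symm u~v)) ∘ sym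

    proper⇒separated : ∀ {l} (κ : Vec (Fin l) n) → Proper G κ → Separated l n degree κ
    proper⇒separated κ proper u v u<v v≤ = proper u v (proj₂ (proj₂ (smaller-neighbours v)) u u<v v≤)

    X-value : ∀ l → X G ≈⟨ l ⟩ valueᶜ l (buildWord n degree) []
    X-value l α refl = sym (trans (valueᶜ-buildWord l n degree [] [] refl admissible α)
      (trans (colour-sum-number l n degree [] α refl)
        (number-cong l (counted l n degree [] α) (λ κ → proper? G κ ×-dec List.≡-dec ℕ._≟_ (content κ) α)
          (λ κ (sq , cont) → separated⇒proper κ (proj₁ (sequential⇒separated l n degree [] κ sq)) , cont)
          (λ κ (proper , cont) → separated⇒sequential l n degree [] κ (proper⇒separated κ proper)
            (λ v → ∉-take[] (degree v ∸ toℕ v)) , cont)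
          (colourings n l))))
      where
      ∉-take[] : ∀ {l} {y : Fin l} j → y ∉ˡ take j []
      ∉-take[] zero    ()
      ∉-take[] (suc j) ()

open Colourings

-- Positivity in the elementary symmetric functions

open Partition using (parts; positive; ordered)

fraction-nonNegative : ∀ m n → 0ℚ ℚ.≤ (+ m) ℚ./ suc n
fraction-nonNegative m n = ℚ.nonNegative⁻¹ _ {{ℚ.normalize-nonNeg m (suc n)}}

-- No integer lies strictly between -1 and 0, so d + 1 and d never have opposite signs.
β-nonNegative : ∀ d → 0ℚ ℚ.≤ β d
β-nonNegative (+ zero)  = ℚ.nonNegative⁻¹ 1ℚ
β-nonNegative +[1+ m ]  = ≡.subst (0ℚ ℚ.≤_) (÷-β +[1+ m ] λ ()) (fraction-nonNegative (suc m ℕ.+ 1) m)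
β-nonNegative -[1+ m ]  = ≡.subst (0ℚ ℚ.≤_)
  (≡.trans (≡.cong (ℚ._/ suc m) (neg m)) (÷-β -[1+ m ] λ ())) (fraction-nonNegative m m)
  where
  neg : ∀ m → + m ≡ ℤ.- (-[1+ m ] ℤ.+ + 1)
  neg zero    = ≡.refl
  neg (suc m) = ≡.refl

*-nonNegative : ∀ {p q} → 0ℚ ℚ.≤ p → 0ℚ ℚ.≤ q → 0ℚ ℚ.≤ p ℚ.* q
*-nonNegative {p} {q} 0≤p 0≤q = ≡.subst (ℚ._≤ p ℚ.* q) (ℚ.*-zeroʳ p)
  (ℚ.*-monoˡ-≤-nonNeg p {{ℚ.nonNegative 0≤p}} 0≤q)

weight-nonNegative : ∀ z (σ : Vec ℕ k) → 0ℚ ℚ.≤ weight z σ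
weight-nonNegative z []      = β-nonNegative (z ⊖ 0)
weight-nonNegative z (s ∷ σ) = *-nonNegative (β-nonNegative (z ⊖ s)) (weight-nonNegative z σ)

insert : ℕ → List ℕ → List ℕ
insert i []       = i ∷ []
insert i (j ∷ js) with j ℕ.≤? i
... | yes _ = i ∷ j ∷ js
... | no _  = j ∷ insert i js

insert-linked : ∀ i js → Linked _≥_ js → Linked _≥_ (insert i js)
insert-linked i []           _ = [-]
insert-linked i (j ∷ [])     _ with j ℕ.≤? i
... | yes j≤i = j≤i ∷ [-]
... | no j≰i  = ℕ.<⇒≤ (ℕ.≰⇒> j≰i) ∷ [-]
insert-linked i (j ∷ m ∷ js) (j≥m ∷ rest) with j ℕ.≤? i
... | yes j≤i = j≤i ∷ j≥m ∷ rest
... | no j≰i with m ℕ.≤? i | insert-linked i (m ∷ js) rest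
... | yes _ | linked = ℕ.<⇒≤ (ℕ.≰⇒> j≰i) ∷ linked
... | no _  | linked = j≥m ∷ linked

insert-positive : ∀ i js → NonZero i → All.All NonZero js → All.All NonZero (insert i js)
insert-positive i []       i≢0 _ = i≢0 ∷ []
insert-positive i (j ∷ js) i≢0 (j≢0 ∷ rest) with j ℕ.≤? i
... | yes _ = i≢0 ∷ j≢0 ∷ rest
... | no _  = j≢0 ∷ insert-positive i js i≢0 rest

insert-part : ℕ → Partition → Partition
insert-part zero    λ′ = λ′
insert-part (suc i) λ′ = record
  { parts = insert (suc i) (parts λ′)
  ; positive = insert-positive (suc i) (parts λ′) _ (positive λ′)
  ; ordered = insert-linked (suc i) (parts λ′) (ordered λ′)
  }

Terms : Set
Terms = List (ℚ × Partition)

product-poly : List ℕ → ℚ[e]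
product-poly = foldr (λ i P → gen i ⊠ P) (con 1ℚ)

combination-poly : Terms → ℚ[e]
combination-poly = foldr (λ (c , λ′) P → (con c ⊠ product-poly (parts λ′)) ⊞ P) (con 0ℚ)

⟦product-poly⟧ : ∀ is → ⟦ product-poly is ⟧ ≡ foldr _⊗_ (const 1ℚ) (List.map e is)
⟦product-poly⟧ []       = ≡.refl
⟦product-poly⟧ (i ∷ is) = ≡.cong (e i ⊗_) (⟦product-poly⟧ is)

⟦combination-poly⟧ : ∀ terms → ⟦ combination-poly terms ⟧ ≡ e-combination terms
⟦combination-poly⟧ []                 = ≡.refl
⟦combination-poly⟧ ((c , λ′) ∷ terms) = ≡.cong₂ (λ F H → (const c ⊗ F) ⊕ H)
  (⟦product-poly⟧ (parts λ′)) (⟦combination-poly⟧ terms)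

module Positivity (K : ℚ-Algebra) (evaluation : Evaluation K) where
  open ℚ-Algebra K
  open Evaluation evaluation
  open Representation K evaluation
  open Newton newtonᵏ using (ε; ε-0)
  open Sums K
  open Solver using (solve; _:=_; _:*_)

  Positive : Carrier → Set
  Positive x = Σ Terms λ terms → All.All (λ (c , _) → 0ℚ ℚ.≤ c) terms × η (combination-poly terms) ≋ x

  positive-cong : ∀ {x y} → x ≋ y → Positive x → Positive y
  positive-cong x≋y (terms , c≥0 , eq) = terms , c≥0 , trans eq x≋y

  positive-0 : Positive 0#
  positive-0 = [] , [] , η-0

  positive-1 : Positive 1#
  positive-1 = ((1ℚ , record { parts = [] ; positive = [] ; ordered = [] }) ∷ []) , (ℚ.nonNegative⁻¹ 1ℚ ∷ []) ,
    trans (η-⊞ (con 1ℚ ⊠ con 1ℚ) (con 0ℚ)) (trans (+-cong (trans (η-⊠ (con 1ℚ) (con 1ℚ)) (*-cong η-1 η-1)) η-0)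
      (trans (+-identityʳ _) (*-identityˡ 1#)))

  positive-+ : ∀ {x y} → Positive x → Positive y → Positive (x + y)
  positive-+ {y = y} (terms , c≥0 , eq) (terms′ , c′≥0 , eq′) = terms ++ terms′ , All.++⁺ c≥0 c′≥0 ,
    trans (join terms) (+-cong eq eq′)
    where
    join : ∀ terms → η (combination-poly (terms ++ terms′)) ≋ η (combination-poly terms) + η (combination-poly terms′)
    join []                 = trans (sym (+-identityˡ _)) (+-congʳ (sym η-0))
    join ((c , λ′) ∷ terms) = trans (η-⊞ t (combination-poly (terms ++ terms′)))
      (trans (+-congˡ (join terms)) (trans (sym (+-assoc _ _ _)) (+-congʳ (sym (η-⊞ t (combination-poly terms))))))
      where t = con c ⊠ product-poly (parts λ′)

  positive-• : ∀ {q x} → 0ℚ ℚ.≤ q → Positive x → Positive (q • x)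
  positive-• {q} 0≤q (terms , c≥0 , eq) = List.map scale terms , scaled c≥0 , trans (scale-η terms) (*-congˡ eq)
    where
    scale : ℚ × Partition → ℚ × Partition
    scale (c , λ′) = q ℚ.* c , λ′
    scaled : ∀ {terms} → All.All (λ (c , _) → 0ℚ ℚ.≤ c) terms → All.All (λ (c , _) → 0ℚ ℚ.≤ c) (List.map scale terms)
    scaled []             = []
    scaled (0≤c ∷ rest) = *-nonNegative 0≤q 0≤c ∷ scaled rest
    scale-η : ∀ terms → η (combination-poly (List.map scale terms)) ≋ q • η (combination-poly terms)
    scale-η []                 = trans η-0 (trans (sym (zeroʳ _)) (*-congˡ (sym η-0)))
    scale-η ((c , λ′) ∷ terms) = trans (η-⊞ (con (q ℚ.* c) ⊠ P) (combination-poly (List.map scale terms)))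
      (trans (+-cong (trans (η-⊠ (con (q ℚ.* c)) P)
        (trans (*-congʳ (trans (η-con (q ℚ.* c)) (ι-* q c)))
        (trans (*-assoc _ _ _) (*-congˡ (trans (*-congʳ (sym (η-con c))) (sym (η-⊠ (con c) P))))))) (scale-η terms))
        (trans (sym (distribˡ _ _ _)) (*-congˡ (sym (η-⊞ (con c ⊠ P) (combination-poly terms))))))
      where P = product-poly (parts λ′)

  product-insert : ∀ i js → η (product-poly (insert i js)) ≋ η (gen i) * η (product-poly js)
  product-insert i []       = η-⊠ (gen i) (con 1ℚ)
  product-insert i (j ∷ js) with j ℕ.≤? i
  ... | yes _ = η-⊠ (gen i) (product-poly (j ∷ js))
  ... | no _  = trans (η-⊠ (gen j) (product-poly (insert i js))) (trans (*-congˡ (product-insert i js))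
    (trans (x∙yz≈y∙xz _ _ _) (*-congˡ (sym (η-⊠ (gen j) (product-poly js))))))

  product-insert-part : ∀ i λ′ → η (product-poly (parts (insert-part i λ′))) ≋ η (gen i) * η (product-poly (parts λ′))
  product-insert-part zero    λ′ = trans (sym (*-identityˡ _)) (*-congʳ (sym ε-0))
  product-insert-part (suc i) λ′ = product-insert (suc i) (parts λ′)

  positive-gen : ∀ i {x} → Positive x → Positive (η (gen i) * x)
  positive-gen i (terms , c≥0 , eq) = List.map multiply terms , multiplied c≥0 , trans (multiply-η terms) (*-congˡ eq)
    where
    multiply : ℚ × Partition → ℚ × Partition
    multiply (c , λ′) = c , insert-part i λ′
    multiplied : ∀ {terms} → All.All (λ (c , _) → 0ℚ ℚ.≤ c) terms →
      All.All (λ (c , _) → 0ℚ ℚ.≤ c) (List.map multiply terms)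
    multiplied []           = []
    multiplied (0≤c ∷ rest) = 0≤c ∷ multiplied rest
    multiply-η : ∀ terms → η (combination-poly (List.map multiply terms)) ≋ η (gen i) * η (combination-poly terms)
    multiply-η []                 = trans η-0 (trans (sym (zeroʳ _)) (*-congˡ (sym η-0)))
    multiply-η ((c , λ′) ∷ terms) = trans (η-⊞ (con c ⊠ P′) (combination-poly (List.map multiply terms)))
      (trans (+-cong (trans (η-⊠ (con c) P′) (trans (*-congˡ (product-insert-part i λ′))
          (trans (x∙yz≈y∙xz _ _ _) (*-congˡ (sym (η-⊠ (con c) P)))))) (multiply-η terms))
        (trans (sym (distribˡ _ _ _)) (*-congˡ (sym (η-⊞ (con c ⊠ P) (combination-poly terms))))))
      where
      P  = product-poly (parts λ′)
      P′ = product-poly (parts (insert-part i λ′))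

  positive-∑ : ∀ {X : Set} (σ : Vec X k) {f} → (∀ z → z ∈ σ → Positive (f z)) → Positive (∑ σ f)
  positive-∑ []      pos = positive-0
  positive-∑ (x ∷ σ) pos = positive-+ (pos x (here ≡.refl)) (positive-∑ σ λ z z∈ → pos z (there z∈))

  -- The entry i starts a new chain unless i − 1 is an older entry.
  chain-start : ℕ → Vec ℕ k → Carrier
  chain-start i σ = if does ((i ∸ 1) ∈? σ) then 1# else ε (i ∸ 1)

  chain-start-∈ : ∀ {i} {σ : Vec ℕ k} → i ∸ 1 ∈ σ → chain-start i σ ≡ 1#
  chain-start-∈ {i = i} {σ} i∈ with (i ∸ 1) ∈? σ
  ... | yes _ = ≡.refl
  ... | no i∉ = contradiction i∈ i∉

  chain-start-∉ : ∀ {i} {σ : Vec ℕ k} → i ∸ 1 ∉ σ → chain-start i σ ≡ ε (i ∸ 1)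
  chain-start-∉ {i = i} {σ} i∉ with (i ∸ 1) ∈? σ
  ... | yes i∈ = contradiction i∈ i∉
  ... | no _   = ≡.refl

  -- The product of e_{i-1} over the starts i of chains: a common denominator for whatever the
  -- remaining operations yield.
  chains : Vec ℕ k → Carrier
  chains []      = 1#
  chains (i ∷ σ) = chain-start i σ * chains σ

  ∈-∷ʳ⁻ : ∀ {k} (σ : Vec ℕ k) {z j} → z ∈ σ ∷ʳ j → z ≢ j → z ∈ σ
  ∈-∷ʳ⁻ []      (here p)  z≢j = contradiction p z≢j
  ∈-∷ʳ⁻ (s ∷ σ) (here p)  z≢j = here p
  ∈-∷ʳ⁻ (s ∷ σ) (there p) z≢j = there (∈-∷ʳ⁻ σ p z≢j)

  chain-start-∷ʳ : ∀ t (σ : Vec ℕ k) j → t ∸ 1 ≢ j → chain-start t (σ ∷ʳ j) ≡ chain-start t σ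
  chain-start-∷ʳ t σ j t-1≢j with (t ∸ 1) ∈? σ
  ... | yes p = chain-start-∈ {i = t} (∈-∷ʳ-init p)
  ... | no ¬p = chain-start-∉ {i = t} λ p → ¬p (∈-∷ʳ⁻ σ p t-1≢j)

  pred≢ : ∀ {i} t → 0 ≢ t → suc i ≢ t → t ∸ 1 ≢ i
  pred≢ zero    0≢t _     _      = 0≢t ≡.refl
  pred≢ (suc t) _   i+1≢t ≡.refl = i+1≢t ≡.refl

  -- The oldest entry i always starts a chain, and without an entry i + 1 no other start depends on
  -- it.
  chains-∷ʳ-∉ : ∀ (σ : Vec ℕ k) i → VecAll.All (0 ≢_) σ → suc i ∉ σ → chains (σ ∷ʳ i) ≋ ε (i ∸ 1) * chains σ
  chains-∷ʳ-∉ []      i _  _    = *-congʳ (reflexive (chain-start-∉ {i = i} {[]} λ ()))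
  chains-∷ʳ-∉ (t ∷ σ) i (t≢0 VecAll.∷ 0∉) i+1∉ = trans
    (*-cong (reflexive (chain-start-∷ʳ t σ i (pred≢ t t≢0 λ eq → i+1∉ (here eq))))
      (chains-∷ʳ-∉ σ i 0∉ λ p → i+1∉ (there p)))
    (x∙yz≈y∙xz _ _ _)

  -- If i + 1 occurs in σ, then i takes over its role as the start of the chain.
  chains-∷ʳ-∈ : ∀ (σ : Vec ℕ k) i → Valid (σ ∷ʳ i) → suc i ∈ σ →
                Σ Carrier λ c → chains (σ ∷ʳ i) ≋ ε (i ∸ 1) * c × chains σ ≋ ε i * c
  chains-∷ʳ-∈ (t ∷ σ) i v i+1∈ with suc i ℕ.≟ t
  chains-∷ʳ-∈ (t ∷ σ) i ((_ VecAll.∷ 0∉) ∷ (t∉ ∷ u)) i+1∈ | yes ≡.refl = chains σ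
    , trans (*-cong (reflexive (chain-start-∈ {i = suc i} (∈-∷ʳ-last σ)))
        (chains-∷ʳ-∉ σ i (proj₁ (All-∷ʳ⁻ σ 0∉)) (All⇒∉ (proj₁ (All-∷ʳ⁻ σ t∉))))) (*-identityˡ _)
    , *-congʳ (reflexive (chain-start-∉ {i = suc i} {σ} (proj₂ (Unique-∷ʳ⁻ σ u))))
  chains-∷ʳ-∈ (t ∷ σ) i v (here eq) | no i+1≢t = contradiction eq i+1≢t
  chains-∷ʳ-∈ (t ∷ σ) i ((t≢0 VecAll.∷ 0∉) ∷ (_ ∷ u)) (there i+1∈) | no i+1≢t with chains-∷ʳ-∈ σ i (0∉ ∷ u) i+1∈
  ... | c , eq₁ , eq₂ = chain-start t σ * c
    , trans (*-cong (reflexive (chain-start-∷ʳ t σ i (pred≢ t t≢0 i+1≢t))) eq₁) (x∙yz≈y∙xz _ _ _)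
    , trans (*-congˡ eq₂) (x∙yz≈y∙xz _ _ _)

  -- The value alone is a fraction; `chains` clears its denominator. Marking z + 1 extends the chain
  -- of z, or starts one with e₀ = 1 if z = 0. Forgetting i turns e_{i-1} into e_i, which is the
  -- start factor of i + 1 if that entry is present and otherwise stays as a positive factor.
  positive-value : ∀ (w : Word k) σ → Valid σ → Positive (value w σ * chains σ)
  positive-value end        [] v = positive-cong (sym (*-identityˡ 1#)) positive-1
  positive-value (mark w)   σ  v = positive-cong
    (trans (∑-*ˡ (0 ∷ σ) (chains σ) (λ z → weight z σ • value w (suc z ∷ σ))) (*-comm _ _))
    (positive-∑ (0 ∷ σ) each)
    where
    each : ∀ z → z ∈ 0 ∷ σ → Positive (chains σ * (weight z σ • value w (suc z ∷ σ)))
    each z z∈ with suc z ∈? (0 ∷ σ)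
    ... | yes z+1∈ = positive-cong (sym (trans (*-congˡ (•-zero _ (weight-vanishes z+1∈))) (zeroʳ _))) positive-0
    ... | no z+1∉  = positive-cong
      (trans (*-congˡ (*-congˡ (trans (*-congʳ (start z∈)) (*-identityˡ _))))
        (solve 3 (λ c q f → q :* (f :* c) := c :* (q :* f)) refl (chains σ) (ι (weight z σ)) (value w (suc z ∷ σ))))
      (positive-• (weight-nonNegative z σ) (positive-value w (suc z ∷ σ) (Valid-∷ v z+1∉)))
      where
      start : z ∈ 0 ∷ σ → chain-start (suc z) σ ≋ 1#
      start (here ≡.refl) = trans (reflexive (chain-start-∉ {i = 1} {σ} (All⇒∉ (Valid⇒0∉ v)))) ε-0
      start (there z∈σ) = reflexive (chain-start-∈ {i = suc z} z∈σ)
  positive-value {suc k} (unmark w) = ∷ʳ-elim _ step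
    where
    step : ∀ σ i → Valid (σ ∷ʳ i) → Positive (D* (value w) (σ ∷ʳ i) * chains (σ ∷ʳ i))
    step σ zero    v = contradiction (here ≡.refl) (proj₂ (Valid-∷ʳ⁻ σ v))
    step σ (suc i) v with suc (suc i) ∈? σ
    ... | yes p = positive-cong (sym (trans (*-congʳ (D*-∷ʳ (value w) σ (suc i)))
      (trans (solve 3 (λ r f c → (r :* f) :* c := f :* (r :* c)) refl _ _ _) (*-congˡ cancel))))
        (positive-value w σ vσ)
      where
      vσ = proj₁ (Valid-∷ʳ⁻ σ v)
      cancel : ratio (suc i) * chains (σ ∷ʳ suc i) ≋ chains σ
      cancel with chains-∷ʳ-∈ σ (suc i) v p
      ... | c , eq₁ , eq₂ = trans (*-congˡ eq₁)
           (trans (sym (*-assoc _ _ _)) (trans (*-congʳ (ratio-gen i)) (sym eq₂)))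
    ... | no ¬p = positive-cong (sym
         (trans (*-cong (D*-∷ʳ (value w) σ (suc i)) (chains-∷ʳ-∉ σ (suc i) (Valid⇒0∉ vσ) ¬p))
      (trans (solve 4 (λ r f ε c → (r :* f) :* (ε :* c) := (r :* ε) :* (f :* c)) refl _ _ _ _)
        (*-congʳ (ratio-gen i)))))
      (positive-gen (suc i) (positive-value w σ vσ))
      where
      vσ = proj₁ (Valid-∷ʳ⁻ σ v)

-- The operators on formal combinations, paired with functionals

open import Algebra.Properties.CommutativeMonoid.Sum ℚ.*-1-commutativeMonoid
  using () renaming (sum to product)

open I using (entries)

-- The proofs stored in `I` are irrelevant, but validity is decidable and can be recomputed.
valid : (σ : I k) → Valid (entries σ)
valid record { entries = σ ; positive = p ; distinct = d } = recompute
  (allPairs? (λ x y → ¬? (x ℕ.≟ y)) (0 ∷ σ)) (0∉ p ∷ d)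
  where
  0∉ : ∀ {k} {σ : Vec ℕ k} → VecAll.All NonZero σ → VecAll.All (0 ≢_) σ
  0∉ []              = []
  0∉ {σ = suc s ∷ σ} (_ ∷ rest) = (λ ()) ∷ 0∉ rest

-- The phantom factor β⊖ z 0 is the leading (z + 1)/z of `A-next` if z > 0, and 1 if z = 0.
weight-product : ∀ z (σ : Vec ℕ k) (f : Fin k → ℚ) → (∀ r → f r ≡ β⊖ z (lookup σ r)) →
                 product f ℚ.* β⊖ z 0 ≡ weight z σ
weight-product z []      f f≡β = ℚ.*-identityˡ _
weight-product z (s ∷ σ) f f≡β = ≡.trans (ℚ.*-assoc (f zero) (product (f ∘ suc)) (β⊖ z 0))
  (≡.cong₂ ℚ._*_ (f≡β zero) (weight-product z σ (f ∘ suc) (f≡β ∘ suc)))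

lookup-≢0 : ∀ {σ : Vec ℕ k} → VecAll.All (0 ≢_) σ → ∀ r → 0 ≢ lookup σ r
lookup-≢0 (p ∷ _)    zero    = p
lookup-≢0 (_ ∷ rest) (suc r) = lookup-≢0 rest r

lookup-injective : ∀ {σ : Vec ℕ k} → Unique σ → ∀ r r′ → r′ ≢ r → lookup σ r ≢ lookup σ r′
lookup-injective (p ∷ u) zero    zero     r≢ _  = r≢ ≡.refl
lookup-injective {σ = s ∷ σ} (p ∷ u) zero (suc r′) _ eq = All⇒∉ p (≡.subst (_∈ σ) (≡.sym eq) (∈-lookup r′ σ))
lookup-injective {σ = s ∷ σ} (p ∷ u) (suc r) zero _ eq = All⇒∉ p (≡.subst (_∈ σ) eq (∈-lookup r σ))
lookup-injective (p ∷ u) (suc r) (suc r′) r≢ eq = lookup-injective u r r′ (r≢ ∘ ≡.cong suc) eq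

÷-β⊖ : ∀ z s → z ≢ s → (+ z ℤ.- + s ℤ.+ + 1) ÷ (+ z ℤ.- + s) ≡ β⊖ z s
÷-β⊖ z s z≢s = ≡.trans (≡.cong (λ d → (d ℤ.+ + 1) ÷ d) (≡.sym (⊖-minus z s))) (÷-β (z ⊖ s) (⊖≢0 z≢s))

÷-β⊖-0 : ∀ s → 0 ≢ s → (+ s ℤ.- + 1) ÷ (+ s) ≡ β⊖ 0 s
÷-β⊖-0 zero    0≢s = contradiction ≡.refl 0≢s
÷-β⊖-0 (suc s) _   = ≡.trans (÷-κ (+ suc s ℤ.- + 1) (+ suc s)) (≡.trans
  (≡.cong (ℚ._* κ (+ suc s)) (fromℤ-+ (+ suc s) (ℤ.- + 1)))
  (≡.trans (solve 2 (λ x y → (x :- con 1ℚ) :* y := x :* y :- y) ≡.refl (fromℤ (+ suc s)) (κ (+ suc s)))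
    (≡.cong (ℚ._- κ (+ suc s)) (fromℤ*κ (+ suc s) λ ()))))
  where open ℚ-Solver

A-one-weight : (σ : I k) → A-one σ ≡ weight 0 (entries σ)
A-one-weight σ with valid σ
... | 0∉ ∷ _ = ≡.trans (≡.sym (ℚ.*-identityʳ _)) (weight-product 0 (entries σ) _ λ r → ÷-β⊖-0 _ (lookup-≢0 0∉ r))

A-next-weight : (σ : I k) (r : Fin k) → A-next σ r ≡ weight (lookup (entries σ) r) (entries σ)
A-next-weight σ r with valid σ
... | 0∉ ∷ u = ≡.trans (ℚ.*-comm ((+ s r ℤ.+ + 1) ÷ (+ s r)) (product factor)) (≡.trans
  (≡.cong (product factor ℚ.*_) (÷-β (+ s r) λ p → lookup-≢0 0∉ r (≡.sym (ℤ.+-injective p))))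
  (weight-product (s r) (entries σ) factor factor-β⊖))
  where
  s = lookup (entries σ)
  factor : Fin _ → ℚ
  factor r′ = if does (r′ Fin.≟ r) then 1ℚ else (+ s r ℤ.- + s r′ ℤ.+ + 1) ÷ (+ s r ℤ.- + s r′)
  factor-β⊖ : ∀ r′ → factor r′ ≡ β⊖ (s r) (s r′)
  factor-β⊖ r′ with r′ Fin.≟ r
  ... | yes ≡.refl = ≡.sym (β⊖-refl (s r))
  ... | no r′≢r    = ÷-β⊖ (s r) (s r′) (lookup-injective u r r′ r′≢r)

A-weight : (σ : I k) (z : ℕ) → z ∈ 0 ∷ entries σ → A (suc z) σ ≡ weight z (entries σ)
A-weight σ zero    _ = A-one-weight σ
A-weight σ (suc z) (there z∈) with Fin.any? (λ r → suc (suc z) ℕ.≟ lookup (entries σ) r ℕ.+ 1)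
... | yes (r , eq) = ≡.trans (A-next-weight σ r) (≡.cong (λ t → weight t (entries σ))
  (ℕ.suc-injective (≡.sym (≡.trans eq (ℕ.+-comm _ 1)))))
... | no none = contradiction (VecAny.index z∈ , ≡.trans (≡.cong suc (lookup-index z∈)) (ℕ.+-comm 1 _)) none

weight-reverse : ∀ z (σ : Vec ℕ k) → weight z (reverse σ) ≡ weight z σ
weight-reverse z []      = ≡.refl
weight-reverse z (s ∷ σ) = ≡.trans (≡.cong (weight z) (reverse-∷ s σ))
  (≡.trans (weight-∷ʳ z (reverse σ) s) (≡.cong (β⊖ z s ℚ.*_) (weight-reverse z σ)))

reverse-∷ʳ : ∀ {X : Set} (σ : Vec X k) y → reverse (σ ∷ʳ y) ≡ y ∷ reverse σ
reverse-∷ʳ []      y = ≡.refl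
reverse-∷ʳ (s ∷ σ) y = ≡.trans (reverse-∷ s (σ ∷ʳ y))
  (≡.trans (≡.cong (_∷ʳ s) (reverse-∷ʳ σ y)) (≡.cong (y ∷_) (≡.sym (reverse-∷ s σ))))

module Pairing (K : ℚ-Algebra) (evaluation : Evaluation K) where
  open ℚ-Algebra K
  open Evaluation evaluation
  open Representation K evaluation
  open Sums K

  -- Marked entries are listed oldest first in I k, newest first in Functional k.
  pairing : V k → Functional k → Carrier
  pairing []            f = 0#
  pairing ((c , σ) ∷ x) f = τ c * f (reverse (entries σ)) + pairing x f

  pairing-++ : (x y : V k) (f : Functional k) → pairing (x ++ y) f ≋ pairing x f + pairing y f
  pairing-++ []            y f = sym (+-identityˡ _)
  pairing-++ ((c , σ) ∷ x) y f = trans (+-congˡ (pairing-++ x y f)) (sym (+-assoc _ _ _))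

  pairing-· : ∀ c (x : V k) (f : Functional k) → pairing (c · x) f ≋ τ c * pairing x f
  pairing-· c []            f = sym (zeroʳ _)
  pairing-· c ((d , σ) ∷ x) f = trans (+-cong (trans (*-congʳ (τ-* c d)) (*-assoc _ _ _)) (pairing-· c x f))
    (sym (distribˡ _ _ _))

  pairing-b : (σ : I k) (f : Functional k) → pairing (b σ) f ≋ f (reverse (entries σ))
  pairing-b σ f = trans (+-identityʳ _) (trans (*-congʳ (trans (τ-con 1ℚ) ι-1)) (*-identityˡ _))

  pairing-·b : ∀ c (σ : I k) (f : Functional k) → pairing (c · b σ) f ≋ τ c * f (reverse (entries σ))
  pairing-·b c σ f = trans (pairing-· c (b σ) f) (*-congˡ (pairing-b σ f))

  pairing-linear : ∀ {l} (g : I k → V l) (f : Functional l) (h : Functional k) →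
    (∀ σ → pairing (g σ) f ≋ h (reverse (entries σ))) → ∀ x → pairing (linear g x) f ≋ pairing x h
  pairing-linear g f h eq []            = refl
  pairing-linear g f h eq ((c , σ) ∷ x) = trans (pairing-++ (c · g σ) (linear g x) f)
    (+-cong (trans (pairing-· c (g σ) f) (*-congˡ (eq σ))) (pairing-linear g f h eq x))

  pairing-D : (x : V (suc k)) (f : Functional k) → pairing (D x) f ≋ pairing x (D* f)
  pairing-D x f = pairing-linear (λ σ → let (s , σ′) = uncons σ in e-ratio s (s ∸ 1) · b σ′) f (D* f) step x
    where
    step : ∀ σ → pairing (let (s , σ′) = uncons σ in e-ratio s (s ∸ 1) · b σ′) f ≋ D* f (reverse (entries σ))
    step ρ@record { entries = s ∷ σ } = trans (pairing-·b (e-ratio s (s ∸ 1)) (proj₂ (uncons ρ)) f)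
      (trans (*-congʳ (sym (ratio-τ s)))
        (trans (sym (D*-∷ʳ f (reverse σ) s)) (reflexive (≡.cong (D* f) (≡.sym (reverse-∷ s σ))))))

  -- A value already present is omitted by `summand`, and its weight is 0.
  pairing-summand : (σ : I k) (f : Functional (suc k)) (z : ℕ) → z ∈ 0 ∷ entries σ →
                    pairing (summand σ z) f ≋ weight z (reverse (entries σ)) • f (suc z ∷ reverse (entries σ))
  pairing-summand σ f z z∈ with suc z ∈? entries σ
  ... | yes p = sym (•-zero _ (≡.trans (weight-reverse z (entries σ)) (weight-vanishes (there p))))
  ... | no p  = trans (pairing-·b (fromℚ (A (suc z) σ)) (append σ (suc z) p) f) (*-cong
    (trans (τ-con (A (suc z) σ)) (ι-cong (≡.trans (A-weight σ z z∈) (≡.sym (weight-reverse z (entries σ))))))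
    (reflexive (≡.cong f (reverse-∷ʳ (entries σ) (suc z)))))

  ∑-reverse : ∀ {X : Set} (σ : Vec X k) (f : X → Carrier) → ∑ (reverse σ) f ≋ ∑ σ f
  ∑-reverse []      f = refl
  ∑-reverse (s ∷ σ) f = trans (reflexive (≡.cong (λ ρ → ∑ ρ f) (reverse-∷ s σ)))
    (trans (∑-∷ʳ (reverse σ) s f) (trans (+-comm _ _) (+-congˡ (∑-reverse σ f))))

  pairing-concatMap : ∀ {l} (σ : I l) (f : Functional (suc l)) (zs : Vec ℕ k) → (∀ {z} → z ∈ zs → z ∈ 0 ∷ entries σ) →
    pairing (concatMap (summand σ) (toList zs)) f ≋ ∑[ z ∈ zs ]
      (weight z (reverse (entries σ)) • f (suc z ∷ reverse (entries σ)))
  pairing-concatMap σ f []       zs⊆ = refl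
  pairing-concatMap σ f (z ∷ zs) zs⊆ = trans (pairing-++ (summand σ z) _ f)
    (+-cong (pairing-summand σ f z (zs⊆ (here ≡.refl))) (pairing-concatMap σ f zs (zs⊆ ∘ there)))

  pairing-M : (x : V k) (f : Functional (suc k)) → pairing (M x) f ≋ pairing x (M* f)
  pairing-M x f = pairing-linear (λ σ → concatMap (summand σ) (0 ∷ toList (entries σ))) f (M* f)
    (λ σ → trans (pairing-concatMap σ f (0 ∷ entries σ) (λ z∈ → z∈)) (+-congˡ (sym (∑-reverse (entries σ) _)))) x

  pairing-forget : ∀ d (x : V k) (w : Word (k ∸ d)) → pairing (forget d x) (value w) ≋
    pairing x (value (forgetWord d w))
  pairing-forget             zero    x w = refl
  pairing-forget {k = zero}  (suc d) x w = refl
  pairing-forget {k = suc k} (suc d) x w = trans (pairing-forget d (D x) w) (pairing-D x (value (forgetWord d w)))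

  pairing-forgetAll : (x : V k) → pairing (forgetAll x) (value end) ≋ pairing x (value forgetAllWord)
  pairing-forgetAll {k = zero}  x = refl
  pairing-forgetAll {k = suc k} x = trans (pairing-forgetAll (D x)) (pairing-D x (value forgetAllWord))

  pairing-scalar : (x : V 0) → τ (scalar x) ≋ pairing x (value end)
  pairing-scalar []            = trans (τ-con 0ℚ) ι-0
  pairing-scalar ((c , σ) ∷ x) = trans (τ-+ c (scalar x)) (+-cong (sym (*-identityʳ _)) (pairing-scalar x))

  module _ {n : ℕ} (G : Graph n) (nui : NaturalUnitInterval G) where

    -- Each operation of `build` is moved across the pairing to its transpose.
    pairing-build : ∀ {s} m (g : Fin m → Fin n) (x : V s) →
      τ (scalar (build G (List.tabulate g) x)) ≋ pairing x (value (buildWord m (degree G nui ∘ g)))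
    pairing-build         zero    g x = trans (pairing-scalar (forgetAll x)) (pairing-forgetAll x)
    pairing-build {s = s} (suc m) g x = trans (pairing-build m (g ∘ suc) (M (forget d x)))
      (trans (pairing-M (forget d x) (value w)) (pairing-forget d x (mark w)))
      where
      d = s ∸ degree G nui (g zero)
      w = buildWord m (degree G nui ∘ g ∘ suc)

    M-value : τ M[ G ,∅,∅] ≋ value (buildWord n (degree G nui)) []
    M-value = trans (pairing-build n (λ v → v) (b ∅)) (pairing-b ∅ (value (buildWord n (degree G nui))))

-- Comparison of both sides through a polynomial in the eᵢ

module Comparison (K : ℚ-Algebra) (evaluation : Evaluation K) {n : ℕ} (G : Graph n)
  (nui : NaturalUnitInterval G) where
  open ℚ-Algebra K
  open Evaluation evaluation
  open Representation K evaluation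
  open Positivity K evaluation
  open Pairing K evaluation

  X-polynomial : Σ ℚ[e] λ P → η P ≋ τ M[ G ,∅,∅] × ⟦ P ⟧ ≈ X G
  X-polynomial = let (P , P≃ , P≈) = represents (buildWord n (degree G nui)) [] in
    -- The coefficient at α is compared in `length α` variables.
    P , trans P≃ (sym (M-value G nui)) , λ α → ≡.trans (P≈ (length α) α ≡.refl)
      (≡.sym (X-value G nui (length α) α ≡.refl))

  M-positive : Positive (τ M[ G ,∅,∅])
  M-positive = positive-cong (trans (*-identityʳ _) (sym (M-value G nui)))
    (positive-value (buildWord n (degree G nui)) [] ([] ∷ []))

identity : Evaluation fractionAlgebra
identity = record
  { τ       = λ φ → φ
  ; τ-cong  = λ _ _ φ≃ψ → φ≃ψ
  ; τ-con   = λ _ _ → ≡.refl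
  ; τ-+     = λ _ _ _ → ≡.refl
  ; τ-*     = λ _ _ _ → ≡.refl
  ; η       = polynomial
  ; η-τ     = λ _ _ → ≡.refl
  ; ratio   = λ s → e-ratio s (s ∸ 1)
  ; ratio-τ = λ _ _ → ≡.refl
  }

≈ᶠ-polynomial : ∀ {F} φ P → polynomial P ≃ φ → ⟦ P ⟧ ≈ F → F ≈ᶠ φ
≈ᶠ-polynomial {F} φ P P≃φ P≈F =
  ≈-trans {F ⊗ ⟦ den ⟧} {⟦ P ⟧ ⊗ ⟦ den ⟧} {⟦ num ⟧} (⊗-congʳ {F} {⟦ P ⟧} ⟦ den ⟧ λ α → ≡.sym (P≈F α))
    (≈-trans {⟦ P ⟧ ⊗ ⟦ den ⟧} {⟦ num ⟧ ⊗ const 1ℚ} {⟦ num ⟧} P≃φ (ℚ-Algebra.*-identityʳ seriesAlgebra ⟦ num ⟧))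
  where open ℚ⟨e⟩ φ using (num; den)

-- Polynomials that agree as fractions agree as series, by cancellation of denominators.
≈-combination : ∀ {F} φ P terms → polynomial P ≃ φ → ⟦ P ⟧ ≈ F →
  polynomial (combination-poly terms) ≃ φ → F ≈ e-combination terms
≈-combination φ P terms P≃φ P≈F terms≃φ α = ≡.trans (≡.sym (P≈F α)) (≡.trans
  (polynomial-injective P (combination-poly terms)
    (≃-trans {polynomial P} {φ} {polynomial (combination-poly terms)} P≃φ
      (ℚ-Algebra.sym fractionAlgebra {polynomial (combination-poly terms)} {φ} terms≃φ)) α)
  (≡.cong (λ F → F α) (⟦combination-poly⟧ terms)))

theorem23 : (n : ℕ) (G : Graph n) → NaturalUnitInterval G →
    X G ≈ᶠ M[ G ,∅,∅] × EPositive (X G)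
theorem23 n G nui = let
    (P , P≃M , P≈X) = Comparison.X-polynomial fractionAlgebra identity G nui
    (terms , c≥0 , terms≃M) = Comparison.M-positive fractionAlgebra identity G nui
  in ≈ᶠ-polynomial {X G} M[ G ,∅,∅] P P≃M P≈X
   , terms , c≥0 , ≈-combination {X G} M[ G ,∅,∅] P terms P≃M P≈X terms≃M
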